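{- Let $q = p^r$ with $q \equiv 1 \pmod 4$, let $\ell \neq p$ be prime, and assume $r \le 4$ or $\ell > (q-1)/2$. Let $\alpha, \beta$ be voltage assignments and suppose $X^\alpha$ and $X^\beta$ are isomorphic as graphs. Then there exists a graph isomorphism $f \colon X^\alpha \to X^\beta$ of the form $f(x,i) = (t x^\sigma, n i)$ for some $t \in \mathbf{F}_q^{\boxtimes}$, $\sigma \in \mathrm{Gal}(\mathbf{F}_q/\mathbf{F}_p)$, $n \in (\mathbf{Z}/\ell)^\times$. Moreover, $n\alpha(s) = \beta(t s^\sigma)$ for all $s \in \mathbf{F}_q^{\boxtimes}$, and $X^{n\alpha}$ and $X^\beta$ are isomorphic as $\mathbf{Z}/\ell$-covering graphs.
   Context: $\mathbf{F}_q^{\boxtimes}$ is the set of nonzero squares in $\mathbf{F}_q$. A voltage assignment is a function $\alpha \colon \mathbf{F}_q^{\boxtimes} \to \mathbf{Z}/\ell$, not identically zero, with $\alpha(-s) = -\alpha(s)$ for all $s$. The graph $X^\alpha$ has vertex set $\mathbf{F}_q \times \mathbf{Z}/\ell$, with an edge between $(x,i)$ and $(y,j)$ iff $y-x \in \mathbf{F}_q^{\boxtimes}$ and $j - i = \alpha(y-x)$; it is a $\mathbf{Z}/\ell$-cover of the Paley graph $X(\mathbf{F}_q)$ via $(x,i)\mapsto x$, with $\mathbf{Z}/\ell$ acting by $(x,i)\mapsto(x,i+1)$. For $n \in (\mathbf{Z}/\ell)^\times$, $n\alpha$ denotes $s \mapsto n\alpha(s)$. An isomorphism of $\mathbf{Z}/\ell$-covering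 graphs $X^\alpha \to X^\beta$ is a graph isomorphism $f$ with $f(x,i+1) = f(x,i)+(0,1)$ for all $(x,i)$. -}

module Defs where

open import Data.Nat as ℕ using (ℕ; zero; suc)
open import Data.Nat.DivMod using (_mod_)
open import Data.Fin using (Fin; toℕ)
open import Data.Product using (Σ; ∃; _×_; _,_; proj₁; proj₂)
open import Relation.Binary.PropositionalEquality using (_≡_; _≢_)
open import Relation.Nullary using (¬_)
open import Function.Bundles using (_↔_; _⇔_; Inverse)

record Field : Set₁ where
  infixl 6 _+_
  infixl 7 _*_
  infix 8 -_
  field
    Carrier : Set
    0# 1# : Carrier
    _+_ _*_ : Carrier → Carrier → Carrier
    -_ : Carrier → Carrier
    +-assoc : ∀ x y z → (x + y) + z ≡ x + (y + z)
    +-comm : ∀ x y → x + y ≡ y + x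
    +-identityˡ : ∀ x → 0# + x ≡ x
    +-inverseˡ : ∀ x → (- x) + x ≡ 0#
    *-assoc : ∀ x y z → (x * y) * z ≡ x * (y * z)
    *-comm : ∀ x y → x * y ≡ y * x
    *-identityˡ : ∀ x → 1# * x ≡ x
    distribˡ : ∀ x y z → x * (y + z) ≡ x * y + x * z
    0≢1 : 0# ≢ 1#
    *-inverse : ∀ x → x ≢ 0# → ∃ λ y → x * y ≡ 1#

HasCard : Field → ℕ → Set
HasCard F q = Fin q ↔ Field.Carrier F

_+ℓ_ : ∀ {ℓ} → Fin ℓ → Fin ℓ → Fin ℓ
_+ℓ_ {suc k} a b = (toℕ a ℕ.+ toℕ b) mod suc k

_*ℓ_ : ∀ {ℓ} → Fin ℓ → Fin ℓ → Fin ℓ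
_*ℓ_ {suc k} a b = (toℕ a ℕ.* toℕ b) mod suc k

negℓ : ∀ {ℓ} → Fin ℓ → Fin ℓ
negℓ {suc k} a = (suc k ℕ.∸ toℕ a) mod suc k

incℓ : ∀ {ℓ} → Fin ℓ → Fin ℓ
incℓ {suc k} a = suc (toℕ a) mod suc k

IsUnitℓ : ∀ {ℓ} → Fin ℓ → Set
IsUnitℓ {zero} ()
IsUnitℓ {suc k} n = ∃ λ m → n *ℓ m ≡ (1 mod suc k)

module _ (F : Field) where
  open Field F

  _-F_ : Carrier → Carrier → Carrier
  y -F x = y + (- x)

  NZSq : Carrier → Set
  NZSq s = s ≢ 0# × ∃ λ w → w * w ≡ s

  -- A voltage assignment.  α is given as a function on all of F; only its
  -- values on nonzero squares are ever used.
  IsVoltage : ∀ {ℓ} → (Carrier → Fin ℓ) → Set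
  IsVoltage α =
    (∃ λ s → NZSq s × ¬ (toℕ (α s) ≡ 0)) ×
    (∀ s → NZSq s → α (- s) ≡ negℓ (α s))

  Vertex : ℕ → Set
  Vertex ℓ = Carrier × Fin ℓ

  Adj : ∀ {ℓ} → (Carrier → Fin ℓ) → Vertex ℓ → Vertex ℓ → Set
  Adj α (x , i) (y , j) = NZSq (y -F x) × j ≡ i +ℓ α (y -F x)

  IsGraphIso : ∀ {ℓ} → (α β : Carrier → Fin ℓ) → Vertex ℓ ↔ Vertex ℓ → Set
  IsGraphIso α β f =
    ∀ u v → Adj α u v ⇔ Adj β (Inverse.to f u) (Inverse.to f v)

  GraphIsomorphic : ∀ {ℓ} → (α β : Carrier → Fin ℓ) → Set
  GraphIsomorphic {ℓ} α β = Σ (Vertex ℓ ↔ Vertex ℓ) λ f → IsGraphIso α β f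

  IsEquivariant : ∀ {ℓ} → Vertex ℓ ↔ Vertex ℓ → Set
  IsEquivariant {ℓ} f = ∀ x i →
    Inverse.to f (x , incℓ i) ≡
      (proj₁ (Inverse.to f (x , i)) , incℓ (proj₂ (Inverse.to f (x , i))))

  CoverIsomorphic : ∀ {ℓ} → (α β : Carrier → Fin ℓ) → Set
  CoverIsomorphic {ℓ} α β =
    Σ (Vertex ℓ ↔ Vertex ℓ) λ f → IsGraphIso α β f × IsEquivariant f

  -- σ ∈ Gal(F_q/F_p): a field automorphism (it automatically fixes F_p)
  IsFieldAut : Carrier ↔ Carrier → Set
  IsFieldAut σ =
    (∀ x y → Inverse.to σ (x + y) ≡ Inverse.to σ x + Inverse.to σ y) ×
    (∀ x y → Inverse.to σ (x * y) ≡ Inverse.to σ x * Inverse.to σ y) ×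
    (Inverse.to σ 1# ≡ 1#)

  scaleV : ∀ {ℓ} → Fin ℓ → (Carrier → Fin ℓ) → Carrier → Fin ℓ
  scaleV n α s = n *ℓ α s

{-# OPTIONS --safe #-}
module Submission where

-- X^α is the Cayley graph of the abelian group F × ℤ/ℓ with connection set {(s, α s)}, so its
-- adjacency operator is A = ∑ₛ T₍ₛ,αₛ₎.  For a prime π ≢ p, A^π ≡ ∑ₛ (T₍ₛ,αₛ₎)^π modulo π, whence a graph
-- isomorphism f : X^α → X^β also maps the graph with connection set k·{(s, α s)} to the one with
-- k·{(s, β s)}, for every k prime to p (Schur).  Taking k ≡ 1 mod p and k ≡ u mod ℓ, f is an
-- isomorphism X^{uα} → X^{uβ} for every u ∈ ℤ/ℓ.
--
-- For u = 0 this says that f permutes the levels F × {i} and that each fᵢ : F → F is an automorphism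
-- of the Paley graph, hence x ↦ t x^σ + b (Carlitz).  For α s ≢ 0 and u = 1/α s it compares the
-- levels 0 and 1: with Λ x = t x^σ coming from f₁, c = f₁ 0 - f₀ 0 and ν the difference of the image
-- levels, {β = ν k} = Λ {α = k} + c for all k ≢ 0.  Since α and β are odd, also {β = ν k} = Λ {α = k} - c,
-- so {β = ν k} is invariant under translation by 2c, hence by c, and β (Λ s) = ν α s.
--
-- Carlitz' theorem: let m = (q - 1)/2 and h = (p - 1)/2.  From (f x - f y)ᵐ = (x - y)ᵐ and the power
-- sums of F, ∑ₓ (f x)^(m+b) (x - y)ᵐ = - C(m,b) (- f y)^b, so f^b has degree ≤ m whenever
-- C(m,b) ≢ 0 in F.  With b ≤ h and b = h + pʲ this forces a Frobenius twist of f to have degree 1.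

open import Defs
open import Algebra.Bundles using (CommutativeRing; RawRing; Semiring)
import Algebra.Properties.AbelianGroup as AbelianGroupProperties
import Algebra.Properties.CommutativeMonoid.Mult as CommutativeMonoidMult
import Algebra.Properties.CommutativeMonoid.Sum as CommutativeMonoidSum
import Algebra.Properties.CommutativeSemiring.Binomial as CommutativeBinomial
import Algebra.Properties.CommutativeSemiring.Exp as CommutativeExp
import Algebra.Properties.Ring as RingProperties
import Algebra.Properties.Semiring.Binomial as Binomial
import Algebra.Properties.Semiring.Exp as SemiringExp
import Algebra.Properties.Semiring.Mult as SemiringMult
import Algebra.Properties.Semiring.Sum as SemiringSum
import Algebra.Solver.Ring as RingSolver
import Algebra.Solver.Ring.AlmostCommutativeRing as ACR
import Algebra.Solver.Ring.NaturalCoefficients.Default as NatSolver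
open import Algebra.Structures using (IsCommutativeRing)
open import Data.Empty using (⊥; ⊥-elim)
open import Data.Fin as Fin using (Fin; zero; suc; toℕ; fromℕ; fromℕ<; inject₁; punchIn)
import Data.Fin.Properties as Fin
open import Data.List using (List; []; _∷_; map; filter; tabulate; foldr)
open import Data.List.Membership.Propositional using (_∈_; _∉_)
open import Data.List.Membership.Propositional.Properties using (∈-filter⁺; ∈-filter⁻; ∈-tabulate⁺; ∈-map⁺; ∈-map⁻)
open import Data.List.Membership.Propositional.Properties.WithK using (unique∧set⇒bag)
open import Data.List.Properties using (map-∘; map-cong)
open import Data.List.Relation.Binary.BagAndSetEquality using (∼bag⇒↭)
open import Data.List.Relation.Binary.Permutation.Propositional using (_↭_; ↭-sym)
import Data.List.Relation.Binary.Permutation.Propositional.Properties as ↭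
open import Data.List.Relation.Unary.All as All using (All; []; _∷_)
open import Data.List.Relation.Unary.AllPairs using ([]; _∷_)
open import Data.List.Relation.Unary.Any using (here; there)
open import Data.List.Relation.Unary.Unique.Propositional using (Unique)
import Data.List.Relation.Unary.Unique.Propositional.Properties as Unique
open import Data.Maybe using (Maybe; just; nothing)
open import Data.Nat as ℕ using (ℕ; zero; suc; z≤n; s≤s)
open import Data.Nat.Combinatorics using (_C_; nCk+nC[k+1]≡[n+1]C[k+1]; k>n⇒nCk≡0; nC1≡n; nCn≡1; nCk≡nC[n∸k])
open import Data.Nat.Coprimality using (Coprime; prime⇒coprime; coprime-Bézout)
open import Data.Nat.DivMod using (_%_; _/_; _mod_; %-distribˡ-+; %-distribˡ-*; m%n%n≡m%n; [m+kn]%n≡m%n; m<n⇒m%n≡m; m%n<n; n%n≡0; m≡m%n+[m/n]*n)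
open import Data.Nat.Divisibility using (_∣_; divides; ∣⇒≤; ∣1⇒≡1; _∣?_; ∣-trans; *-cancelˡ-∣; *-monoʳ-∣; m∣m*n; n∣m*n; ∣n⇒∣m*n; ∣m+n∣m⇒∣n; m%n≡0⇒n∣m)
open import Data.Nat.GCD using (module Bézout)
open import Data.Nat.ListAction using (sum; product)
open import Data.Nat.ListAction.Properties using (sum-↭)
open import Data.Nat.Primality using (Prime; euclidsLemma; prime⇒nonZero; prime⇒nonTrivial; prime⇒irreducible; ¬prime[0]; ¬prime[1])
open import Data.Nat.Primality.Factorisation using (factorise)
import Data.Nat.Properties as ℕ
import Data.Nat.Tactic.RingSolver as ℕSolver
open import Data.Product using (Σ; ∃; _×_; _,_; proj₁; proj₂)
open import Data.Product.Properties using (≡-dec)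
open import Data.Sum using (_⊎_; inj₁; inj₂)
open import Function using (_∘_; id; mk⇔)
open import Function.Bundles using (_↔_; _⇔_; Equivalence; Inverse; mk↔ₛ′)
open import Level using (0ℓ)
open import Relation.Binary.Definitions using (DecidableEquality; tri<; tri≈; tri>)
open import Relation.Binary.PropositionalEquality
open import Relation.Nullary using (¬_; Dec; yes; no; contradiction)
open import Relation.Nullary.Decidable using (map′; ¬?; _×-dec_; decidable-stable)
open import Relation.Unary using (Decidable)

-- The multiplier k is reached one prime factor at a time, so no prime in a prescribed residue class
-- has to be found. Being 1 modulo p, it leaves every translation by s in F as it was and changes
-- only the voltages. At u = 0 the voltages disappear. Every element of F is a sum of two squares,
-- so the levels are exactly the connected components, which is why f must permute them. The passage
-- from 2c to c rests on 2h + 1 = p: going h times by -2c amounts to c. The obstacle in Carlitz'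
-- theorem is that polynomials count only as functions on F. Since x^q = x, degrees are meaningful
-- only up to q - 1, and a power or Frobenius twist of f may wrap around and lose its apparent
-- degree. Every comparison of degrees therefore comes with a proof that this bound is respected.
-- The exponents h and h + pʲ are chosen because all base-p digits of m equal h, so that Lucas'
-- congruence makes C(m,h) and C(m,h + pʲ) nonzero in F.

-- Binomial coefficients of prime powers.

[1+k]*[1+n]C[1+k]≡[1+n]*nCk : ∀ n k → suc k ℕ.* (suc n C suc k) ≡ suc n ℕ.* (n C k)
[1+k]*[1+n]C[1+k]≡[1+n]*nCk n zero = trans (ℕ.*-identityˡ _) (trans (nC1≡n (suc n)) (sym (ℕ.*-identityʳ (suc n))))
[1+k]*[1+n]C[1+k]≡[1+n]*nCk zero (suc k)
  rewrite k>n⇒nCk≡0 {1} {suc (suc k)} (s≤s (s≤s z≤n)) | k>n⇒nCk≡0 {0} {suc k} (s≤s z≤n) = ℕ.*-zeroʳ k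
[1+k]*[1+n]C[1+k]≡[1+n]*nCk (suc n) (suc k) = begin
  (2 ℕ.+ k) ℕ.* (suc (suc n) C suc (suc k))
    ≡⟨ cong ((2 ℕ.+ k) ℕ.*_) (nCk+nC[k+1]≡[n+1]C[k+1] (suc n) (suc k)) ⟨
  (2 ℕ.+ k) ℕ.* (A ℕ.+ B) ≡⟨ regroup k A B ⟩
  A ℕ.+ (suc k ℕ.* A ℕ.+ (2 ℕ.+ k) ℕ.* B)
    ≡⟨ cong₂ (λ u v → A ℕ.+ (u ℕ.+ v)) ([1+k]*[1+n]C[1+k]≡[1+n]*nCk n k) ([1+k]*[1+n]C[1+k]≡[1+n]*nCk n (suc k)) ⟩
  A ℕ.+ (suc n ℕ.* (n C k) ℕ.+ suc n ℕ.* (n C suc k)) ≡⟨ cong (A ℕ.+_) (ℕ.*-distribˡ-+ (suc n) (n C k) (n C suc k)) ⟨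
  A ℕ.+ suc n ℕ.* (n C k ℕ.+ n C suc k) ≡⟨ cong (λ u → A ℕ.+ suc n ℕ.* u) (nCk+nC[k+1]≡[n+1]C[k+1] n k) ⟩
  suc (suc n) ℕ.* A ∎
  where
  open ≡-Reasoning
  A = suc n C suc k
  B = suc n C suc (suc k)
  regroup : ∀ k A B → (2 ℕ.+ k) ℕ.* (A ℕ.+ B) ≡ A ℕ.+ (suc k ℕ.* A ℕ.+ (2 ℕ.+ k) ℕ.* B)
  regroup = ℕSolver.solve-∀

prime-power-∣ : ∀ {p} → Prime p → ∀ j i c → ¬ p ∣ c → p ℕ.^ j ∣ i ℕ.* c → p ℕ.^ j ∣ i
prime-power-∣ pr zero i c p∤c d = divides i (sym (ℕ.*-identityʳ i))
prime-power-∣ {p} pr (suc j) i c p∤c d with euclidsLemma i c pr (∣-trans (m∣m*n (p ℕ.^ j)) d)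
... | inj₂ p∣c = contradiction p∣c p∤c
... | inj₁ (divides i′ refl) =
  subst (p ℕ.^ suc j ∣_) (ℕ.*-comm p i′) (*-monoʳ-∣ p (prime-power-∣ pr j i′ c p∤c
    (*-cancelˡ-∣ p {{prime⇒nonZero pr}} (subst (p ℕ.^ suc j ∣_) (trans (cong (ℕ._* c) (ℕ.*-comm i′ p)) (ℕ.*-assoc p i′ c)) d))))

-- With P = pʲ, the absorption identity i C(P,i) = P C(P-1,i-1) shows that P would divide i < P if p
-- did not divide C(P,i).
p∣[p^j]Ci : ∀ {p} → Prime p → ∀ j i → 0 ℕ.< i → i ℕ.< p ℕ.^ j → p ∣ (p ℕ.^ j) C i
p∣[p^j]Ci {p} pr j (suc i) _ i<P with p ∣? ((p ℕ.^ j) C suc i)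
... | yes d = d
... | no p∤C with p ℕ.^ j in eq
...   | suc P = contradiction (∣⇒≤ (subst (_∣ suc i) eq (prime-power-∣ pr j (suc i) (suc P C suc i) p∤C
                  (subst₂ _∣_ (sym eq) (sym ([1+k]*[1+n]C[1+k]≡[1+n]*nCk P i)) (m∣m*n (P C i)))))) (ℕ.<⇒≱ i<P)

-- Fields as commutative rings, and a ring normaliser for them.

module FieldRing (F : Field) where
  open Field F

  isCommutativeRing : IsCommutativeRing _≡_ _+_ _*_ -_ 0# 1#
  isCommutativeRing = record
    { isRing = record
      { +-isAbelianGroup = record
        { isGroup = record
          { isMonoid = record
            { isSemigroup = record
              { isMagma = record { isEquivalence = isEquivalence ; ∙-cong = cong₂ _+_ }
              ; assoc = +-assoc }
            ; identity = +-identityˡ , λ x → trans (+-comm x 0#) (+-identityˡ x) }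
          ; inverse = +-inverseˡ , λ x → trans (+-comm x (- x)) (+-inverseˡ x)
          ; ⁻¹-cong = cong -_ }
        ; comm = +-comm }
      ; *-cong = cong₂ _*_
      ; *-assoc = *-assoc
      ; *-identity = *-identityˡ , λ x → trans (*-comm x 1#) (*-identityˡ x)
      ; distrib = distribˡ , λ x y z → trans (*-comm (y + z) x) (trans (distribˡ x y z) (cong₂ _+_ (*-comm x y) (*-comm x z))) }
    ; *-comm = *-comm }

  commutativeRing : CommutativeRing 0ℓ 0ℓ
  commutativeRing = record { isCommutativeRing = isCommutativeRing }

-- The coefficient ring ℤ is represented by formal differences of naturals, so that the
-- normaliser can detect vanishing coefficients although equality in F does not compute.
module FieldSolver (F : Field) where
  open Field F
  open FieldRing F
  open CommutativeRing commutativeRing using (semiring; +-abelianGroup; ring; commutativeSemiring; +-identityʳ; -‿inverseʳ)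
  open RingProperties ring
  open AbelianGroupProperties +-abelianGroup using (⁻¹-∙-comm; ⁻¹-involutive)
  open SemiringMult semiring renaming (_×_ to _×F_)

  private
    module N = NatSolver commutativeSemiring

  cancel : ℕ × ℕ → ℕ × ℕ
  cancel (suc a , suc b) = cancel (a , b)
  cancel x = x

  ℕ² : RawRing 0ℓ 0ℓ
  ℕ² = record
    { Carrier = ℕ × ℕ ; _≈_ = _≡_
    ; _+_ = λ (a , b) (c , d) → cancel (a ℕ.+ c , b ℕ.+ d)
    ; _*_ = λ (a , b) (c , d) → cancel (a ℕ.* c ℕ.+ b ℕ.* d , a ℕ.* d ℕ.+ b ℕ.* c)
    ; -_ = λ (a , b) → (b , a)
    ; 0# = (0 , 0) ; 1# = (1 , 0) }

  almostRing : ACR.AlmostCommutativeRing 0ℓ 0ℓ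
  almostRing = ACR.fromCommutativeRing commutativeRing

  ⟦_⟧ᵈ : ℕ × ℕ → Carrier
  ⟦ a , b ⟧ᵈ = a ×F 1# + - (b ×F 1#)

  -- Agrees with ⟦_⟧ᵈ, but reduces to 0# and 1# on the constants of the solver.
  ⟦_⟧ᶜ : ℕ × ℕ → Carrier
  ⟦ 0 , 0 ⟧ᶜ = 0#
  ⟦ 1 , 0 ⟧ᶜ = 1#
  ⟦ x ⟧ᶜ = ⟦ x ⟧ᵈ

  ⟦⟧ᶜ≡⟦⟧ᵈ : ∀ x → ⟦ x ⟧ᶜ ≡ ⟦ x ⟧ᵈ
  ⟦⟧ᶜ≡⟦⟧ᵈ (0 , 0) = sym (-‿inverseʳ 0#)
  ⟦⟧ᶜ≡⟦⟧ᵈ (1 , 0) = sym (trans (cong (λ u → (1# + 0#) + u) -0#≈0#) (trans (+-identityʳ _) (+-identityʳ _)))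
  ⟦⟧ᶜ≡⟦⟧ᵈ (0 , suc b) = refl
  ⟦⟧ᶜ≡⟦⟧ᵈ (1 , suc b) = refl
  ⟦⟧ᶜ≡⟦⟧ᵈ (suc (suc a) , b) = refl

  private
    -‿expand : ∀ A B X Y → (A + - B) * (X + - Y) ≡ (A * X + B * Y) + - (A * Y + B * X)
    -‿expand A B X Y = begin
      (A + - B) * (X + - Y)
        ≡⟨ N.solve 4 (λ a b c d → (a N.:+ b) N.:* (c N.:+ d) N.:= (a N.:* c N.:+ b N.:* d) N.:+ (a N.:* d N.:+ b N.:* c)) refl A (- B) X (- Y) ⟩
      (A * X + - B * - Y) + (A * - Y + - B * X)
        ≡⟨ cong₂ _+_ (cong (A * X +_) (trans (sym (-‿distribˡ-* B (- Y))) (trans (cong -_ (sym (-‿distribʳ-* B Y))) (⁻¹-involutive _))))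
                     (trans (cong₂ _+_ (sym (-‿distribʳ-* A Y)) (sym (-‿distribˡ-* B X))) (⁻¹-∙-comm _ _)) ⟩
      (A * X + B * Y) + - (A * Y + B * X) ∎
      where open ≡-Reasoning

    ⟦cancel⟧ᵈ : ∀ x → ⟦ cancel x ⟧ᵈ ≡ ⟦ x ⟧ᵈ
    ⟦cancel⟧ᵈ (zero , b) = refl
    ⟦cancel⟧ᵈ (suc a , zero) = refl
    ⟦cancel⟧ᵈ (suc a , suc b) = trans (⟦cancel⟧ᵈ (a , b)) (begin
      A + - B                       ≡⟨ +-identityʳ _ ⟨
      A + - B + 0#                  ≡⟨ cong (A + - B +_) (-‿inverseʳ 1#) ⟨
      A + - B + (1# + - 1#)         ≡⟨ N.solve 4 (λ x y z w → x N.:+ y N.:+ (z N.:+ w) N.:= (z N.:+ x) N.:+ (w N.:+ y)) refl A (- B) 1# (- 1#) ⟩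
      (1# + A) + (- 1# + - B)       ≡⟨ cong (1# + A +_) (⁻¹-∙-comm _ _) ⟩
      (1# + A) + - (1# + B)         ∎)
      where
      open ≡-Reasoning
      A = a ×F 1#
      B = b ×F 1#

    ⟦cancel⟧ᶜ : ∀ x → ⟦ cancel x ⟧ᶜ ≡ ⟦ x ⟧ᵈ
    ⟦cancel⟧ᶜ x = trans (⟦⟧ᶜ≡⟦⟧ᵈ (cancel x)) (⟦cancel⟧ᵈ x)

  morphism : ℕ² ACR.-Raw-AlmostCommutative⟶ almostRing
  morphism = record
    { ⟦_⟧ = ⟦_⟧ᶜ
    ; +-homo = λ x@(a , b) y@(c , d) → begin
        ⟦ cancel (a ℕ.+ c , b ℕ.+ d) ⟧ᶜ ≡⟨ ⟦cancel⟧ᶜ (a ℕ.+ c , b ℕ.+ d) ⟩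
        (a ℕ.+ c) ×F 1# + - ((b ℕ.+ d) ×F 1#)
          ≡⟨ cong₂ (λ u v → u + - v) (×-homo-+ 1# a c) (×-homo-+ 1# b d) ⟩
        (a ×F 1# + c ×F 1#) + - (b ×F 1# + d ×F 1#)
          ≡⟨ cong ((a ×F 1# + c ×F 1#) +_) (sym (⁻¹-∙-comm _ _)) ⟩
        (a ×F 1# + c ×F 1#) + (- (b ×F 1#) + - (d ×F 1#))
          ≡⟨ N.solve 4 (λ x y z w → (x N.:+ y) N.:+ (z N.:+ w) N.:= (x N.:+ z) N.:+ (y N.:+ w)) refl (a ×F 1#) (c ×F 1#) (- (b ×F 1#)) (- (d ×F 1#)) ⟩
        ⟦ a , b ⟧ᵈ + ⟦ c , d ⟧ᵈ ≡⟨ cong₂ _+_ (⟦⟧ᶜ≡⟦⟧ᵈ x) (⟦⟧ᶜ≡⟦⟧ᵈ y) ⟨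
        ⟦ x ⟧ᶜ + ⟦ y ⟧ᶜ ∎
    ; *-homo = λ x@(a , b) y@(c , d) → sym (trans (cong₂ _*_ (⟦⟧ᶜ≡⟦⟧ᵈ x) (⟦⟧ᶜ≡⟦⟧ᵈ y)) (trans (-‿expand _ _ _ _)
        (trans (cong₂ (λ u v → u + - v) (prods a c b d) (prods a d b c)) (sym (⟦cancel⟧ᶜ (a ℕ.* c ℕ.+ b ℕ.* d , a ℕ.* d ℕ.+ b ℕ.* c))))))
    ; -‿homo = λ x@(a , b) → trans (⟦⟧ᶜ≡⟦⟧ᵈ (b , a)) (trans (+-comm _ _)
        (trans (cong (- (a ×F 1#) +_) (sym (⁻¹-involutive _))) (trans (⁻¹-∙-comm _ _) (cong -_ (sym (⟦⟧ᶜ≡⟦⟧ᵈ x))))))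
    ; 0-homo = refl
    ; 1-homo = refl
    }
    where
    open ≡-Reasoning
    prods : ∀ a c b d → (a ×F 1#) * (c ×F 1#) + (b ×F 1#) * (d ×F 1#) ≡ (a ℕ.* c ℕ.+ b ℕ.* d) ×F 1#
    prods a c b d = sym (trans (×-homo-+ 1# (a ℕ.* c) (b ℕ.* d)) (cong₂ _+_ (×1-homo-* a c) (×1-homo-* b d)))

  private
    _≟ᶜ_ : ∀ x y → Maybe (⟦ x ⟧ᶜ ≡ ⟦ y ⟧ᶜ)
    x ≟ᶜ y with ≡-dec ℕ._≟_ ℕ._≟_ x y
    ... | yes e = just (cong ⟦_⟧ᶜ e)
    ... | no _  = nothing

  open RingSolver ℕ² almostRing morphism _≟ᶜ_ public
    using (solve; _:=_; _:+_; _:*_; _:-_; :-_; con)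

  :1 : ∀ {n} → RingSolver.Polynomial ℕ² almostRing morphism _≟ᶜ_ n
  :1 = con (1 , 0)

  :0 : ∀ {n} → RingSolver.Polynomial ℕ² almostRing morphism _≟ᶜ_ n
  :0 = con (0 , 0)

-- Powers of sums modulo a prime, and Schur's multiplier argument.

module Freshman {a ℓ} (S : Semiring a ℓ) where
  open Semiring S hiding (zero; setoid) renaming (refl to ≈-refl; sym to ≈-sym; trans to ≈-trans)
  open SemiringSum S renaming (sum to ∑)
  open SemiringMult S renaming (_×_ to _×S_)
  open SemiringExp S
  open CommutativeMonoidMult +-commutativeMonoid using (×-distrib-+)
  open import Relation.Binary.Reasoning.Setoid (Semiring.setoid S)

  ×-zeroʳ : ∀ c → c ×S 0# ≈ 0#
  ×-zeroʳ zero    = ≈-refl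
  ×-zeroʳ (suc c) = ≈-trans (+-identityˡ _) (×-zeroʳ c)

  ∑-multiples : ∀ c n (t : Fin n → Carrier) → (∀ i → ∃ λ z → t i ≈ c ×S z) → ∃ λ z → ∑ t ≈ c ×S z
  ∑-multiples c zero t h = 0# , ≈-sym (×-zeroʳ c)
  ∑-multiples c (suc n) t h with h zero | ∑-multiples c n (t ∘ suc) (h ∘ suc)
  ... | z , e | z′ , e′ = z + z′ , ≈-trans (+-cong e e′) (≈-sym (×-distrib-+ z z′ c))

  -- Serves both for operators on ℕ-valued functions and for F. A semiring has no subtraction, so
  -- the congruence modulo p is expressed by an explicit multiple `p ×S z` on one side.
  [x+y]^p : ∀ {p} → Prime p → ∀ x y → x * y ≈ y * x → ∃ λ z → (x + y) ^ p ≈ x ^ p + y ^ p + p ×S z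
  [x+y]^p {zero} pr x y comm = contradiction pr ¬prime[0]
  [x+y]^p {p@(suc p-1)} pr x y comm = proj₁ middle , (begin
    (x + y) ^ p                               ≈⟨ theorem comm p ⟩
    t zero + ∑ (t ∘ suc)                      ≈⟨ +-cong first (sum-init-last (t ∘ suc)) ⟩
    y ^ p + (∑ (t ∘ suc ∘ inject₁) + t (suc (fromℕ p-1))) ≈⟨ +-congˡ (+-cong (proj₂ middle) last≈) ⟩
    y ^ p + (p ×S z + x ^ p)                  ≈⟨ +-congˡ (+-comm _ _) ⟩
    y ^ p + (x ^ p + p ×S z)                  ≈⟨ +-assoc _ _ _ ⟨
    y ^ p + x ^ p + p ×S z                    ≈⟨ +-congʳ (+-comm _ _) ⟩
    x ^ p + y ^ p + p ×S z                    ∎)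
    where
    open Binomial S x y
    t : Fin (suc p) → Carrier
    t = binomialTerm p
    first : t zero ≈ y ^ p
    first = ≈-trans (×-homo-1 _) (*-identityˡ _)
    last≈ : t (suc (fromℕ p-1)) ≈ x ^ p
    last≈ rewrite Fin.toℕ-fromℕ p-1 | nCn≡1 p | ℕ.n∸n≡0 p-1 = ≈-trans (×-homo-1 _) (*-identityʳ _)
    mid : ∀ i → ∃ λ z → t (suc (inject₁ i)) ≈ p ×S z
    -- The divisibility is taken at exponent j = 1, where `p ℕ.^ 1` is `p ℕ.* 1` and has to be
    -- rewritten to p.
    mid i with p∣[p^j]Ci pr 1 (toℕ (suc (inject₁ i))) (s≤s z≤n)
             (subst (toℕ (suc (inject₁ i)) ℕ.<_) (sym (ℕ.*-identityʳ p)) (s≤s (subst (ℕ._< p-1) (sym (Fin.toℕ-inject₁ i)) (Fin.toℕ<n i))))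
    ... | divides c eq = c ×S b , ≈-trans (×-congˡ (trans (cong (_C toℕ (suc (inject₁ i))) (sym (ℕ.*-identityʳ p))) (trans eq (ℕ.*-comm c p)))) (≈-sym (×-assocˡ b p c))
      where b = binomial p (suc (inject₁ i))
    middle : ∃ λ z → ∑ (t ∘ suc ∘ inject₁) ≈ p ×S z
    middle = ∑-multiples p p-1 (t ∘ suc ∘ inject₁) mid
    z = proj₁ middle

  ∑ₗ : {I : Set} → (I → Carrier) → List I → Carrier
  ∑ₗ x = foldr (λ i → x i +_) 0#

  ∑ₗ-^p : ∀ {p} → Prime p → {I : Set} (x : I → Carrier) → (∀ i j → x i * x j ≈ x j * x i) →
    ∀ is → ∃ λ z → ∑ₗ x is ^ p ≈ ∑ₗ (λ i → x i ^ p) is + p ×S z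
  ∑ₗ-^p {zero} pr = contradiction pr ¬prime[0]
  ∑ₗ-^p {suc p-1} pr x comm [] = 0# , ≈-trans (zeroˡ _) (≈-sym (≈-trans (+-identityˡ _) (×-zeroʳ (suc p-1))))
  ∑ₗ-^p {p@(suc p-1)} pr x comm (i ∷ is) with [x+y]^p pr (x i) (∑ₗ x is) (∑ₗ-comm is) | ∑ₗ-^p pr x comm is
    where
    ∑ₗ-comm : ∀ js → x i * ∑ₗ x js ≈ ∑ₗ x js * x i
    ∑ₗ-comm [] = ≈-trans (zeroʳ _) (≈-sym (zeroˡ _))
    ∑ₗ-comm (j ∷ js) = ≈-trans (distribˡ _ _ _) (≈-trans (+-cong (comm i j) (∑ₗ-comm js)) (≈-sym (distribʳ _ _ _)))
  ... | z , e | z′ , e′ = z′ + z , (begin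
    (x i + ∑ₗ x is) ^ p                                ≈⟨ e ⟩
    x i ^ p + ∑ₗ x is ^ p + p ×S z                      ≈⟨ +-congʳ (+-congˡ e′) ⟩
    x i ^ p + (∑ₗ (λ i → x i ^ p) is + p ×S z′) + p ×S z ≈⟨ +-congʳ (+-assoc _ _ _) ⟨
    x i ^ p + ∑ₗ (λ i → x i ^ p) is + p ×S z′ + p ×S z   ≈⟨ +-assoc _ _ _ ⟩
    x i ^ p + ∑ₗ (λ i → x i ^ p) is + (p ×S z′ + p ×S z) ≈⟨ +-congˡ (×-distrib-+ z′ z p) ⟨
    x i ^ p + ∑ₗ (λ i → x i ^ p) is + p ×S (z′ + z)      ∎)

module Endomorphisms (V : Set) where

  Fun : Set
  Fun = V → ℕ

  -- Adjacency operators live here, in effect as matrices over ℕ, so that entries 0 and 1 can be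
  -- told apart afterwards. Functions are compared only pointwise, hence `op-cong`.
  record End : Set where
    field
      op    : Fun → Fun
      op-cong : ∀ {g h} → g ≗ h → op g ≗ op h
      op-0  : ∀ v → op (λ _ → 0) v ≡ 0
      op-+  : ∀ g h v → op (λ w → g w ℕ.+ h w) v ≡ op g v ℕ.+ op h v
  open End public

  infix 4 _≈ₑ_
  -- A record rather than a bare pointwise equality, so that both operators can be inferred from the
  -- type.
  record _≈ₑ_ (A B : End) : Set where
    constructor ext
    field app : ∀ h v → op A h v ≡ op B h v
  open _≈ₑ_ public

  _+ₑ_ : End → End → End
  A +ₑ B = record
    { op = λ h v → op A h v ℕ.+ op B h v
    ; op-cong = λ e v → cong₂ ℕ._+_ (op-cong A e v) (op-cong B e v)
    ; op-0 = λ v → cong₂ ℕ._+_ (op-0 A v) (op-0 B v)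
    ; op-+ = λ g h v → trans (cong₂ ℕ._+_ (op-+ A g h v) (op-+ B g h v)) (interchange (op A g v) (op A h v) (op B g v) (op B h v)) }
    where
    interchange : ∀ a b c d → (a ℕ.+ b) ℕ.+ (c ℕ.+ d) ≡ (a ℕ.+ c) ℕ.+ (b ℕ.+ d)
    interchange = ℕSolver.solve-∀

  _*ₑ_ : End → End → End
  A *ₑ B = record
    { op = λ h → op A (op B h)
    ; op-cong = λ e → op-cong A (op-cong B e)
    ; op-0 = λ v → trans (op-cong A (op-0 B) v) (op-0 A v)
    ; op-+ = λ g h v → trans (op-cong A (op-+ B g h) v) (op-+ A _ _ v) }

  0ₑ 1ₑ : End
  0ₑ = record { op = λ _ _ → 0 ; op-cong = λ _ _ → refl ; op-0 = λ _ → refl ; op-+ = λ _ _ _ → refl }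
  1ₑ = record { op = id ; op-cong = id ; op-0 = λ _ → refl ; op-+ = λ _ _ _ → refl }

  endomorphisms : Semiring 0ℓ 0ℓ
  endomorphisms = record
    { Carrier = End ; _≈_ = _≈ₑ_ ; _+_ = _+ₑ_ ; _*_ = _*ₑ_ ; 0# = 0ₑ ; 1# = 1ₑ
    ; isSemiring = record
      { isSemiringWithoutAnnihilatingZero = record
        { +-isCommutativeMonoid = record
          { isMonoid = record
            { isSemigroup = record
              { isMagma = record
                { isEquivalence = record
                  { refl = ext λ _ _ → refl
                  ; sym = λ e → ext λ h v → sym (app e h v)
                  ; trans = λ e e′ → ext λ h v → trans (app e h v) (app e′ h v) }
                ; ∙-cong = λ e e′ → ext λ h v → cong₂ ℕ._+_ (app e h v) (app e′ h v) }
              ; assoc = λ A B D → ext λ h v → ℕ.+-assoc (op A h v) (op B h v) (op D h v) }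
            ; identity = (λ A → ext λ _ _ → refl) , (λ A → ext λ h v → ℕ.+-identityʳ (op A h v)) }
          ; comm = λ A B → ext λ h v → ℕ.+-comm (op A h v) (op B h v) }
        ; *-cong = λ {A} {A′} {B} {B′} e e′ → ext λ h v → trans (op-cong A (app e′ h) v) (app e (op B′ h) v)
        ; *-assoc = λ A B D → ext λ h v → refl
        ; *-identity = (λ A → ext λ _ _ → refl) , (λ A → ext λ _ _ → refl)
        ; distrib = (λ A B D → ext λ h v → op-+ A (op B h) (op D h) v) , (λ A B D → ext λ _ _ → refl) }
      ; zero = (λ A → ext λ _ _ → refl) , (λ A → ext λ h v → op-0 A v) } }

iter : {V : Set} → (V → V) → ℕ → V → V
iter a zero    v = v
iter a (suc n) v = iter a n (a v)

iter-comm : {V : Set} (a b : V → V) → (∀ v → a (b v) ≡ b (a v)) → ∀ m n v → iter a m (iter b n v) ≡ iter b n (iter a m v)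
iter-comm a b ab zero n v = refl
iter-comm a b ab (suc m) n v = trans (cong (iter a m) (one n v)) (iter-comm a b ab m n (a v))
  where
  one : ∀ n v → a (iter b n v) ≡ iter b n (a v)
  one zero v = refl
  one (suc n) v = trans (one n (b v)) (cong (iter b n) (ab v))

iter-+ : {V : Set} (a : V → V) → ∀ m n v → iter a (m ℕ.+ n) v ≡ iter a n (iter a m v)
iter-+ a zero n v = refl
iter-+ a (suc m) n v = iter-+ a m n (a v)

iter-* : {V : Set} (a : V → V) → ∀ m n v → iter (iter a m) n v ≡ iter a (n ℕ.* m) v
iter-* a m zero v = refl
iter-* a m (suc n) v = trans (iter-* a m n (iter a m v)) (sym (iter-+ a m (n ℕ.* m) v))

-- Schur's multiplier argument: if f intertwines the sums of two commuting families of maps, then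
-- modulo a prime p it intertwines the sums of their p-th iterates, because (∑ aₛ)ᵖ ≡ ∑ aₛᵖ.
-- When these iterates are injective in s, both sums have coefficients 0 and 1, so that the
-- congruence modulo p is an equality.
module Schur {V I : Set} (_≟_ : DecidableEquality V) (f : V → V) (f-injective : ∀ {v w} → f v ≡ f w → v ≡ w)
             (L : List I) (L-unique : Unique L) where
  open Endomorphisms V
  open Freshman endomorphisms
  open SemiringMult endomorphisms using () renaming (_×_ to _×ₑ_)
  open SemiringExp endomorphisms using () renaming (_^_ to _^ₑ_)

  -- An identity between two adjacency operators, encoded through multisets of neighbours, from
  -- which single neighbours can be read off again.
  Intertwines : (a b : I → V → V) → Set
  Intertwines a b = ∀ v → map (λ s → f (a s v)) L ↭ map (λ s → b s (f v)) L

  pull : (V → V) → End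
  pull a = record { op = λ h v → h (a v) ; op-cong = λ e v → e (a v) ; op-0 = λ _ → refl ; op-+ = λ _ _ _ → refl }

  pull-^ : ∀ a n → ∀ h v → op (pull a ^ₑ n) h v ≡ h (iter a n v)
  pull-^ a zero h v = refl
  pull-^ a (suc n) h v = pull-^ a n h (a v)

  op-× : ∀ n A h v → op (n ×ₑ A) h v ≡ n ℕ.* op A h v
  op-× zero A h v = refl
  op-× (suc n) A h v = cong (op A h v ℕ.+_) (op-× n A h v)

  op-∑ₗ : ∀ (A : I → End) h v is → op (∑ₗ A is) h v ≡ sum (map (λ s → op (A s) h v) is)
  op-∑ₗ A h v [] = refl
  op-∑ₗ A h v (i ∷ is) = cong (op (A i) h v ℕ.+_) (op-∑ₗ A h v is)

  intertwines-^ : ∀ A B → (∀ h v → op A (h ∘ f) v ≡ op B h (f v)) → ∀ n h v → op (A ^ₑ n) (h ∘ f) v ≡ op (B ^ₑ n) h (f v)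
  intertwines-^ A B AB zero h v = refl
  intertwines-^ A B AB (suc n) h v =
    trans (op-cong A (intertwines-^ A B AB n h) v) (AB (op (B ^ₑ n) h) v)

  δ : V → V → ℕ
  δ w v with w ≟ v
  ... | yes _ = 1
  ... | no _  = 0

  count-∉ : ∀ w xs → w ∉ xs → sum (map (δ w) xs) ≡ 0
  count-∉ w [] _ = refl
  count-∉ w (x ∷ xs) w∉ with w ≟ x
  ... | yes refl = contradiction (here refl) w∉
  ... | no _ = count-∉ w xs (w∉ ∘ there)

  count : ∀ w xs → Unique xs → (w ∈ xs × sum (map (δ w) xs) ≡ 1) ⊎ (w ∉ xs × sum (map (δ w) xs) ≡ 0)
  count w [] _ = inj₂ ((λ ()) , refl)
  count w (x ∷ xs) (x∉ ∷ u) with w ≟ x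
  ... | yes refl = inj₁ (here refl , cong suc (count-∉ w xs (λ w∈ → All.lookup x∉ w∈ refl)))
  ... | no w≢x with count w xs u
  ...   | inj₁ (w∈ , e) = inj₁ (there w∈ , e)
  ...   | inj₂ (w∉ , e) = inj₂ ((λ { (here e′) → w≢x e′ ; (there w∈) → w∉ w∈ }) , e)

  1≢0-mod : ∀ {p} → Prime p → ∀ z z′ → 1 ℕ.+ p ℕ.* z ≢ 0 ℕ.+ p ℕ.* z′
  1≢0-mod {p} pr z z′ e = ℕ.<⇒≱ (ℕ.nonTrivial⇒n>1 p {{prime⇒nonTrivial pr}})
    (∣⇒≤ (∣m+n∣m⇒∣n (subst (p ∣_) (trans (sym e) (ℕ.+-comm 1 (p ℕ.* z))) (m∣m*n z′)) (m∣m*n z)))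

  same-members : ∀ {p} → Prime p → ∀ {xs ys} → Unique xs → Unique ys →
    (∀ w → ∃ λ z → ∃ λ z′ → sum (map (δ w) xs) ℕ.+ p ℕ.* z ≡ sum (map (δ w) ys) ℕ.+ p ℕ.* z′) → xs ↭ ys
  same-members {p} pr {xs} {ys} ux uy cong-mod = ∼bag⇒↭ (unique∧set⇒bag ux uy (mk⇔ (to _) (from _)))
    where
    to : ∀ w → w ∈ xs → w ∈ ys
    to w w∈ with count w xs ux | count w ys uy | cong-mod w
    ... | _ | inj₁ (w∈′ , _) | _ = w∈′
    ... | inj₁ (_ , e) | inj₂ (_ , e′) | z , z′ , eq rewrite e | e′ = contradiction eq (1≢0-mod pr z z′)
    ... | inj₂ (w∉ , _) | _ | _ = contradiction w∈ w∉
    from : ∀ w → w ∈ ys → w ∈ xs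
    from w w∈ with count w xs ux | count w ys uy | cong-mod w
    ... | inj₁ (w∈′ , _) | _ | _ = w∈′
    ... | inj₂ (_ , e) | inj₁ (_ , e′) | z , z′ , eq rewrite e | e′ = contradiction (sym eq) (1≢0-mod pr z′ z)
    ... | _ | inj₂ (w∉ , _) | _ = contradiction w∈ w∉

  module _ (a b : I → V → V)
           (a-comm : ∀ s t v → a s (a t v) ≡ a t (a s v)) (b-comm : ∀ s t v → b s (b t v) ≡ b t (b s v)) where

    private
      A B : End
      A = ∑ₗ (pull ∘ a) L
      B = ∑ₗ (pull ∘ b) L

    intertwines⇒op : Intertwines a b → ∀ h v → op A (h ∘ f) v ≡ op B h (f v)
    intertwines⇒op int h v = begin
      op A (h ∘ f) v                         ≡⟨ op-∑ₗ (pull ∘ a) (h ∘ f) v L ⟩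
      sum (map (λ s → h (f (a s v))) L)      ≡⟨ cong sum (map-∘ L) ⟩
      sum (map h (map (λ s → f (a s v)) L))  ≡⟨ sum-↭ (↭.map⁺ h (int v)) ⟩
      sum (map h (map (λ s → b s (f v)) L))  ≡⟨ cong sum (map-∘ L) ⟨
      sum (map (λ s → h (b s (f v))) L)      ≡⟨ op-∑ₗ (pull ∘ b) h (f v) L ⟨
      op B h (f v)                           ∎
      where open ≡-Reasoning

    ∑-pull-^p : ∀ {p} → Prime p → (c : I → V → V) → (∀ s t v → c s (c t v) ≡ c t (c s v)) →
      ∃ λ Z → ∀ h v → op (∑ₗ (pull ∘ c) L ^ₑ p) h v ≡ sum (map (λ s → h (iter (c s) p v)) L) ℕ.+ p ℕ.* op Z h v
    ∑-pull-^p {p} pr c c-comm with ∑ₗ-^p pr (pull ∘ c) (λ s t → ext λ h v → cong h (c-comm t s v)) L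
    ... | Z , e = Z , λ h v → trans (app e h v) (cong₂ ℕ._+_
            (trans (op-∑ₗ (λ s → pull (c s) ^ₑ p) h v L) (cong sum (map-cong-pull h v L))) (op-× p Z h v))
      where
      map-cong-pull : ∀ h v is → map (λ s → op (pull (c s) ^ₑ p) h v) is ≡ map (λ s → h (iter (c s) p v)) is
      map-cong-pull h v [] = refl
      map-cong-pull h v (i ∷ is) = cong₂ _∷_ (pull-^ (c i) p h v) (map-cong-pull h v is)

    intertwines-iter : ∀ {p} → Prime p →
      (∀ v {s t} → iter (a s) p v ≡ iter (a t) p v → s ≡ t) →
      (∀ v {s t} → iter (b s) p v ≡ iter (b t) p v → s ≡ t) →
      Intertwines a b → Intertwines (λ s → iter (a s) p) (λ s → iter (b s) p)
    intertwines-iter {p} pr a-inj b-inj int v =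
      same-members pr (Unique.map⁺ (a-inj v ∘ f-injective) L-unique) (Unique.map⁺ (b-inj (f v)) L-unique) counts
      where
      -- Applying the operator congruence to the indicator function `δ w` turns it into a congruence
      -- between the numbers of occurrences of w.
      counts : ∀ w → ∃ λ z → ∃ λ z′ → sum (map (δ w) (map (λ s → f (iter (a s) p v)) L)) ℕ.+ p ℕ.* z
                                     ≡ sum (map (δ w) (map (λ s → iter (b s) p (f v)) L)) ℕ.+ p ℕ.* z′
      counts w with ∑-pull-^p pr a a-comm | ∑-pull-^p pr b b-comm
      ... | Z , e | Z′ , e′ = _ , _ , (begin
        sum (map (δ w) (map (λ s → f (iter (a s) p v)) L)) ℕ.+ p ℕ.* op Z (δ w ∘ f) v
          ≡⟨ cong (λ l → sum l ℕ.+ p ℕ.* op Z (δ w ∘ f) v) (map-∘ L) ⟨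
        sum (map (λ s → δ w (f (iter (a s) p v))) L) ℕ.+ p ℕ.* op Z (δ w ∘ f) v ≡⟨ e (δ w ∘ f) v ⟨
        op (A ^ₑ p) (δ w ∘ f) v        ≡⟨ intertwines-^ A B (intertwines⇒op int) p (δ w) v ⟩
        op (B ^ₑ p) (δ w) (f v)        ≡⟨ e′ (δ w) (f v) ⟩
        sum (map (λ s → δ w (iter (b s) p (f v))) L) ℕ.+ p ℕ.* op Z′ (δ w) (f v)
          ≡⟨ cong (λ l → sum l ℕ.+ p ℕ.* op Z′ (δ w) (f v)) (map-∘ L) ⟩
        sum (map (δ w) (map (λ s → iter (b s) p (f v)) L)) ℕ.+ p ℕ.* op Z′ (δ w) (f v) ∎)
        where open ≡-Reasoning

  intertwines-cong : ∀ {a a′ b b′ : I → V → V} → (∀ s v → a s v ≡ a′ s v) → (∀ s v → b s v ≡ b′ s v) →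
    Intertwines a b → Intertwines a′ b′
  intertwines-cong aa′ bb′ int v =
    subst₂ _↭_ (map-cong (λ s → cong f (aa′ s v)) L) (map-cong (λ s → bb′ s (f v)) L) (int v)

  module _ {p : ℕ} (a b : I → V → V)
           (a-comm : ∀ s t v → a s (a t v) ≡ a t (a s v)) (b-comm : ∀ s t v → b s (b t v) ≡ b t (b s v))
           (a-inj : ∀ m → ¬ p ∣ m → ∀ v {s t} → iter (a s) m v ≡ iter (a t) m v → s ≡ t)
           (b-inj : ∀ m → ¬ p ∣ m → ∀ v {s t} → iter (b s) m v ≡ iter (b t) m v → s ≡ t)
           (int : Intertwines a b) where

    -- Each prime factor is applied to the iterates already reached. Every partial product must
    -- again give injective iterates, hence `a-inj` and `b-inj` for all m not divisible by p.
    intertwines-product : ∀ πs → All Prime πs → ¬ p ∣ product πs →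
      Intertwines (λ s → iter (a s) (product πs)) (λ s → iter (b s) (product πs))
    intertwines-product [] [] _ = int
    intertwines-product (π ∷ πs) (π-prime ∷ primes) p∤ =
      intertwines-cong (λ s → iter-* (a s) m π) (λ s → iter-* (b s) m π)
        (intertwines-iter (λ s → iter (a s) m) (λ s → iter (b s) m)
          (λ s t → iter-comm (a s) (a t) (a-comm s t) m m) (λ s t → iter-comm (b s) (b t) (b-comm s t) m m) π-prime
          (λ v e → a-inj (π ℕ.* m) p∤ v (trans (sym (iter-* _ m π v)) (trans e (iter-* _ m π v))))
          (λ v e → b-inj (π ℕ.* m) p∤ v (trans (sym (iter-* _ m π v)) (trans e (iter-* _ m π v))))
          (intertwines-product πs primes (p∤ ∘ ∣n⇒∣m*n π)))
      where m = product πs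

    intertwines-multiplier : ∀ m → .{{ℕ.NonZero m}} → ¬ p ∣ m → Intertwines (λ s → iter (a s) m) (λ s → iter (b s) m)
    intertwines-multiplier m p∤m with factorise m
    ... | record { factors = πs ; isFactorisation = refl ; factorsPrime = primes } = intertwines-product πs primes p∤m

-- Field arithmetic and polynomial functions with degree bounds.

module FieldFacts (F : Field) where
  open Field F
  open FieldRing F
  open FieldSolver F
  open CommutativeRing commutativeRing public using (semiring; commutativeSemiring; +-identityʳ; *-identityʳ; -‿inverseʳ; zeroˡ; zeroʳ)
  open CommutativeExp commutativeSemiring public using (_^_; ^-homo-*; ^-assocʳ; ^-distrib-*)

  *-nonzero : ∀ {x y} → x ≢ 0# → y ≢ 0# → x * y ≢ 0#
  *-nonzero {x} {y} x≢0 y≢0 xy≡0 with *-inverse x x≢0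
  ... | x⁻¹ , e = y≢0 (begin
    y             ≡⟨ *-identityˡ y ⟨
    1# * y        ≡⟨ cong (_* y) e ⟨
    x * x⁻¹ * y   ≡⟨ solve 3 (λ x z y → x :* z :* y := z :* (x :* y)) refl x x⁻¹ y ⟩
    x⁻¹ * (x * y) ≡⟨ cong (x⁻¹ *_) xy≡0 ⟩
    x⁻¹ * 0#      ≡⟨ zeroʳ _ ⟩
    0#            ∎)
    where open ≡-Reasoning

  ^-nonzero : ∀ {x} n → x ≢ 0# → x ^ n ≢ 0#
  ^-nonzero zero x≢0 e = 0≢1 (sym e)
  ^-nonzero (suc n) x≢0 = *-nonzero x≢0 (^-nonzero n x≢0)

  x+y-x≡y : ∀ x y → x + y + - x ≡ y
  x+y-x≡y = solve 2 (λ x y → x :+ y :- x := y) refl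

  x+[y-x]≡y : ∀ x y → x + (y + - x) ≡ y
  x+[y-x]≡y = solve 2 (λ x y → x :+ (y :- x) := y) refl

  x*-1≡-x : ∀ x → x * - 1# ≡ - x
  x*-1≡-x = solve 1 (λ x → x :* :- :1 := :- x) refl

  x-y≡0⇒x≡y : ∀ {x y} → x + - y ≡ 0# → x ≡ y
  x-y≡0⇒x≡y {x} {y} e = begin
    x             ≡⟨ solve 2 (λ x y → x := (x :- y) :+ y) refl x y ⟩
    (x + - y) + y ≡⟨ cong (_+ y) e ⟩
    0# + y        ≡⟨ +-identityˡ y ⟩
    y             ∎
    where open ≡-Reasoning

  x≡y⇒x-y≡0 : ∀ {x y} → x ≡ y → x + - y ≡ 0#
  x≡y⇒x-y≡0 {x} refl = -‿inverseʳ x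

  +-cancelˡ : ∀ z {x y} → z + x ≡ z + y → x ≡ y
  +-cancelˡ z {x} {y} e = begin
    x              ≡⟨ solve 2 (λ x z → x := (z :+ x) :- z) refl x z ⟩
    (z + x) + - z  ≡⟨ cong (_+ - z) e ⟩
    (z + y) + - z  ≡⟨ solve 2 (λ y z → (z :+ y) :- z := y) refl y z ⟩
    y              ∎
    where open ≡-Reasoning

  *-cancelˡ : ∀ z {x y} → z ≢ 0# → z * x ≡ z * y → x ≡ y
  *-cancelˡ z {x} {y} z≢0 e with *-inverse z z≢0
  ... | z⁻¹ , zz⁻¹ = begin
    x              ≡⟨ *-identityˡ x ⟨
    1# * x         ≡⟨ cong (_* x) zz⁻¹ ⟨
    z * z⁻¹ * x    ≡⟨ solve 3 (λ z w x → z :* w :* x := w :* (z :* x)) refl z z⁻¹ x ⟩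
    z⁻¹ * (z * x)  ≡⟨ cong (z⁻¹ *_) e ⟩
    z⁻¹ * (z * y)  ≡⟨ solve 3 (λ z w y → w :* (z :* y) := z :* w :* y) refl z z⁻¹ y ⟩
    z * z⁻¹ * y    ≡⟨ cong (_* y) zz⁻¹ ⟩
    1# * y         ≡⟨ *-identityˡ y ⟩
    y              ∎
    where open ≡-Reasoning

  1^ : ∀ n → 1# ^ n ≡ 1#
  1^ zero = refl
  1^ (suc n) = trans (*-identityˡ _) (1^ n)

module Polynomials (F : Field) where
  open Field F
  open FieldSolver F
  open FieldFacts F
  open SemiringSum semiring using () renaming (sum to ∑)

  -- Polynomial functions of degree < n, and those of degree ≤ n with coefficient c at xⁿ.
  data Low : ℕ → (Carrier → Carrier) → Set
  data Lead (n : ℕ) (c : Carrier) (g : Carrier → Carrier) : Set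
  data Low where
    low₀ : ∀ {g} → (∀ x → g x ≡ 0#) → Low 0 g
    low₊ : ∀ {n g} c → Lead n c g → Low (suc n) g
  data Lead n c g where
    lead : ∀ g′ → Low n g′ → (∀ x → g x ≡ c * x ^ n + g′ x) → Lead n c g

  lead-cong : ∀ {n c g h} → (∀ x → g x ≡ h x) → Lead n c g → Lead n c h
  lead-cong e (lead g′ low eq) = lead g′ low λ x → trans (sym (e x)) (eq x)

  low-cong : ∀ {n g h} → (∀ x → g x ≡ h x) → Low n g → Low n h
  low-cong e (low₀ z) = low₀ λ x → trans (sym (e x)) (z x)
  low-cong e (low₊ c lg) = low₊ c (lead-cong e lg)

  low-suc : ∀ {n g} → Low n g → Low (suc n) g
  low-suc {g = g} lg = low₊ 0# (lead g lg λ x → sym (trans (cong (_+ g x) (zeroˡ _)) (+-identityˡ _)))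

  low-0 : ∀ n → Low n (λ _ → 0#)
  low-0 zero = low₀ λ _ → refl
  low-0 (suc n) = low-suc (low-0 n)

  low-+ : ∀ {n g h} → Low n g → Low n h → Low n (λ x → g x + h x)
  low-+ (low₀ zg) (low₀ zh) = low₀ λ x → trans (cong₂ _+_ (zg x) (zh x)) (+-identityˡ 0#)
  low-+ {suc n} (low₊ c (lead g′ lg eg)) (low₊ d (lead h′ lh eh)) = low₊ (c + d) (lead (λ x → g′ x + h′ x) (low-+ lg lh) λ x →
    trans (cong₂ _+_ (eg x) (eh x))
      (solve 5 (λ c d X u v → (c :* X :+ u) :+ (d :* X :+ v) := (c :+ d) :* X :+ (u :+ v)) refl c d (x ^ n) (g′ x) (h′ x)))

  low-scale : ∀ {n g} k → Low n g → Low n (λ x → k * g x)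
  low-scale k (low₀ zg) = low₀ λ x → trans (cong (k *_) (zg x)) (zeroʳ k)
  low-scale {suc n} k (low₊ c (lead g′ lg eg)) = low₊ (k * c) (lead (λ x → k * g′ x) (low-scale k lg) λ x →
    trans (cong (k *_) (eg x)) (solve 4 (λ k c X u → k :* (c :* X :+ u) := k :* c :* X :+ k :* u) refl k c (x ^ n) (g′ x)))

  low-≤ : ∀ {m n g} → m ℕ.≤ n → Low m g → Low n g
  low-≤ m≤n = go (ℕ.≤⇒≤′ m≤n)
    where
    go : ∀ {m n g} → m ℕ.≤′ n → Low m g → Low n g
    go ℕ.≤′-refl lg = lg
    go (ℕ.≤′-step le) lg = low-suc (go le lg)

  low-x* : ∀ {n g} → Low n g → Low (suc n) (λ x → x * g x)
  low-x* (low₀ zg) = low-suc (low₀ λ x → trans (cong (x *_) (zg x)) (zeroʳ x))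
  low-x* {suc n} (low₊ c (lead g′ lg eg)) = low₊ c (lead (λ x → x * g′ x) (low-x* lg) λ x →
    trans (cong (x *_) (eg x)) (solve 4 (λ x c X u → x :* (c :* X :+ u) := c :* (x :* X) :+ x :* u) refl x c (x ^ n) (g′ x)))

  low-x^* : ∀ k {n g} → Low n g → Low (k ℕ.+ n) (λ x → x ^ k * g x)
  low-x^* zero lg = low-cong (λ x → sym (*-identityˡ _)) lg
  low-x^* (suc k) lg = low-cong (λ x → sym (*-assoc _ _ _)) (low-x* (low-x^* k lg))

  low-* : ∀ {m n g h} → Low m g → Low n h → Low (m ℕ.+ n) (λ x → g x * h x)
  low-* {n = n} {h = h} (low₀ zg) lh = low-cong (λ x → sym (trans (cong (_* h x) (zg x)) (zeroˡ _))) (low-0 n)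
  low-* {suc m} {n} {h = h} (low₊ c (lead g′ lg eg)) lh = low-suc (low-cong
    (λ x → sym (trans (cong (_* h x) (eg x)) (solve 4 (λ c X u H → (c :* X :+ u) :* H := c :* (X :* H) :+ u :* H) refl c (x ^ m) (g′ x) (h x))))
    (low-+ (low-scale c (low-x^* m lh)) (low-* lg lh)))

  lead-* : ∀ {m n c d g h} → Lead m c g → Lead n d h → Lead (m ℕ.+ n) (c * d) (λ x → g x * h x)
  lead-* {m} {n} {c} {d} (lead g′ lg eg) (lead h′ lh eh) = lead
    (λ x → c * (x ^ m * h′ x) + (d * (x ^ n * g′ x) + g′ x * h′ x))
    (low-+ (low-scale c (low-x^* m lh)) (low-+ (low-scale d (subst (λ k → Low k (λ x → x ^ n * g′ x)) (ℕ.+-comm n m) (low-x^* n lg))) (low-* lg lh)))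
    λ x → trans (cong₂ _*_ (eg x) (eh x)) (trans
      (solve 6 (λ c d X Y u v → (c :* X :+ u) :* (d :* Y :+ v) := c :* d :* (X :* Y) :+ (c :* (X :* v) :+ (d :* (Y :* u) :+ u :* v)))
        refl c d (x ^ m) (x ^ n) (g′ x) (h′ x))
      (cong (λ Z → c * d * Z + (c * (x ^ m * h′ x) + (d * (x ^ n * g′ x) + g′ x * h′ x))) (sym (^-homo-* x m n))))

  lead-const : ∀ c → Lead 0 c (λ _ → c)
  lead-const c = lead (λ _ → 0#) (low-0 0) λ x → solve 1 (λ c → c := c :* :1 :+ :0) refl c

  lead-^ : ∀ {n c g} k → Lead n c g → Lead (k ℕ.* n) (c ^ k) (λ x → g x ^ k)
  lead-^ zero lg = lead-const 1#
  lead-^ (suc k) lg = lead-* lg (lead-^ k lg)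

  low-∑ : ∀ {n k} (g : Fin k → Carrier → Carrier) → (∀ i → Low n (g i)) → Low n (λ x → ∑ (λ i → g i x))
  low-∑ {n} {zero} g lg = low-0 n
  low-∑ {n} {suc k} g lg = low-+ (lg zero) (low-∑ (g ∘ suc) (lg ∘ suc))

  -- The quotient arises from xⁿ⁺² - aⁿ⁺² = (x - a) xⁿ⁺¹ + a (xⁿ⁺¹ - aⁿ⁺¹).
  pow-diff : ∀ a n → ∃ λ g → Lead n 1# g × (∀ x → x ^ suc n + - (a ^ suc n) ≡ (x + - a) * g x)
  pow-diff a zero = (λ _ → 1#) , lead-const 1# , λ x → solve 2 (λ x a → x :* :1 :- a :* :1 := (x :- a) :* :1) refl x a
  pow-diff a (suc n) with pow-diff a n
  ... | g , lg , eg = (λ x → x ^ suc n + a * g x) , lead (λ x → a * g x) (low-scale a (low₊ 1# lg)) (λ x → cong (_+ a * g x) (sym (*-identityˡ _))) , λ x → begin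
    x * x ^ suc n + - (a * a ^ suc n)
      ≡⟨ solve 4 (λ x a X A → x :* X :- a :* A := (x :- a) :* X :+ a :* (X :- A)) refl x a (x ^ suc n) (a ^ suc n) ⟩
    (x + - a) * x ^ suc n + a * (x ^ suc n + - (a ^ suc n))
      ≡⟨ cong (λ z → (x + - a) * x ^ suc n + a * z) (eg x) ⟩
    (x + - a) * x ^ suc n + a * ((x + - a) * g x)
      ≡⟨ solve 4 (λ d X a G → d :* X :+ a :* (d :* G) := d :* (X :+ a :* G)) refl (x + - a) (x ^ suc n) a (g x) ⟩
    (x + - a) * (x ^ suc n + a * g x) ∎
    where open ≡-Reasoning

  private
    split-difference : ∀ c X A u v → (c * X + u) + - (c * A + v) ≡ c * (X + - A) + (u + - v)
    split-difference = solve 5 (λ c X A u v → (c :* X :+ u) :- (c :* A :+ v) := c :* (X :- A) :+ (u :- v)) refl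

    regroup-lead : ∀ c X m h → c * (1# * X + m) + h ≡ c * X + (c * m + h)
    regroup-lead = solve 4 (λ c X m h → c :* (:1 :* X :+ m) :+ h := c :* X :+ (c :* m :+ h)) refl

    factor-out : ∀ c D m h → c * (D * m) + D * h ≡ D * (c * m + h)
    factor-out = solve 4 (λ c D m h → c :* (D :* m) :+ D :* h := D :* (c :* m :+ h)) refl

  lead-divide-step : ∀ a n {c d} {g g′ M h : Carrier → Carrier} → (∀ x → g x ≡ c * x ^ suc (suc n) + g′ x) →
    Lead (suc n) 1# M → (∀ x → x ^ suc (suc n) + - (a ^ suc (suc n)) ≡ (x + - a) * M x) →
    Lead n d h → (∀ x → g′ x + - (g′ a) ≡ (x + - a) * h x) →
    Lead (suc n) c (λ x → c * M x + h x) × (∀ x → g x + - (g a) ≡ (x + - a) * (c * M x + h x))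
  lead-divide-step a n {c} {d} {g} {g′} {M} {h} eg (lead M′ lM eM′) eM lh eh =
    lead (λ x → c * M′ x + h x) (low-+ (low-scale c lM) (low₊ d lh))
      (λ x → trans (cong (λ z → c * z + h x) (eM′ x)) (regroup-lead c (x ^ suc n) (M′ x) (h x))) ,
    λ x → begin
      g x + - (g a) ≡⟨ cong₂ (λ u v → u + - v) (eg x) (eg a) ⟩
      (c * x ^ suc (suc n) + g′ x) + - (c * a ^ suc (suc n) + g′ a)
        ≡⟨ split-difference c (x ^ suc (suc n)) (a ^ suc (suc n)) (g′ x) (g′ a) ⟩
      c * (x ^ suc (suc n) + - (a ^ suc (suc n))) + (g′ x + - (g′ a)) ≡⟨ cong₂ (λ u v → c * u + v) (eM x) (eh x) ⟩
      c * ((x + - a) * M x) + (x + - a) * h x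
        ≡⟨ factor-out c (x + - a) (M x) (h x) ⟩
      (x + - a) * (c * M x + h x) ∎
    where open ≡-Reasoning

  -- Division by x - a, one leading term at a time: `pow-diff` divides the top power, and the
  -- recursion handles the rest.
  lead-divide : ∀ a n {c g} → Lead (suc n) c g → ∃ λ h → Lead n c h × (∀ x → g x + - (g a) ≡ (x + - a) * h x)
  lead-divide a zero {c} {g} (lead g′ (low₊ d (lead g″ (low₀ z) eg′)) eg) = (λ _ → c) , lead-const c , λ x → begin
    g x + - (g a) ≡⟨ cong₂ (λ u v → u + - v) (eval x) (eval a) ⟩
    (c * (x * 1#) + (d * 1# + 0#)) + - (c * (a * 1#) + (d * 1# + 0#))
      ≡⟨ solve 4 (λ c x a d → (c :* (x :* :1) :+ (d :* :1 :+ :0)) :- (c :* (a :* :1) :+ (d :* :1 :+ :0)) := (x :- a) :* c) refl c x a d ⟩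
    (x + - a) * c ∎
    where
    open ≡-Reasoning
    eval : ∀ x → g x ≡ c * (x * 1#) + (d * 1# + 0#)
    eval x = trans (eg x) (cong (c * (x * 1#) +_) (trans (eg′ x) (cong (d * 1# +_) (z x))))
  lead-divide a (suc n) {c} {g} (lead g′ (low₊ d lg) eg) =
    let M , lM , eM = pow-diff a (suc n)
        h , lh , eh = lead-divide a n lg
    in (λ x → c * M x + h x) , lead-divide-step a n {g = g} {g′} eg lM eM lh eh

  -- Dividing by the linear factor of one root leaves degree n and n + 1 further roots, since the
  -- factor is nonzero at each of them.
  roots-bound : ∀ n {c g} → c ≢ 0# → Lead n c g → (xs : Fin (suc n) → Carrier) → (∀ {i j} → xs i ≡ xs j → i ≡ j) → ¬ (∀ i → g (xs i) ≡ 0#)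
  roots-bound zero {c} {g} c≢0 (lead g′ (low₀ z) eg) xs inj vanish = c≢0 (begin
    c                 ≡⟨ solve 1 (λ c → c := c :* :1 :+ :0) refl c ⟩
    c * 1# + 0#       ≡⟨ cong (c * 1# +_) (z (xs zero)) ⟨
    c * 1# + g′ (xs zero) ≡⟨ eg (xs zero) ⟨
    g (xs zero)       ≡⟨ vanish zero ⟩
    0#                ∎)
    where open ≡-Reasoning
  roots-bound (suc n) {c} {g} c≢0 lg xs inj vanish with lead-divide (xs zero) n lg
  ... | h , lh , eh = roots-bound n c≢0 lh (xs ∘ suc) (λ e → Fin.suc-injective (inj e)) λ i →
    *-cancelˡ (xs (suc i) + - (xs zero)) (λ e → Fin.0≢1+n (sym (inj (x-y≡0⇒x≡y e))))
      (trans (sym (eh (xs (suc i)))) (trans (x≡y⇒x-y≡0 (trans (vanish (suc i)) (sym (vanish zero)))) (sym (zeroʳ _))))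

  module _ (_≟_ : DecidableEquality Carrier) where

    low-degree : ∀ {n g} → Low n g → (∀ x → g x ≡ 0#) ⊎ (∃ λ k → ∃ λ c → k ℕ.< n × c ≢ 0# × Lead k c g)
    low-degree (low₀ z) = inj₁ z
    low-degree {suc n} {g} (low₊ c lg@(lead g′ low eg)) with c ≟ 0#
    ... | no c≢0 = inj₂ (n , c , ℕ.n<1+n n , c≢0 , lg)
    ... | yes c≡0 = case-low (low-degree (low-cong (λ x → sym (trans (eg x) (trans (cong (λ c → c * x ^ n + g′ x) c≡0)
                      (trans (cong (_+ g′ x) (zeroˡ _)) (+-identityˡ _))))) low))
      where
      case-low : (∀ x → g x ≡ 0#) ⊎ (∃ λ k → ∃ λ c → k ℕ.< n × c ≢ 0# × Lead k c g) →
                 (∀ x → g x ≡ 0#) ⊎ (∃ λ k → ∃ λ c → k ℕ.< suc n × c ≢ 0# × Lead k c g)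
      case-low (inj₁ z) = inj₁ z
      case-low (inj₂ (k , c , k<n , rest)) = inj₂ (k , c , ℕ.m<n⇒m<1+n k<n , rest)

-- Finite fields: Fermat's theorem, uniqueness of degrees, power sums.

module FiniteField (F : Field) {n : ℕ} (card : Fin (suc n) ↔ Field.Carrier F) where
  open Field F
  open FieldRing F
  open FieldSolver F
  open FieldFacts F
  open Polynomials F
  open CommutativeRing commutativeRing using (*-commutativeMonoid)
  open SemiringMult semiring public using (×-homo-+; ×-assoc-*; ×1-homo-*; ×-homo-1) renaming (_×_ to _×F_)
  open SemiringSum semiring using (sum-cong-≗; sum-replicate; *-distribˡ-sum; ∑-distrib-+; sum-permute; sum-remove) renaming (sum to ∑)
  private module Prod = CommutativeMonoidSum *-commutativeMonoid

  elt : Fin (suc n) → Carrier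
  elt = Inverse.to card

  idx : Carrier → Fin (suc n)
  idx = Inverse.from card

  elt-idx : ∀ x → elt (idx x) ≡ x
  elt-idx x = Inverse.inverseˡ card refl

  idx-elt : ∀ i → idx (elt i) ≡ i
  idx-elt i = Inverse.inverseʳ card refl

  elt-injective : ∀ {i j} → elt i ≡ elt j → i ≡ j
  elt-injective {i} {j} e = trans (sym (idx-elt i)) (trans (cong idx e) (idx-elt j))

  infix 4 _≟_
  _≟_ : DecidableEquality Carrier
  x ≟ y = map′ (λ e → trans (sym (elt-idx x)) (trans (cong elt e) (elt-idx y))) (cong idx) (idx x Fin.≟ idx y)

  any? : ∀ {P : Carrier → Set} → Decidable P → Dec (∃ P)
  any? {P} P? = map′ (λ (i , p) → elt i , p) (λ (x , p) → idx x , subst P (sym (elt-idx x)) p) (Fin.any? (P? ∘ elt))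

  square? : Decidable (NZSq F)
  square? s = ¬? (s ≟ 0#) ×-dec any? (λ w → w * w ≟ s)

  permutation : Carrier ↔ Carrier → Fin (suc n) ↔ Fin (suc n)
  permutation π = mk↔ₛ′ (λ i → idx (Inverse.to π (elt i))) (λ i → idx (Inverse.from π (elt i)))
    (λ i → trans (cong (idx ∘ Inverse.to π) (elt-idx _)) (trans (cong idx (Inverse.inverseˡ π refl)) (idx-elt i)))
    (λ i → trans (cong (idx ∘ Inverse.from π) (elt-idx _)) (trans (cong idx (Inverse.inverseʳ π refl)) (idx-elt i)))

  ∑F : (Carrier → Carrier) → Carrier
  ∑F φ = ∑ (φ ∘ elt)

  ∑F-cong : ∀ {φ ψ} → (∀ x → φ x ≡ ψ x) → ∑F φ ≡ ∑F ψ
  ∑F-cong e = sum-cong-≗ {suc n} (e ∘ elt)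

  ∑F-+ : ∀ φ ψ → ∑F (λ x → φ x + ψ x) ≡ ∑F φ + ∑F ψ
  ∑F-+ φ ψ = ∑-distrib-+ (φ ∘ elt) (ψ ∘ elt)

  ∑F-* : ∀ c φ → ∑F (λ x → c * φ x) ≡ c * ∑F φ
  ∑F-* c φ = sym (*-distribˡ-sum c (φ ∘ elt))

  ∑F-const : ∀ c → ∑F (λ _ → c) ≡ suc n ×F c
  ∑F-const c = sum-replicate (suc n)

  ∑F-permute : (π : Carrier ↔ Carrier) → ∀ φ → ∑F (φ ∘ Inverse.to π) ≡ ∑F φ
  ∑F-permute π φ = sym (trans (sum-permute (φ ∘ elt) (permutation π)) (sum-cong-≗ {suc n} λ i → cong φ (elt-idx (Inverse.to π (elt i)))))

  ∏F-permute : (π : Carrier ↔ Carrier) → ∀ φ → Prod.sum (φ ∘ Inverse.to π ∘ elt) ≡ Prod.sum (φ ∘ elt)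
  ∏F-permute π φ = sym (trans (Prod.sum-permute (φ ∘ elt) (permutation π)) (Prod.sum-cong-≗ {suc n} λ i → cong φ (elt-idx (Inverse.to π (elt i)))))

  ∑F-split-0 : ∀ φ c → (∀ x → x ≢ 0# → φ x ≡ c) → ∑F φ ≡ φ 0# + n ×F c
  ∑F-split-0 φ c e = trans (sum-remove {i = idx 0#} (φ ∘ elt)) (cong₂ _+_ (cong φ (elt-idx 0#))
    (trans (sum-cong-≗ {n} λ j → e (elt (punchIn (idx 0#) j)) λ e′ → Fin.punchInᵢ≢i (idx 0#) j (trans (sym (idx-elt _)) (cong idx e′))) (sum-replicate n)))

  ∏F-split-0 : ∀ φ c → (∀ x → x ≢ 0# → φ x ≡ c) → Prod.sum (φ ∘ elt) ≡ φ 0# * c ^ n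
  ∏F-split-0 φ c e = trans (Prod.sum-remove {i = idx 0#} (φ ∘ elt)) (cong₂ _*_ (cong φ (elt-idx 0#))
    (trans (Prod.sum-cong-≗ {n} λ j → e (elt (punchIn (idx 0#) j)) λ e′ → Fin.punchInᵢ≢i (idx 0#) j (trans (sym (idx-elt _)) (cong idx e′))) (Prod.sum-replicate n)))

  translate : Carrier → Carrier ↔ Carrier
  translate a = mk↔ₛ′ (a +_) (- a +_)
    (solve 2 (λ a x → a :+ (:- a :+ x) := x) refl a) (solve 2 (λ a x → :- a :+ (a :+ x) := x) refl a)

  dilate : ∀ a → a ≢ 0# → Carrier ↔ Carrier
  dilate a a≢0 = let a⁻¹ , e = *-inverse a a≢0 in mk↔ₛ′ (a *_) (a⁻¹ *_)
    (λ x → trans (sym (*-assoc a a⁻¹ x)) (trans (cong (_* x) e) (*-identityˡ x)))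
    (λ x → trans (sym (*-assoc a⁻¹ a x)) (trans (cong (_* x) (trans (*-comm a⁻¹ a) e)) (*-identityˡ x)))

  -- Translation by 1 permutes F and adds q · 1 to the sum of all elements.
  card×1≡0 : suc n ×F 1# ≡ 0#
  card×1≡0 = +-cancelˡ (∑F id) (begin
    ∑F id + suc n ×F 1#        ≡⟨ cong (∑F id +_) (∑F-const 1#) ⟨
    ∑F id + ∑F (λ _ → 1#)      ≡⟨ ∑F-+ id (λ _ → 1#) ⟨
    ∑F (λ x → x + 1#)          ≡⟨ ∑F-cong (λ x → +-comm x 1#) ⟩
    ∑F (λ x → 1# + x)          ≡⟨ ∑F-permute (translate 1#) id ⟩
    ∑F id                      ≡⟨ +-identityʳ _ ⟨
    ∑F id + 0#                 ∎)
    where open ≡-Reasoning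

  n×1≡-1 : n ×F 1# ≡ - 1#
  n×1≡-1 = +-cancelˡ 1# (trans card×1≡0 (sym (-‿inverseʳ 1#)))

  0^ : ∀ {k} → 0 ℕ.< k → 0# ^ k ≡ 0#
  0^ {suc k} _ = zeroˡ _

  private
    -- Neutral at 0, so that a product over all of F runs in effect over the nonzero elements.
    1or : Carrier → Carrier → Carrier
    1or a x with x ≟ 0#
    ... | yes _ = 1#
    ... | no _  = a

    1or-0 : ∀ a → 1or a 0# ≡ 1#
    1or-0 a with 0# ≟ 0#
    ... | yes _ = refl
    ... | no 0≢0 = contradiction refl 0≢0

    1or-≢ : ∀ a {x} → x ≢ 0# → 1or a x ≡ a
    1or-≢ a {x} x≢0 with x ≟ 0#
    ... | yes e = contradiction e x≢0
    ... | no _ = refl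

    1or-≢0 : ∀ {a x} → a ≢ 0# ⊎ x ≡ 0# → 1or a x ≢ 0#
    1or-≢0 {a} {x} h e with x ≟ 0#
    1or-≢0 {a} {x} h e | yes _ = 0≢1 (sym e)
    1or-≢0 {a} {x} (inj₁ a≢0) e | no _ = a≢0 e
    1or-≢0 {a} {x} (inj₂ x≡0) e | no x≢0 = x≢0 x≡0

    ∏-nonzero : ∀ {k} (t : Fin k → Carrier) → (∀ i → t i ≢ 0#) → Prod.sum t ≢ 0#
    ∏-nonzero {zero} t h e = 0≢1 (sym e)
    ∏-nonzero {suc k} t h = *-nonzero (h zero) (∏-nonzero (t ∘ suc) (h ∘ suc))

  -- Multiplication by a permutes the nonzero elements, so their product P satisfies P = P aⁿ.
  fermat : ∀ a → a ≢ 0# → a ^ n ≡ 1#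
  fermat a a≢0 = sym (*-cancelˡ P P≢0 (begin
    P * 1#                                                    ≡⟨ *-identityʳ P ⟩
    P                                                         ≡⟨ ∏F-permute (dilate a a≢0) φ ⟨
    Prod.sum (λ i → φ (a * elt i))                            ≡⟨ Prod.sum-cong-≗ {suc n} (λ i → φ[ax] (elt i)) ⟩
    Prod.sum (λ i → φ (elt i) * 1or a (elt i))                ≡⟨ Prod.∑-distrib-+ (φ ∘ elt) (1or a ∘ elt) ⟩
    P * Prod.sum (1or a ∘ elt)                                ≡⟨ cong (P *_) (∏F-split-0 (1or a) a (λ x → 1or-≢ a)) ⟩
    P * (1or a 0# * a ^ n)                                    ≡⟨ cong (λ u → P * (u * a ^ n)) (1or-0 a) ⟩
    P * (1# * a ^ n)                                          ≡⟨ cong (P *_) (*-identityˡ _) ⟩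
    P * a ^ n                                                 ∎))
    where
    open ≡-Reasoning
    φ : Carrier → Carrier
    φ x = 1or x x
    P = Prod.sum (φ ∘ elt)
    P≢0 : P ≢ 0#
    P≢0 = ∏-nonzero (φ ∘ elt) λ i → 1or-≢0 {elt i} {elt i} (dec (elt i))
      where
      dec : ∀ x → x ≢ 0# ⊎ x ≡ 0#
      dec x with x ≟ 0#
      ... | yes e = inj₂ e
      ... | no e = inj₁ e
    φ[ax] : ∀ x → φ (a * x) ≡ φ x * 1or a x
    φ[ax] x with x ≟ 0#
    ... | yes refl = trans (trans (cong φ (zeroʳ a)) (1or-0 0#)) (sym (*-identityˡ 1#))
    ... | no x≢0 = trans (1or-≢ (a * x) (*-nonzero a≢0 x≢0)) (*-comm a x)

  x^1+n≡x : ∀ x → x ^ suc n ≡ x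
  x^1+n≡x x with x ≟ 0#
  ... | yes refl = zeroˡ _
  ... | no x≢0 = trans (cong (x *_) (fermat x x≢0)) (*-identityʳ x)

  lead-nonvanishing : ∀ {k c g} → c ≢ 0# → Lead k c g → k ℕ.≤ n → ¬ (∀ x → g x ≡ 0#)
  lead-nonvanishing {k} c≢0 lg k≤n z = roots-bound k c≢0 lg (λ i → elt (Fin.inject≤ i (s≤s k≤n)))
    (λ e → Fin.inject≤-injective (s≤s k≤n) (s≤s k≤n) _ _ (elt-injective e)) (λ i → z _)

  -- If j ≤ k, subtracting the second expression for g from the first leaves a polynomial of degree
  -- k ≤ q - 1 that vanishes at all q points. Beyond q - 1 degrees are ambiguous, as x^q = x.
  degree-unique : ∀ {k j c g} → c ≢ 0# → Lead k c g → k ℕ.≤ n → Low j g → k ℕ.< j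
  degree-unique {k} {j} {c} {g} c≢0 (lead g′ lg′ eg) k≤n lg = ℕ.≰⇒> λ j≤k →
    lead-nonvanishing c≢0 (lead {g = λ _ → 0#} (λ x → g′ x + - 1# * g x) (low-+ lg′ (low-scale (- 1#) (low-≤ j≤k lg)))
      (λ x → sym (begin
        c * x ^ k + (g′ x + - 1# * g x) ≡⟨ +-assoc _ _ _ ⟨
        c * x ^ k + g′ x + - 1# * g x   ≡⟨ cong (_+ - 1# * g x) (eg x) ⟨
        g x + - 1# * g x                ≡⟨ x-1*x≡0 (g x) ⟩
        0#                              ∎))) k≤n (λ _ → refl)
    where
    open ≡-Reasoning
    x-1*x≡0 : ∀ x → x + - 1# * x ≡ 0#
    x-1*x≡0 = solve 1 (λ x → x :+ :- :1 :* x := :0) refl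

  -- Otherwise xˢ⁺¹ - x, of degree s + 1 ≤ q - 1, would vanish on all of F. This stands in for a
  -- primitive root.
  nontrivial-power : ∀ {s} → 0 ℕ.< s → s ℕ.< n → ∃ λ a → a ≢ 0# × a ^ s ≢ 1#
  nontrivial-power {s} 0<s s<n with any? (λ a → ¬? (a ≟ 0#) ×-dec ¬? (a ^ s ≟ 1#))
  ... | yes w = w
  ... | no none = ⊥-elim (lead-nonvanishing {suc s} {1#} {λ _ → 0#} (λ e → 0≢1 (sym e)) all-roots s<n (λ _ → refl))
    where
    x^[1+s]≡x : ∀ x → x ^ suc s ≡ x
    x^[1+s]≡x x with x ≟ 0#
    ... | yes refl = zeroˡ _
    ... | no x≢0 with x ^ s ≟ 1#
    ...   | yes e = trans (cong (x *_) e) (*-identityʳ x)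
    ...   | no ne = contradiction (x , x≢0 , ne) none
    lin : ∀ x → - x ≡ - 1# * (x * 1#) + 0#
    lin = solve 1 (λ x → :- x := :- :1 :* (x :* :1) :+ :0) refl
    low-neg : Low 2 (λ x → - x)
    low-neg = low₊ (- 1#) (lead (λ _ → 0#) (low-0 1) lin)
    all-roots : Lead (suc s) 1# (λ _ → 0#)
    all-roots = lead (λ x → - x) (low-≤ (s≤s 0<s) low-neg) λ x →
      sym (trans (cong (_+ - x) (trans (*-identityˡ _) (x^[1+s]≡x x))) (-‿inverseʳ x))

  power-sum-0 : ∑F (_^ 0) ≡ 0#
  power-sum-0 = trans (∑F-const 1#) card×1≡0

  power-sum-n : 0 ℕ.< n → ∑F (_^ n) ≡ - 1#
  power-sum-n 0<n = trans (∑F-split-0 (_^ n) 1# fermat) (trans (cong₂ _+_ (0^ 0<n) n×1≡-1) (+-identityˡ _))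

  -- Replacing x by ax permutes the terms but multiplies the sum by aˢ, and a can be chosen with aˢ
  -- ≢ 1.
  power-sum-< : ∀ {s} → s ℕ.< n → ∑F (_^ s) ≡ 0#
  power-sum-< {zero} _ = power-sum-0
  power-sum-< {s@(suc _)} s<n =
    let a , a≢0 , a^s≢1 = nontrivial-power (s≤s z≤n) s<n
        S = ∑F (_^ s)
        a^sS≡S : a ^ s * S ≡ S
        a^sS≡S = trans (sym (∑F-* (a ^ s) (_^ s))) (trans (∑F-cong (λ x → sym (^-distrib-* a x s))) (∑F-permute (dilate a a≢0) (_^ s)))
    in *-cancelˡ (a ^ s + - 1#) (λ e → a^s≢1 (x-y≡0⇒x≡y e))
         (trans (distribute (a ^ s) S) (trans (x≡y⇒x-y≡0 a^sS≡S) (sym (zeroʳ _))))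
    where
    distribute : ∀ A S → (A + - 1#) * S ≡ A * S + - S
    distribute = solve 2 (λ A S → (A :- :1) :* S := A :* S :- S) refl

  -- At k = 0 this would fail for x = 0.
  x^[k+n]≡x^k : ∀ {k} → 0 ℕ.< k → ∀ x → x ^ (k ℕ.+ n) ≡ x ^ k
  x^[k+n]≡x^k {suc k} _ x = begin
    x ^ (suc k ℕ.+ n)   ≡⟨ cong (x ^_) (ℕ.+-suc k n) ⟨
    x ^ (k ℕ.+ suc n)   ≡⟨ ^-homo-* x k (suc n) ⟩
    x ^ k * x ^ suc n   ≡⟨ cong (x ^ k *_) (x^1+n≡x x) ⟩
    x ^ k * x           ≡⟨ *-comm _ _ ⟩
    x ^ suc k           ∎
    where open ≡-Reasoning

-- Base-p digits of (pʲ - 1) / 2.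

double-injective : ∀ {a b} → a ℕ.+ a ≡ b ℕ.+ b → a ≡ b
double-injective {a} {b} e with ℕ.<-cmp a b
... | tri< a<b _ _ = contradiction e (ℕ.<⇒≢ (ℕ.+-mono-< a<b a<b))
... | tri≈ _ a≡b _ = a≡b
... | tri> _ _ b<a = contradiction (sym e) (ℕ.<⇒≢ (ℕ.+-mono-< b<a b<a))

-- (pʲ - 1) / 2 for p = 1 + 2h; all its base-p digits are h.
half : ℕ → ℕ → ℕ
half h zero    = 0
half h (suc j) = h ℕ.+ suc (2 ℕ.* h) ℕ.* half h j

half-spec : ∀ h j → suc (2 ℕ.* half h j) ≡ suc (2 ℕ.* h) ℕ.^ j
half-spec h zero = refl
half-spec h (suc j) = trans (expand h (half h j)) (cong (suc (2 ℕ.* h) ℕ.*_) (half-spec h j))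
  where
  expand : ∀ h x → suc (2 ℕ.* (h ℕ.+ suc (2 ℕ.* h) ℕ.* x)) ≡ suc (2 ℕ.* h) ℕ.* suc (2 ℕ.* x)
  expand = ℕSolver.solve-∀

-- Concatenation of two blocks of digits h, the upper one moved up by j places.
half-+ : ∀ h j i → half h (j ℕ.+ i) ≡ half h j ℕ.+ half h i ℕ.* suc (2 ℕ.* h) ℕ.^ j
half-+ h zero i = sym (ℕ.*-identityʳ _)
half-+ h (suc j) i = trans (cong (λ x → h ℕ.+ suc (2 ℕ.* h) ℕ.* x) (half-+ h j i))
  (expand h (suc (2 ℕ.* h)) (half h j) (half h i) (suc (2 ℕ.* h) ℕ.^ j))
  where
  expand : ∀ h p x y P → h ℕ.+ p ℕ.* (x ℕ.+ y ℕ.* P) ≡ h ℕ.+ p ℕ.* x ℕ.+ y ℕ.* (p ℕ.* P)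
  expand = ℕSolver.solve-∀

half<^ : ∀ h j → half h j ℕ.< suc (2 ℕ.* h) ℕ.^ j
half<^ h j = subst (half h j ℕ.<_) (half-spec h j) (s≤s (ℕ.m≤m+n _ _))

-- Characteristic p: the Frobenius map and binomial coefficients modulo p.

module Characteristic (F : Field) {n : ℕ} (card : Fin (suc n) ↔ Field.Carrier F)
                      {h : ℕ} (pr : Prime (suc (2 ℕ.* h))) {r : ℕ} (q≡p^r : suc n ≡ suc (2 ℕ.* h) ℕ.^ r) where
  open Field F
  open FieldSolver F
  open FieldFacts F
  open FiniteField F card
  open Freshman semiring using ([x+y]^p)

  p : ℕ
  p = suc (2 ℕ.* h)

  ×-as-* : ∀ k x → k ×F x ≡ (k ×F 1#) * x
  ×-as-* k x = sym (trans (×-assoc-* k 1# x) (cong (k ×F_) (*-identityˡ x)))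

  p^j×1 : ∀ j → (p ℕ.^ j) ×F 1# ≡ (p ×F 1#) ^ j
  p^j×1 zero = ×-homo-1 1#
  p^j×1 (suc j) = trans (×1-homo-* p (p ℕ.^ j)) (cong ((p ×F 1#) *_) (p^j×1 j))

  -- Its r-th power is q · 1 = 0, and a field has no nonzero nilpotents.
  p×1≡0 : p ×F 1# ≡ 0#
  p×1≡0 = decidable-stable (p ×F 1# ≟ 0#) λ p≢0 →
    ^-nonzero r p≢0 (trans (sym (p^j×1 r)) (trans (cong (_×F 1#) (sym q≡p^r)) card×1≡0))

  p∣⇒×≡0 : ∀ {k} → p ∣ k → ∀ x → k ×F x ≡ 0#
  p∣⇒×≡0 {k} (divides c eq) x = begin
    k ×F x                       ≡⟨ ×-as-* k x ⟩
    (k ×F 1#) * x                ≡⟨ cong (λ k → (k ×F 1#) * x) eq ⟩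
    ((c ℕ.* p) ×F 1#) * x        ≡⟨ cong (_* x) (×1-homo-* c p) ⟩
    (c ×F 1#) * (p ×F 1#) * x    ≡⟨ cong (λ u → (c ×F 1#) * u * x) p×1≡0 ⟩
    (c ×F 1#) * 0# * x           ≡⟨ cong (_* x) (zeroʳ _) ⟩
    0# * x                       ≡⟨ zeroˡ x ⟩
    0#                           ∎
    where open ≡-Reasoning

  -- Bézout's identity for p and a would otherwise give 1 = 0 in F.
  ×1-nonzero : ∀ {a} → 0 ℕ.< a → a ℕ.< p → a ×F 1# ≢ 0#
  ×1-nonzero {a} 0<a a<p a≡0 = bezout (coprime-Bézout (prime⇒coprime pr {{ℕ.>-nonZero 0<a}} a<p))
    where
    kill : ∀ y → (y ℕ.* a) ×F 1# ≡ 0#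
    kill y = trans (×1-homo-* y a) (trans (cong ((y ×F 1#) *_) a≡0) (zeroʳ _))
    killp : ∀ x → (x ℕ.* p) ×F 1# ≡ 0#
    killp x = p∣⇒×≡0 (divides x refl) 1#
    absurd : ∀ u v → suc u ≡ v → u ×F 1# ≡ 0# → v ×F 1# ≡ 0# → ⊥
    absurd u v e u≡0 v≡0 = 0≢1 (sym (trans (sym (+-identityʳ 1#)) (trans (cong (1# +_) (sym u≡0)) (trans (cong (_×F 1#) e) v≡0))))
    bezout : Bézout.Identity 1 p a → ⊥
    bezout (Bézout.+- x y e) = absurd (y ℕ.* a) (x ℕ.* p) e (kill y) (killp x)
    bezout (Bézout.-+ x y e) = absurd (x ℕ.* p) (y ℕ.* a) e (killp x) (kill y)

  frobenius-+ : ∀ j x y → (x + y) ^ (p ℕ.^ j) ≡ x ^ (p ℕ.^ j) + y ^ (p ℕ.^ j)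
  frobenius-+ zero x y = trans (*-identityʳ _) (cong₂ _+_ (sym (*-identityʳ x)) (sym (*-identityʳ y)))
  frobenius-+ (suc j) x y = begin
    (x + y) ^ (p ℕ.* p ℕ.^ j)                    ≡⟨ ^-assocʳ (x + y) p (p ℕ.^ j) ⟨
    ((x + y) ^ p) ^ (p ℕ.^ j)                    ≡⟨ cong (_^ (p ℕ.^ j)) frob ⟩
    (x ^ p + y ^ p) ^ (p ℕ.^ j)                  ≡⟨ frobenius-+ j (x ^ p) (y ^ p) ⟩
    (x ^ p) ^ (p ℕ.^ j) + (y ^ p) ^ (p ℕ.^ j)    ≡⟨ cong₂ _+_ (^-assocʳ x p (p ℕ.^ j)) (^-assocʳ y p (p ℕ.^ j)) ⟩
    x ^ (p ℕ.* p ℕ.^ j) + y ^ (p ℕ.* p ℕ.^ j)    ∎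
    where
    open ≡-Reasoning
    frob : (x + y) ^ p ≡ x ^ p + y ^ p
    frob = let z , e = [x+y]^p pr x y (*-comm x y) in
      trans e (trans (cong (x ^ p + y ^ p +_) (p∣⇒×≡0 (divides 1 (sym (ℕ.+-identityʳ p))) z)) (+-identityʳ _))

  frobenius-- : ∀ j x y → (x + - y) ^ (p ℕ.^ j) ≡ x ^ (p ℕ.^ j) + - (y ^ (p ℕ.^ j))
  frobenius-- j x y = begin
    (x + - y) ^ P                            ≡⟨ add-sub ((x + - y) ^ P) (y ^ P) ⟩
    ((x + - y) ^ P + y ^ P) + - (y ^ P)      ≡⟨ cong (_+ - (y ^ P)) (frobenius-+ j (x + - y) y) ⟨
    ((x + - y) + y) ^ P + - (y ^ P)          ≡⟨ cong (λ z → z ^ P + - (y ^ P)) (sub-add x y) ⟩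
    x ^ P + - (y ^ P)                        ∎
    where
    open ≡-Reasoning
    P = p ℕ.^ j
    add-sub : ∀ a b → a ≡ (a + b) + - b
    add-sub = solve 2 (λ a b → a := (a :+ b) :- b) refl
    sub-add : ∀ a b → (a + - b) + b ≡ a
    sub-add = solve 2 (λ a b → (a :- b) :+ b := a) refl

  x^p^[ir]≡x : ∀ i x → x ^ (p ℕ.^ (i ℕ.* r)) ≡ x
  x^p^[ir]≡x zero x = *-identityʳ x
  x^p^[ir]≡x (suc i) x = begin
    x ^ (p ℕ.^ (r ℕ.+ i ℕ.* r))            ≡⟨ cong (x ^_) (ℕ.^-distribˡ-+-* p r (i ℕ.* r)) ⟩
    x ^ (p ℕ.^ r ℕ.* p ℕ.^ (i ℕ.* r))      ≡⟨ ^-assocʳ x (p ℕ.^ r) (p ℕ.^ (i ℕ.* r)) ⟨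
    (x ^ (p ℕ.^ r)) ^ (p ℕ.^ (i ℕ.* r))    ≡⟨ cong (λ k → (x ^ k) ^ (p ℕ.^ (i ℕ.* r))) (sym q≡p^r) ⟩
    (x ^ suc n) ^ (p ℕ.^ (i ℕ.* r))        ≡⟨ cong (_^ (p ℕ.^ (i ℕ.* r))) (x^1+n≡x x) ⟩
    x ^ (p ℕ.^ (i ℕ.* r))                  ≡⟨ x^p^[ir]≡x i x ⟩
    x                                      ∎
    where open ≡-Reasoning

  bin : ℕ → ℕ → Carrier
  bin N K = (N C K) ×F 1#

  bin-0 : ∀ N → bin N 0 ≡ 1#
  bin-0 N = +-identityʳ 1#

  bin-> : ∀ {N K} → N ℕ.< K → bin N K ≡ 0#
  bin-> N<K = cong (_×F 1#) (k>n⇒nCk≡0 N<K)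

  bin-pascal : ∀ N K → bin (suc N) (suc K) ≡ bin N K + bin N (suc K)
  bin-pascal N K = trans (cong (_×F 1#) (sym (nCk+nC[k+1]≡[n+1]C[k+1] N K))) (×-homo-+ 1# (N C K) (N C suc K))

  -- Induction with (K + 1) C(N+1,K+1) = (N + 1) C(N,K), where N + 1 < p is nonzero in F.
  bin-nonzero : ∀ {N K} → K ℕ.≤ N → N ℕ.< p → bin N K ≢ 0#
  bin-nonzero {N} {zero} _ _ e = 0≢1 (sym (trans (sym (bin-0 N)) e))
  bin-nonzero {suc N} {suc K} (s≤s K≤N) N<p e =
    *-nonzero (×1-nonzero (s≤s z≤n) N<p) (bin-nonzero K≤N (ℕ.<-trans (ℕ.n<1+n N) N<p)) (begin
      (suc N ×F 1#) * bin N K              ≡⟨ ×1-homo-* (suc N) (N C K) ⟨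
      (suc N ℕ.* (N C K)) ×F 1#            ≡⟨ cong (_×F 1#) ([1+k]*[1+n]C[1+k]≡[1+n]*nCk N K) ⟨
      (suc K ℕ.* (suc N C suc K)) ×F 1#    ≡⟨ ×1-homo-* (suc K) (suc N C suc K) ⟩
      (suc K ×F 1#) * bin (suc N) (suc K)  ≡⟨ cong ((suc K ×F 1#) *_) e ⟩
      (suc K ×F 1#) * 0#                   ≡⟨ zeroʳ _ ⟩
      0#                                   ∎)
    where open ≡-Reasoning

  -- Lucas' congruence, as far as it is needed: (1 + X)ᴺ⁺ᴾ = (1 + X)ᴺ (1 + Xᴾ) for P a power of p.
  module Shift (j : ℕ) where
    private
      P : ℕ
      P = p ℕ.^ j

      0<P : 0 ℕ.< P
      0<P = ℕ.m^n>0 p j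

    bin-P : ∀ K → 0 ℕ.< K → K ℕ.< P → bin P K ≡ 0#
    bin-P K 0<K K<P = p∣⇒×≡0 (p∣[p^j]Ci pr j K 0<K K<P) 1#

    bin-shift< : ∀ N K → K ℕ.< P → bin (N ℕ.+ P) K ≡ bin N K
    bin-shift< N zero _ = trans (bin-0 (N ℕ.+ P)) (sym (bin-0 N))
    bin-shift< zero (suc K) K<P = trans (bin-P (suc K) (s≤s z≤n) K<P) (sym (bin-> {0} {suc K} (s≤s z≤n)))
    bin-shift< (suc N) (suc K) K<P = begin
      bin (suc (N ℕ.+ P)) (suc K)             ≡⟨ bin-pascal (N ℕ.+ P) K ⟩
      bin (N ℕ.+ P) K + bin (N ℕ.+ P) (suc K) ≡⟨ cong₂ _+_ (bin-shift< N K (ℕ.<-trans (ℕ.n<1+n K) K<P)) (bin-shift< N (suc K) K<P) ⟩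
      bin N K + bin N (suc K)                 ≡⟨ bin-pascal N K ⟨
      bin (suc N) (suc K)                     ∎
      where open ≡-Reasoning

    bin-shift : ∀ N K → bin (N ℕ.+ P) (P ℕ.+ K) ≡ bin N (P ℕ.+ K) + bin N K
    bin-shift zero zero = begin
      bin P (P ℕ.+ 0)             ≡⟨ cong (λ k → bin P k) (ℕ.+-identityʳ P) ⟩
      bin P P                     ≡⟨ cong (_×F 1#) (nCn≡1 P) ⟩
      1 ×F 1#                     ≡⟨ +-identityˡ _ ⟨
      0# + 1 ×F 1#                ≡⟨ cong (_+ 1 ×F 1#) (bin-> {0} {P ℕ.+ 0} (ℕ.<-≤-trans 0<P (ℕ.m≤m+n P 0))) ⟨
      bin 0 (P ℕ.+ 0) + bin 0 0   ∎
      where open ≡-Reasoning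
    bin-shift zero (suc K) = trans (bin-> {P} (ℕ.m<m+n P (s≤s z≤n)))
      (sym (trans (cong₂ _+_ (bin-> {0} (ℕ.<-≤-trans 0<P (ℕ.m≤m+n P (suc K)))) (bin-> {0} {suc K} (s≤s z≤n))) (+-identityˡ _)))
    bin-shift (suc N) zero = begin
      bin (suc (N ℕ.+ P)) (P ℕ.+ 0)             ≡⟨ cong (bin (suc (N ℕ.+ P))) P+0 ⟩
      bin (suc (N ℕ.+ P)) (suc P-1)             ≡⟨ bin-pascal (N ℕ.+ P) P-1 ⟩
      bin (N ℕ.+ P) P-1 + bin (N ℕ.+ P) (suc P-1) ≡⟨ cong₂ _+_ (bin-shift< N P-1 P-1<P) (trans (cong (bin (N ℕ.+ P)) (sym P+0)) (bin-shift N 0)) ⟩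
      bin N P-1 + (bin N (P ℕ.+ 0) + bin N 0)   ≡⟨ +-assoc _ _ _ ⟨
      bin N P-1 + bin N (P ℕ.+ 0) + bin N 0     ≡⟨ cong (λ k → bin N P-1 + bin N k + bin N 0) P+0 ⟩
      bin N P-1 + bin N (suc P-1) + bin N 0     ≡⟨ cong (_+ bin N 0) (bin-pascal N P-1) ⟨
      bin (suc N) (suc P-1) + bin (suc N) 0     ≡⟨ cong (λ k → bin (suc N) k + bin (suc N) 0) P+0 ⟨
      bin (suc N) (P ℕ.+ 0) + bin (suc N) 0     ∎
      where
      open ≡-Reasoning
      P-1 = ℕ.pred P
      1+P-1 : suc P-1 ≡ P
      1+P-1 = ℕ.suc-pred P {{ℕ.>-nonZero 0<P}}
      P+0 : P ℕ.+ 0 ≡ suc P-1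
      P+0 = trans (ℕ.+-identityʳ P) (sym 1+P-1)
      P-1<P : P-1 ℕ.< P
      P-1<P = subst (P-1 ℕ.<_) 1+P-1 (ℕ.n<1+n P-1)
    bin-shift (suc N) (suc K) = begin
      bin (suc (N ℕ.+ P)) (P ℕ.+ suc K)                      ≡⟨ cong (bin (suc (N ℕ.+ P))) (ℕ.+-suc P K) ⟩
      bin (suc (N ℕ.+ P)) (suc (P ℕ.+ K))                    ≡⟨ bin-pascal (N ℕ.+ P) (P ℕ.+ K) ⟩
      bin (N ℕ.+ P) (P ℕ.+ K) + bin (N ℕ.+ P) (suc (P ℕ.+ K)) ≡⟨ cong₂ _+_ (bin-shift N K) (trans (cong (bin (N ℕ.+ P)) (sym (ℕ.+-suc P K))) (bin-shift N (suc K))) ⟩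
      (bin N (P ℕ.+ K) + bin N K) + (bin N (P ℕ.+ suc K) + bin N (suc K)) ≡⟨ interchange (bin N (P ℕ.+ K)) (bin N K) (bin N (P ℕ.+ suc K)) (bin N (suc K)) ⟩
      (bin N (P ℕ.+ K) + bin N (P ℕ.+ suc K)) + (bin N K + bin N (suc K)) ≡⟨ cong (λ k → bin N (P ℕ.+ K) + bin N k + (bin N K + bin N (suc K))) (ℕ.+-suc P K) ⟩
      (bin N (P ℕ.+ K) + bin N (suc (P ℕ.+ K))) + (bin N K + bin N (suc K)) ≡⟨ cong₂ _+_ (bin-pascal N (P ℕ.+ K)) (bin-pascal N K) ⟨
      bin (suc N) (suc (P ℕ.+ K)) + bin (suc N) (suc K)      ≡⟨ cong (λ k → bin (suc N) k + bin (suc N) (suc K)) (ℕ.+-suc P K) ⟨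
      bin (suc N) (P ℕ.+ suc K) + bin (suc N) (suc K)        ∎
      where
      open ≡-Reasoning
      interchange : ∀ a b c d → (a + b) + (c + d) ≡ (a + c) + (b + d)
      interchange = solve 4 (λ a b c d → (a :+ b) :+ (c :+ d) := (a :+ c) :+ (b :+ d)) refl

    private
      peel : ∀ N v → N ℕ.+ suc v ℕ.* P ≡ (N ℕ.+ v ℕ.* P) ℕ.+ P
      peel N v = lemma N v P
        where
        lemma : ∀ N v P → N ℕ.+ suc v ℕ.* P ≡ (N ℕ.+ v ℕ.* P) ℕ.+ P
        lemma = ℕSolver.solve-∀

    bin-shifts< : ∀ N v K → K ℕ.< P → bin (N ℕ.+ v ℕ.* P) K ≡ bin N K
    bin-shifts< N zero K K<P = cong (λ M → bin M K) (ℕ.+-identityʳ N)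
    bin-shifts< N (suc v) K K<P = trans (cong (λ M → bin M K) (peel N v)) (trans (bin-shift< (N ℕ.+ v ℕ.* P) K K<P) (bin-shifts< N v K K<P))

    -- In (1 + X)ᴺ (1 + Xᴾ)ᵛ the second factor is 1 + v Xᴾ up to powers beyond P + K, because K < P.
    bin-shifts : ∀ N v K → K ℕ.< P → bin (N ℕ.+ v ℕ.* P) (P ℕ.+ K) ≡ bin N (P ℕ.+ K) + v ×F bin N K
    bin-shifts N zero K K<P = trans (cong (λ M → bin M (P ℕ.+ K)) (ℕ.+-identityʳ N)) (sym (+-identityʳ _))
    bin-shifts N (suc v) K K<P = begin
      bin (N ℕ.+ suc v ℕ.* P) (P ℕ.+ K)                         ≡⟨ cong (λ M → bin M (P ℕ.+ K)) (peel N v) ⟩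
      bin (N ℕ.+ v ℕ.* P ℕ.+ P) (P ℕ.+ K)                       ≡⟨ bin-shift (N ℕ.+ v ℕ.* P) K ⟩
      bin (N ℕ.+ v ℕ.* P) (P ℕ.+ K) + bin (N ℕ.+ v ℕ.* P) K     ≡⟨ cong₂ _+_ (bin-shifts N v K K<P) (bin-shifts< N v K K<P) ⟩
      bin N (P ℕ.+ K) + v ×F bin N K + bin N K                  ≡⟨ +-assoc _ _ _ ⟩
      bin N (P ℕ.+ K) + (v ×F bin N K + bin N K)                ≡⟨ cong (bin N (P ℕ.+ K) +_) (+-comm _ _) ⟩
      bin N (P ℕ.+ K) + (bin N K + v ×F bin N K)                ∎
      where open ≡-Reasoning

  h<p : h ℕ.< p
  h<p = s≤s (ℕ.m≤m+n h (h ℕ.+ 0))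

  -- The lowest base-p digit is h, so by Lucas the coefficient equals C(h,k) modulo p.
  bin-half : ∀ j k → k ℕ.≤ h → bin (half h (suc j)) k ≢ 0#
  bin-half j k k≤h e = bin-nonzero k≤h h<p (trans (sym (trans (cong (λ M → bin M k) half≡)
      (Shift.bin-shifts< 1 h (half h j) k (subst (k ℕ.<_) (sym (ℕ.*-identityʳ p)) (ℕ.≤-<-trans k≤h h<p))))) e)
    where
    half≡ : half h (suc j) ≡ h ℕ.+ half h j ℕ.* (p ℕ.^ 1)
    half≡ = cong (h ℕ.+_) (trans (ℕ.*-comm p (half h j)) (cong (half h j ℕ.*_) (sym (ℕ.*-identityʳ p))))

  -- Cutting the digits at P reduces the coefficient to `half h (suc i)`, which is h modulo p, times
  -- C(`half h (suc j)`, h).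
  bin-half-+ : 0 ℕ.< h → ∀ j i → bin (half h (suc j ℕ.+ suc i)) (p ℕ.^ suc j ℕ.+ h) ≢ 0#
  bin-half-+ 0<h j i e = *-nonzero half×1≢0 (bin-half j h ℕ.≤-refl) (begin
    (half h (suc i) ×F 1#) * bin (half h (suc j)) h     ≡⟨ ×-as-* (half h (suc i)) _ ⟨
    half h (suc i) ×F bin (half h (suc j)) h            ≡⟨ +-identityˡ _ ⟨
    0# + half h (suc i) ×F bin (half h (suc j)) h       ≡⟨ cong (_+ half h (suc i) ×F bin (half h (suc j)) h)
                                                            (bin-> {half h (suc j)} {P ℕ.+ h} (ℕ.<-≤-trans (half<^ h (suc j)) (ℕ.m≤m+n P h))) ⟨
    bin (half h (suc j)) (P ℕ.+ h) + half h (suc i) ×F bin (half h (suc j)) h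
                                                        ≡⟨ Shift.bin-shifts (suc j) (half h (suc j)) (half h (suc i)) h h<P ⟨
    bin (half h (suc j) ℕ.+ half h (suc i) ℕ.* P) (P ℕ.+ h) ≡⟨ cong (λ M → bin M (P ℕ.+ h)) (half-+ h (suc j) (suc i)) ⟨
    bin (half h (suc j ℕ.+ suc i)) (P ℕ.+ h)            ≡⟨ e ⟩
    0#                                                  ∎)
    where
    open ≡-Reasoning
    P = p ℕ.^ suc j
    h<P : h ℕ.< P
    h<P = ℕ.<-≤-trans h<p (ℕ.m≤m*n p (p ℕ.^ j) {{ℕ.m^n≢0 p j}})
    half×1≢0 : half h (suc i) ×F 1# ≢ 0#
    half×1≢0 e = ×1-nonzero 0<h h<p (trans (sym (+-identityʳ _)) (trans (cong (h ×F 1# +_) (sym (p∣⇒×≡0 (divides (half h i) (ℕ.*-comm p (half h i))) 1#)))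
      (trans (sym (×-homo-+ 1# h (p ℕ.* half h i))) e)))

-- Carlitz' theorem.

module Paley (F : Field) {n : ℕ} (card : Fin (suc n) ↔ Field.Carrier F)
             {h : ℕ} (pr : Prime (suc (2 ℕ.* h))) {r-1 : ℕ} (q≡p^r : suc n ≡ suc (2 ℕ.* h) ℕ.^ suc r-1) where
  open Field F
  open FieldSolver F
  open FieldFacts F
  open Polynomials F
  open FiniteField F card
  open Characteristic F card {h} pr {suc r-1} q≡p^r
  open SemiringSum semiring using (sum-cong-≗; *-distribˡ-sum; ∑-comm; sum-replicate-zero; sum-remove; sum-init-last) renaming (sum to ∑)

  m : ℕ
  m = half h (suc r-1)

  n≡m+m : n ≡ m ℕ.+ m
  n≡m+m = ℕ.suc-injective (trans q≡p^r (trans (sym (half-spec h (suc r-1))) (cong (λ k → suc (m ℕ.+ k)) (ℕ.+-identityʳ m))))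

  0<h : 0 ℕ.< h
  0<h = positive h pr
    where
    positive : ∀ h → Prime (suc (2 ℕ.* h)) → 0 ℕ.< h
    positive zero pr = contradiction pr ¬prime[1]
    positive (suc h) _ = s≤s z≤n

  h≤m : h ℕ.≤ m
  h≤m = ℕ.m≤m+n h _

  0<m : 0 ℕ.< m
  0<m = ℕ.<-≤-trans 0<h h≤m

  m≤n : m ℕ.≤ n
  m≤n = subst (m ℕ.≤_) (sym n≡m+m) (ℕ.m≤m+n m m)

  m<n : m ℕ.< n
  m<n = subst (m ℕ.<_) (sym n≡m+m) (ℕ.m<m+n m 0<m)

  0<n : 0 ℕ.< n
  0<n = ℕ.<-trans 0<m m<n

  ∑-single : ∀ {k} (t : Fin k → Carrier) i → (∀ j → j ≢ i → t j ≡ 0#) → ∑ t ≡ t i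
  ∑-single {suc k} t i z = trans (sum-remove {i = i} t) (trans (cong (t i +_)
    (trans (sum-cong-≗ {k} (λ j → z (punchIn i j) (Fin.punchInᵢ≢i i j))) (sum-replicate-zero k))) (+-identityʳ _))

  -- Binomial expansion with the sums exchanged. The functions u and v are left free because both z
  -- and w² are expanded this way.
  moment : ∀ N (u v : Carrier → Carrier) d →
    ∑F (λ z → v z * (u z + d) ^ N) ≡ ∑ {suc N} (λ k → bin N (toℕ k) * d ^ (N ℕ.∸ toℕ k) * ∑F (λ z → v z * u z ^ toℕ k))
  moment N u v d = begin
    ∑F (λ z → v z * (u z + d) ^ N)
      ≡⟨ ∑F-cong (λ z → trans (cong (v z *_) (CommutativeBinomial.theorem commutativeSemiring N (u z) d)) (*-distribˡ-sum (v z) (term z))) ⟩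
    ∑F (λ z → ∑ {suc N} (λ k → v z * term z k))
      ≡⟨ ∑-comm {suc n} {suc N} (λ i k → v (elt i) * term (elt i) k) ⟩
    ∑ {suc N} (λ k → ∑F (λ z → v z * term z k))
      ≡⟨ sum-cong-≗ {suc N} (λ k → trans (∑F-cong (λ z → regroup z k)) (∑F-* (coeff k) (λ z → v z * u z ^ toℕ k))) ⟩
    ∑ {suc N} (λ k → coeff k * ∑F (λ z → v z * u z ^ toℕ k)) ∎
    where
    open ≡-Reasoning
    term : Carrier → Fin (suc N) → Carrier
    term z k = (N C toℕ k) ×F (u z ^ toℕ k * d ^ (N ℕ.∸ toℕ k))
    coeff : Fin (suc N) → Carrier
    coeff k = bin N (toℕ k) * d ^ (N ℕ.∸ toℕ k)
    reorder : ∀ V B U D → V * (B * (U * D)) ≡ B * D * (V * U)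
    reorder = solve 4 (λ V B U D → V :* (B :* (U :* D)) := B :* D :* (V :* U)) refl
    regroup : ∀ z k → v z * term z k ≡ coeff k * (v z * u z ^ toℕ k)
    regroup z k = trans (cong (v z *_) (×-as-* (N C toℕ k) _)) (reorder (v z) (bin N (toℕ k)) (u z ^ toℕ k) (d ^ (N ℕ.∸ toℕ k)))

  -- Exponents strictly between n and 2n reduce by n to positive exponents below n.
  power-sum-zero : ∀ {s} → s ≢ n → s ℕ.< n ℕ.+ n → ∑F (_^ s) ≡ 0#
  power-sum-zero {s} s≢n s<2n with ℕ.<-cmp s n
  ... | tri< s<n _ _ = power-sum-< s<n
  ... | tri≈ _ s≡n _ = contradiction s≡n s≢n
  ... | tri> _ _ n<s = trans (∑F-cong reduce) (power-sum-< s∸n<n)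
    where
    s∸n<n : s ℕ.∸ n ℕ.< n
    s∸n<n = subst (s ℕ.∸ n ℕ.<_) (ℕ.m+n∸n≡m n n) (ℕ.∸-monoˡ-< s<2n (ℕ.<⇒≤ n<s))
    reduce : ∀ x → x ^ s ≡ x ^ (s ℕ.∸ n)
    reduce x = trans (cong (x ^_) (sym (ℕ.m∸n+n≡m (ℕ.<⇒≤ n<s)))) (x^[k+n]≡x^k (ℕ.m<n⇒0<n∸m n<s) x)

  -- Only the term with z^(2m) survives the summation over z.
  key-moment : ∀ b → b ℕ.≤ m → ∀ d → ∑F (λ z → z ^ (m ℕ.+ b) * (z + d) ^ m) ≡ - (bin m b * d ^ b)
  key-moment b b≤m d = begin
    ∑F (λ z → z ^ (m ℕ.+ b) * (z + d) ^ m)  ≡⟨ moment m id (_^ (m ℕ.+ b)) d ⟩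
    ∑ t                                     ≡⟨ ∑-single t k₀ others ⟩
    t k₀                                    ≡⟨ at-k toℕk₀ ⟩
    bin m (m ℕ.∸ b) * d ^ (m ℕ.∸ (m ℕ.∸ b)) * ∑F (λ z → z ^ (m ℕ.+ b) * z ^ (m ℕ.∸ b))
      ≡⟨ cong₂ (λ B e → B * d ^ e * ∑F (λ z → z ^ (m ℕ.+ b) * z ^ (m ℕ.∸ b))) (cong (_×F 1#) (sym (nCk≡nC[n∸k] b≤m))) (ℕ.m∸[m∸n]≡n b≤m) ⟩
    bin m b * d ^ b * ∑F (λ z → z ^ (m ℕ.+ b) * z ^ (m ℕ.∸ b))
      ≡⟨ cong (bin m b * d ^ b *_) (trans (∑F-cong (λ z → trans (sym (^-homo-* z (m ℕ.+ b) (m ℕ.∸ b))) (cong (z ^_) exponent))) (power-sum-n 0<n)) ⟩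
    bin m b * d ^ b * - 1#                  ≡⟨ x*-1≡-x _ ⟩
    - (bin m b * d ^ b)                     ∎
    where
    open ≡-Reasoning
    t : Fin (suc m) → Carrier
    t k = bin m (toℕ k) * d ^ (m ℕ.∸ toℕ k) * ∑F (λ z → z ^ (m ℕ.+ b) * z ^ toℕ k)
    k₀ : Fin (suc m)
    k₀ = fromℕ< (s≤s (ℕ.m∸n≤m m b))
    toℕk₀ : toℕ k₀ ≡ m ℕ.∸ b
    toℕk₀ = Fin.toℕ-fromℕ< (s≤s (ℕ.m∸n≤m m b))
    at-k : ∀ {e} → toℕ k₀ ≡ e → t k₀ ≡ bin m e * d ^ (m ℕ.∸ e) * ∑F (λ z → z ^ (m ℕ.+ b) * z ^ e)
    at-k refl = refl
    exponent : m ℕ.+ b ℕ.+ (m ℕ.∸ b) ≡ n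
    exponent = trans (ℕ.+-assoc m b _) (trans (cong (m ℕ.+_) (ℕ.m+[n∸m]≡n b≤m)) (sym n≡m+m))
    others : ∀ k → k ≢ k₀ → t k ≡ 0#
    others k k≢k₀ = trans (cong (bin m (toℕ k) * d ^ (m ℕ.∸ toℕ k) *_) (trans (∑F-cong (λ z → sym (^-homo-* z (m ℕ.+ b) (toℕ k))))
        (power-sum-zero {m ℕ.+ b ℕ.+ toℕ k} ≢n <2n))) (zeroʳ _)
      where
      ≢n : m ℕ.+ b ℕ.+ toℕ k ≢ n
      ≢n e = k≢k₀ (Fin.toℕ-injective (trans (ℕ.+-cancelˡ-≡ (m ℕ.+ b) (toℕ k) (m ℕ.∸ b) (trans e (sym exponent))) (sym toℕk₀)))
      <2n : m ℕ.+ b ℕ.+ toℕ k ℕ.< n ℕ.+ n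
      <2n = ℕ.+-mono-≤-< (subst (m ℕ.+ b ℕ.≤_) (sym n≡m+m) (ℕ.+-monoʳ-≤ m b≤m)) (ℕ.≤-<-trans (Fin.toℕ≤pred[n] k) m<n)

  -- The map z ↦ zᵐ is the quadratic character with values in F, so this is the polynomial form of
  -- being an automorphism of the Paley graph.
  Preserves : Carrier ↔ Carrier → Set
  Preserves f = ∀ x y → (Inverse.to f x + - Inverse.to f y) ^ m ≡ (x + - y) ^ m

  -- As a function of y, the sum over x is a linear combination of the polynomials (x - y)ᵐ, each of
  -- degree m. By `key-moment` it is also a nonzero multiple of f(y)ᵇ.
  low-power : ∀ f → Preserves f → ∀ b → b ℕ.≤ m → bin m b ≢ 0# → Low (suc m) (λ y → Inverse.to f y ^ b)
  low-power f pres b b≤m bin≢0 =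
    let c , bin*c = *-inverse (bin m b) bin≢0
        -- Here c inverts C(m,b), and the remaining factors undo the two signs in `sum≡`.
        k = (- 1#) ^ b * (c * - 1#)
    in low-cong (λ y → formula y c bin*c) (low-scale k (low-∑ summand summand-low))
    where
    open ≡-Reasoning
    φ = Inverse.to f
    summand : Fin (suc n) → Carrier → Carrier
    summand i y = φ (elt i) ^ (m ℕ.+ b) * (elt i + - y) ^ m
    linear : ∀ x y → x + - y ≡ - 1# * (y * 1#) + x
    linear = solve 2 (λ x y → x :- y := :- :1 :* (y :* :1) :+ x) refl
    summand-low : ∀ i → Low (suc m) (summand i)
    summand-low i = low-scale (φ (elt i) ^ (m ℕ.+ b)) (subst (λ e → Low (suc e) (λ y → (elt i + - y) ^ m)) (ℕ.*-identityʳ m)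
      (low₊ ((- 1#) ^ m) (lead-^ {1} {g = λ y → elt i + - y} m (lead (λ _ → elt i) (low₊ (elt i) (lead-const (elt i))) (linear (elt i))))))
    sum≡ : ∀ y → ∑ (λ i → summand i y) ≡ - (bin m b * (- φ y) ^ b)
    sum≡ y = begin
      ∑F (λ x → φ x ^ (m ℕ.+ b) * (x + - y) ^ m)        ≡⟨ ∑F-cong (λ x → cong (φ x ^ (m ℕ.+ b) *_) (sym (pres x y))) ⟩
      ∑F (λ x → φ x ^ (m ℕ.+ b) * (φ x + - φ y) ^ m)    ≡⟨ ∑F-permute f (λ z → z ^ (m ℕ.+ b) * (z + - φ y) ^ m) ⟩
      ∑F (λ z → z ^ (m ℕ.+ b) * (z + - φ y) ^ m)        ≡⟨ key-moment b b≤m (- φ y) ⟩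
      - (bin m b * (- φ y) ^ b)                         ∎
    regroup : ∀ E c B X → E * (c * - 1#) * - (B * X) ≡ B * c * (E * X)
    regroup = solve 4 (λ E c B X → E :* (c :* :- :1) :* :- (B :* X) := B :* c :* (E :* X)) refl
    neg-neg : ∀ x → - 1# * - x ≡ x
    neg-neg = solve 1 (λ x → :- :1 :* :- x := x) refl
    formula : ∀ y c → bin m b * c ≡ 1# → (- 1#) ^ b * (c * - 1#) * ∑ (λ i → summand i y) ≡ φ y ^ b
    formula y c bin*c = begin
      (- 1#) ^ b * (c * - 1#) * ∑ (λ i → summand i y)           ≡⟨ cong ((- 1#) ^ b * (c * - 1#) *_) (sum≡ y) ⟩
      (- 1#) ^ b * (c * - 1#) * - (bin m b * (- φ y) ^ b)       ≡⟨ regroup ((- 1#) ^ b) c (bin m b) ((- φ y) ^ b) ⟩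
      bin m b * c * ((- 1#) ^ b * (- φ y) ^ b)                  ≡⟨ cong (_* ((- 1#) ^ b * (- φ y) ^ b)) bin*c ⟩
      1# * ((- 1#) ^ b * (- φ y) ^ b)                           ≡⟨ *-identityˡ _ ⟩
      (- 1#) ^ b * (- φ y) ^ b                                  ≡⟨ ^-distrib-* (- 1#) (- φ y) b ⟨
      (- 1# * - φ y) ^ b                                        ≡⟨ cong (_^ b) (neg-neg (φ y)) ⟩
      φ y ^ b                                                   ∎

  -- The inverse is the Frobenius power j(r - 1), since j + j(r - 1) is a multiple of r.
  frobenius : ℕ → Carrier ↔ Carrier
  frobenius j = mk↔ₛ′ (_^ (p ℕ.^ j)) (_^ (p ℕ.^ (j ℕ.* r-1)))
      (λ x → inv (j ℕ.* r-1) j (trans (ℕ.+-comm (j ℕ.* r-1) j) (sym (ℕ.*-suc j r-1))) x)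
      (λ x → inv j (j ℕ.* r-1) (sym (ℕ.*-suc j r-1)) x)
    where
    inv : ∀ a b → a ℕ.+ b ≡ j ℕ.* suc r-1 → ∀ x → (x ^ (p ℕ.^ a)) ^ (p ℕ.^ b) ≡ x
    inv a b e x = trans (^-assocʳ x (p ℕ.^ a) (p ℕ.^ b)) (trans (cong (x ^_) (trans (sym (ℕ.^-distribˡ-+-* p a b)) (cong (p ℕ.^_) e))) (x^p^[ir]≡x j x))

  frobenius∘ : ℕ → Carrier ↔ Carrier → Carrier ↔ Carrier
  frobenius∘ j f = mk↔ₛ′ (λ x → Inverse.to f x ^ (p ℕ.^ j)) (λ x → Inverse.from f (Inverse.from (frobenius j) x))
    (λ x → trans (cong (_^ (p ℕ.^ j)) (Inverse.inverseˡ f refl)) (Inverse.inverseˡ (frobenius j) refl))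
    (λ x → trans (cong (Inverse.from f) (Inverse.inverseʳ (frobenius j) refl)) (Inverse.inverseʳ f refl))

  -- The quadratic character takes values fixed by Frobenius, because mp = m + h(q - 1). Hence
  -- twists of f again satisfy `Preserves`.
  [z^m]^p : ∀ z → (z ^ m) ^ p ≡ z ^ m
  [z^m]^p z = trans (^-assocʳ z m p) (trans (cong (z ^_) exponent) (drop h))
    where
    exponent : m ℕ.* p ≡ m ℕ.+ h ℕ.* n
    exponent = trans (lemma m h) (cong (λ k → m ℕ.+ h ℕ.* k) (sym n≡m+m))
      where
      lemma : ∀ m h → m ℕ.* suc (2 ℕ.* h) ≡ m ℕ.+ h ℕ.* (m ℕ.+ m)
      lemma = ℕSolver.solve-∀
    drop : ∀ k → z ^ (m ℕ.+ k ℕ.* n) ≡ z ^ m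
    drop zero = cong (z ^_) (ℕ.+-identityʳ m)
    drop (suc k) = trans (cong (z ^_) (rearrange m k n)) (trans (x^[k+n]≡x^k (ℕ.<-≤-trans 0<m (ℕ.m≤m+n m _)) z) (drop k))
      where
      rearrange : ∀ m k n → m ℕ.+ suc k ℕ.* n ≡ m ℕ.+ k ℕ.* n ℕ.+ n
      rearrange = ℕSolver.solve-∀

  [z^m]^p^j : ∀ j z → (z ^ m) ^ (p ℕ.^ j) ≡ z ^ m
  [z^m]^p^j zero z = *-identityʳ _
  [z^m]^p^j (suc j) z = trans (sym (^-assocʳ (z ^ m) p (p ℕ.^ j))) (trans (cong (_^ (p ℕ.^ j)) ([z^m]^p z)) ([z^m]^p^j j z))

  frobenius∘-preserves : ∀ j f → Preserves f → Preserves (frobenius∘ j f)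
  frobenius∘-preserves j f pres x y = begin
    (φ x ^ P + - (φ y ^ P)) ^ m   ≡⟨ cong (_^ m) (frobenius-- j (φ x) (φ y)) ⟨
    ((φ x + - φ y) ^ P) ^ m       ≡⟨ ^-assocʳ _ P m ⟩
    (φ x + - φ y) ^ (P ℕ.* m)     ≡⟨ cong ((φ x + - φ y) ^_) (ℕ.*-comm P m) ⟩
    (φ x + - φ y) ^ (m ℕ.* P)     ≡⟨ ^-assocʳ _ m P ⟨
    ((φ x + - φ y) ^ m) ^ P       ≡⟨ [z^m]^p^j j _ ⟩
    (φ x + - φ y) ^ m             ≡⟨ pres x y ⟩
    (x + - y) ^ m                 ∎
    where
    open ≡-Reasoning
    φ = Inverse.to f
    P = p ℕ.^ j

  to-injective : ∀ (f : Carrier ↔ Carrier) {x y} → Inverse.to f x ≡ Inverse.to f y → x ≡ y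
  to-injective f {x} {y} e = trans (sym (Inverse.inverseʳ f refl)) (trans (cong (Inverse.from f) e) (Inverse.inverseʳ f refl))

  low-self : ∀ f → Preserves f → Low (suc m) (Inverse.to f)
  low-self f pres = low-cong (λ y → *-identityʳ _) (low-power f pres 1 0<m (bin-half r-1 1 0<h))

  degree : ∀ f → Preserves f → ∃ λ k → ∃ λ c → k ℕ.≤ m × c ≢ 0# × Lead k c (Inverse.to f)
  degree f pres = result (low-degree _≟_ (low-self f pres))
    where
    result : _ ⊎ _ → _
    result (inj₁ z) = contradiction (to-injective f (trans (z 0#) (sym (z 1#)))) 0≢1
    result (inj₂ (k , c , s≤s k≤m , c≢0 , lg)) = k , c , k≤m , c≢0 , lg

  degree≤m : ∀ f → Preserves f → ∀ {a c} → c ≢ 0# → Lead a c (Inverse.to f) → a ℕ.≤ n → a ℕ.≤ m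
  degree≤m f pres c≢0 lf a≤n = ℕ.≤-pred (degree-unique c≢0 lf a≤n (low-self f pres))

  -- If ka ≤ m, then (k + 1)a ≤ 2m = q - 1, so f^(k+1) has not wrapped around and its degree (k +
  -- 1)a obeys the bound m of `low-power`.
  h*degree≤m : ∀ f → Preserves f → ∀ {a c} → c ≢ 0# → Lead a c (Inverse.to f) → a ℕ.≤ n → h ℕ.* a ℕ.≤ m
  h*degree≤m f pres {a} {c} c≢0 lf a≤n = go h ℕ.≤-refl
    where
    go : ∀ k → k ℕ.≤ h → k ℕ.* a ℕ.≤ m
    go zero _ = z≤n
    go (suc k) k<h = ℕ.≤-pred (degree-unique (^-nonzero (suc k) c≢0) (lead-^ (suc k) lf)
      (subst (a ℕ.+ k ℕ.* a ℕ.≤_) (sym n≡m+m) (ℕ.+-mono-≤ (degree≤m f pres c≢0 lf a≤n) (go k (ℕ.<⇒≤ k<h))))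
      (low-power f pres (suc k) (ℕ.≤-trans k<h h≤m) (bin-half r-1 (suc k) k<h)))

  -- The top base-p digit of m is h.
  m<[1+h]p^[r-1] : m ℕ.< suc h ℕ.* p ℕ.^ r-1
  m<[1+h]p^[r-1] = subst (ℕ._< suc h ℕ.* p ℕ.^ r-1) (sym (trans (cong (half h) (ℕ.+-comm 1 r-1)) (trans (half-+ h r-1 1)
      (cong (λ k → half h r-1 ℕ.+ k ℕ.* p ℕ.^ r-1) (trans (cong (h ℕ.+_) (ℕ.*-zeroʳ p)) (ℕ.+-identityʳ h))))))
    (ℕ.+-monoˡ-< (h ℕ.* p ℕ.^ r-1) (half<^ h r-1))

  -- f and its twist fᴾ cannot both have degree ≥ p^(r-1): otherwise f^h · fᴾ would have
  -- degree between m + 1 and 2m, although C(m, h + P) ≢ 0 makes it a polynomial of degree ≤ m.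
  twist-degree : ∀ f → Preserves f → ∀ {a c} → c ≢ 0# → Lead a c (Inverse.to f) → a ℕ.≤ n → p ℕ.^ r-1 ℕ.≤ a →
    ∀ j → suc j ℕ.≤ r-1 → ∀ {b d} → d ≢ 0# → Lead b d (λ x → Inverse.to f x ^ (p ℕ.^ suc j)) → b ℕ.≤ n → b ℕ.< p ℕ.^ r-1
  twist-degree f pres {a} {c} c≢0 lf a≤n a≥ j j<r-1 {b} {d} d≢0 lf′ b≤n = ℕ.≰⇒> λ b≥ →
    ℕ.<⇒≱ m<[1+h]p^[r-1] (ℕ.≤-trans (ℕ.+-mono-≤ b≥ (ℕ.*-monoʳ-≤ h a≥)) b+ha≤m)
    where
    P = p ℕ.^ suc j
    ha≤m = h*degree≤m f pres c≢0 lf a≤n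
    b≤m = degree≤m (frobenius∘ (suc j) f) (frobenius∘-preserves (suc j) f pres) d≢0 lf′ b≤n
    r≡ : suc j ℕ.+ suc (r-1 ℕ.∸ suc j) ≡ suc r-1
    r≡ = trans (ℕ.+-suc (suc j) _) (cong suc (ℕ.m+[n∸m]≡n j<r-1))
    bin≢0 : bin m (P ℕ.+ h) ≢ 0#
    bin≢0 = subst (λ r → bin (half h r) (P ℕ.+ h) ≢ 0#) r≡ (bin-half-+ 0<h j (r-1 ℕ.∸ suc j))
    P+h≤m : P ℕ.+ h ℕ.≤ m
    P+h≤m = ℕ.≮⇒≥ λ m<P+h → bin≢0 (bin-> m<P+h)
    b+ha≤m : b ℕ.+ h ℕ.* a ℕ.≤ m
    b+ha≤m = ℕ.≤-pred (degree-unique (*-nonzero d≢0 (^-nonzero h c≢0)) (lead-* lf′ (lead-^ h lf))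
      (subst (b ℕ.+ h ℕ.* a ℕ.≤_) (sym n≡m+m) (ℕ.+-mono-≤ b≤m ha≤m))
      (low-cong (λ x → ^-homo-* (Inverse.to f x) P h) (low-power f pres (P ℕ.+ h) P+h≤m bin≢0)))

  p^r-1*p : p ℕ.* p ℕ.^ r-1 ≡ suc n
  p^r-1*p = sym q≡p^r

  -- The degree of f is made ≥ p^(r-1) by a twist that does not wrap around.
  climb : ∀ {D} → 0 ℕ.< D → D ℕ.≤ n → ∃ λ k → p ℕ.^ k ℕ.* D ℕ.≤ n × p ℕ.^ r-1 ℕ.≤ p ℕ.^ k ℕ.* D
  climb {D} 0<D D≤n = result (search (suc r-1))
    where
    Found = ∃ λ k → p ℕ.^ k ℕ.* D ℕ.≤ n × p ℕ.^ r-1 ℕ.≤ p ℕ.^ k ℕ.* D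
    search : ∀ t → Found ⊎ (p ℕ.^ t ℕ.* D ℕ.≤ n)
    search zero = inj₂ (subst (ℕ._≤ n) (sym (ℕ.+-identityʳ D)) D≤n)
    search (suc t) with search t
    ... | inj₁ found = inj₁ found
    ... | inj₂ le with p ℕ.^ suc t ℕ.* D ℕ.≤? n
    ...   | yes le′ = inj₂ le′
    ...   | no gt = inj₁ (t , le , ℕ.*-cancelˡ-≤ p (subst₂ ℕ._≤_ (sym p^r-1*p) (ℕ.*-assoc p (p ℕ.^ t) D) (ℕ.≰⇒> gt)))
    result : Found ⊎ (p ℕ.^ suc r-1 ℕ.* D ℕ.≤ n) → Found
    result (inj₁ found) = found
    result (inj₂ le) = contradiction (ℕ.≤-trans (ℕ.m≤m*n (p ℕ.^ suc r-1) D {{ℕ.>-nonZero 0<D}}) le) (ℕ.<⇒≱ (subst (n ℕ.<_) q≡p^r (ℕ.n<1+n n)))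

  -- Let D be the degree of f^p. By `twist-degree` no twist f^(pʲ) with 0 < j < r reaches degree
  -- pʳ⁻¹, so D, pD, ..., pʳ⁻¹D never wrap around, and the last is the degree of f itself. Then h
  -- pʳ⁻¹D ≤ m < (h + 1)pʳ⁻¹ leaves D ≤ 1.
  large-degree⇒twist-linear : ∀ f → Preserves f → ∀ {a c} → c ≢ 0# → Lead a c (Inverse.to f) → a ℕ.≤ n → p ℕ.^ r-1 ℕ.≤ a →
    Low 2 (λ x → Inverse.to f x ^ (p ℕ.^ 1))
  large-degree⇒twist-linear f pres {a} {c} c≢0 lf a≤n a≥ = low-≤ (s≤s D≤1) (low₊ e lg)
    where
    φ = Inverse.to f
    g-degree = degree (frobenius∘ 1 f) (frobenius∘-preserves 1 f pres)
    D = proj₁ g-degree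
    e = proj₁ (proj₂ g-degree)
    D≤m : D ℕ.≤ m
    D≤m = proj₁ (proj₂ (proj₂ g-degree))
    e≢0 : e ≢ 0#
    e≢0 = proj₁ (proj₂ (proj₂ (proj₂ g-degree)))
    lg : Lead D e (λ x → φ x ^ (p ℕ.^ 1))
    lg = proj₂ (proj₂ (proj₂ (proj₂ g-degree)))
    tower : ∀ i → Lead (p ℕ.^ i ℕ.* D) (e ^ (p ℕ.^ i)) (λ x → φ x ^ (p ℕ.^ suc i))
    tower i = lead-cong (λ x → trans (^-assocʳ (φ x) (p ℕ.^ 1) (p ℕ.^ i)) (cong (φ x ^_) (cong (ℕ._* p ℕ.^ i) (ℕ.*-identityʳ p)))) (lead-^ (p ℕ.^ i) lg)
    -- The bound at i makes pⁱD a genuine degree, which `twist-degree` then puts below pʳ⁻¹. One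
    -- more factor p stays below q.
    bound : ∀ i → i ℕ.≤ r-1 → p ℕ.^ i ℕ.* D ℕ.≤ n
    bound zero _ = subst (ℕ._≤ n) (sym (ℕ.+-identityʳ D)) (ℕ.≤-trans D≤m m≤n)
    bound (suc i) i<r-1 = ℕ.≤-pred (subst₂ ℕ._<_ (sym (ℕ.*-assoc p (p ℕ.^ i) D)) p^r-1*p (ℕ.*-monoʳ-< p
      (twist-degree f pres c≢0 lf a≤n a≥ i i<r-1 (^-nonzero (p ℕ.^ i) e≢0) (tower i) (bound i (ℕ.<⇒≤ i<r-1)))))
    lf′ : Lead (p ℕ.^ r-1 ℕ.* D) (e ^ (p ℕ.^ r-1)) φ
    lf′ = lead-cong (λ x → trans (cong (φ x ^_) (sym q≡p^r)) (x^1+n≡x (φ x))) (tower r-1)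
    hD<1+h : h ℕ.* D ℕ.< suc h
    hD<1+h = ℕ.*-cancelʳ-< (p ℕ.^ r-1) (h ℕ.* D) (suc h) (ℕ.≤-<-trans
      (subst (ℕ._≤ m) (reorder h (p ℕ.^ r-1) D) (h*degree≤m f pres (^-nonzero (p ℕ.^ r-1) e≢0) lf′ (bound r-1 ℕ.≤-refl)))
      m<[1+h]p^[r-1])
      where
      reorder : ∀ h P D → h ℕ.* (P ℕ.* D) ≡ h ℕ.* D ℕ.* P
      reorder = ℕSolver.solve-∀
    D≤1 : D ℕ.≤ 1
    D≤1 = ℕ.*-cancelˡ-≤ h {{ℕ.>-nonZero 0<h}} (subst (h ℕ.* D ℕ.≤_) (sym (ℕ.*-identityʳ h)) (ℕ.≤-pred hD<1+h))

  low₂⇒affine : ∀ {g} → Low 2 g → ∃ λ c → ∃ λ d → ∀ x → g x ≡ c * x + d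
  low₂⇒affine {g} (low₊ c (lead g′ (low₊ d (lead g″ (low₀ z) e′)) e)) = c , d , λ x →
    trans (e x) (trans (cong (c * (x * 1#) +_) (trans (e′ x) (cong (d * 1# +_) (z x)))) (simplify c x d))
    where
    simplify : ∀ c x d → c * (x * 1#) + (d * 1# + 0#) ≡ c * x + d
    simplify = solve 3 (λ c x d → c :* (x :* :1) :+ (d :* :1 :+ :0) := c :* x :+ d) refl

  twist-linear : ∀ f → Preserves f → ∃ λ K → ∃ λ c → ∃ λ d → ∀ x → Inverse.to f x ^ (p ℕ.^ K) ≡ c * x + d
  twist-linear f pres =
    let D , c₀ , D≤m , c₀≢0 , lf = degree f pres
        k , le , ge = climb (positive D c₀ lf) (ℕ.≤-trans D≤m m≤n)
        g = frobenius∘ k f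
        c , d , e = low₂⇒affine (large-degree⇒twist-linear g (frobenius∘-preserves k f pres) (^-nonzero (p ℕ.^ k) c₀≢0) (lead-^ (p ℕ.^ k) lf) le ge)
    in k ℕ.+ 1 , c , d , λ x → trans (trans (cong (Inverse.to f x ^_) (ℕ.^-distribˡ-+-* p k 1)) (sym (^-assocʳ (Inverse.to f x) (p ℕ.^ k) (p ℕ.^ 1)))) (e x)
    where
    positive : ∀ D c → Lead D c (Inverse.to f) → 0 ℕ.< D
    positive (suc D) _ _ = s≤s z≤n
    positive zero c (lead g′ (low₀ z) e) = contradiction (to-injective f (trans (trans (e 0#) (cong (c * 1# +_) (trans (z 0#) (sym (z 1#))))) (sym (e 1#)))) 0≢1

  carlitz : ∀ f → Preserves f → ∃ λ j → ∃ λ t → ∃ λ b → ∀ x → Inverse.to f x ≡ t * x ^ (p ℕ.^ j) + b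
  carlitz f pres =
    let K , c , d , e = twist-linear f pres
        -- The inverse of the K-th Frobenius power is again a Frobenius power and distributes over c
        -- x + d.
        j = K ℕ.* r-1
        Q = p ℕ.^ j
    in j , c ^ Q , d ^ Q , λ x →
      trans (sym (Inverse.inverseʳ (frobenius K) refl)) (trans (cong (_^ Q) (e x))
        (trans (frobenius-+ j (c * x) d) (cong (_+ d ^ Q) (^-distrib-* c x Q))))

-- Squares and nonsquares.

module Squares (F : Field) {n : ℕ} (card : Fin (suc n) ↔ Field.Carrier F)
               {h : ℕ} (pr : Prime (suc (2 ℕ.* h))) {r-1 : ℕ} (q≡p^r : suc n ≡ suc (2 ℕ.* h) ℕ.^ suc r-1)
               (m-even : ∃ λ k → half h (suc r-1) ≡ k ℕ.+ k) where
  open Field F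
  open FieldSolver F
  open FieldFacts F
  open FiniteField F card
  open Characteristic F card {h} pr {suc r-1} q≡p^r
  open Paley F card {h} pr {r-1} q≡p^r
  open SemiringSum semiring using (sum-init-last) renaming (sum to ∑)

  ww^k : ∀ w k → (w * w) ^ k ≡ w ^ (k ℕ.+ k)
  ww^k w k = trans (^-distrib-* w w k) (sym (^-homo-* w k k))

  -- In the expansion only w^(2m) and w^(2n) have nonzero power sums, both equal to -1.
  square-moment : ∀ d → ∑F (λ w → 1# * (w * w + d) ^ n) ≡ - (bin n m * d ^ m) + - 1#
  square-moment d = begin
    ∑F (λ w → 1# * (w * w + d) ^ n)       ≡⟨ moment n (λ w → w * w) (λ _ → 1#) d ⟩
    ∑ t                                   ≡⟨ sum-init-last t ⟩
    ∑ (t ∘ inject₁) + t (fromℕ n)         ≡⟨ cong₂ _+_ (∑-single (t ∘ inject₁) k₀ others) (at (fromℕ n) (Fin.toℕ-fromℕ n)) ⟩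
    t (inject₁ k₀) + bin n n * d ^ (n ℕ.∸ n) * S n ≡⟨ cong₂ _+_ (at (inject₁ k₀) toℕk₀) last-term ⟩
    bin n m * d ^ (n ℕ.∸ m) * S m + - 1#  ≡⟨ cong (_+ - 1#) (cong₂ (λ e s → bin n m * d ^ e * s) n∸m≡m S-m) ⟩
    bin n m * d ^ m * - 1# + - 1#         ≡⟨ cong (_+ - 1#) (x*-1≡-x (bin n m * d ^ m)) ⟩
    - (bin n m * d ^ m) + - 1#            ∎
    where
    open ≡-Reasoning
    S : ℕ → Carrier
    S k = ∑F (λ w → 1# * (w * w) ^ k)
    S≡ : ∀ k → S k ≡ ∑F (_^ (k ℕ.+ k))
    S≡ k = ∑F-cong λ w → trans (*-identityˡ _) (ww^k w k)
    t : Fin (suc n) → Carrier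
    t k = bin n (toℕ k) * d ^ (n ℕ.∸ toℕ k) * S (toℕ k)
    at : ∀ k {e} → toℕ k ≡ e → t k ≡ bin n e * d ^ (n ℕ.∸ e) * S e
    at k refl = refl
    k₀ : Fin n
    k₀ = fromℕ< m<n
    toℕk₀ : toℕ (inject₁ k₀) ≡ m
    toℕk₀ = trans (Fin.toℕ-inject₁ k₀) (Fin.toℕ-fromℕ< m<n)
    n∸m≡m : n ℕ.∸ m ≡ m
    n∸m≡m = trans (cong (ℕ._∸ m) n≡m+m) (ℕ.m+n∸n≡m m m)
    S-m : S m ≡ - 1#
    S-m = trans (S≡ m) (trans (∑F-cong (λ w → cong (w ^_) (sym n≡m+m))) (power-sum-n 0<n))
    S-n : S n ≡ - 1#
    S-n = trans (S≡ n) (trans (∑F-cong (x^[k+n]≡x^k 0<n)) (power-sum-n 0<n))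
    last-term : bin n n * d ^ (n ℕ.∸ n) * S n ≡ - 1#
    last-term = trans (cong₂ _*_ (cong₂ _*_ (trans (cong (_×F 1#) (nCn≡1 n)) (×-homo-1 1#)) (cong (d ^_) (ℕ.n∸n≡0 n))) S-n)
      (trans (cong (_* - 1#) (*-identityˡ 1#)) (*-identityˡ _))
    others : ∀ k → k ≢ k₀ → t (inject₁ k) ≡ 0#
    others k k≢k₀ = trans (at (inject₁ k) (Fin.toℕ-inject₁ k)) (trans (cong (bin n (toℕ k) * d ^ (n ℕ.∸ toℕ k) *_)
      (trans (S≡ (toℕ k)) (power-sum-zero {toℕ k ℕ.+ toℕ k} ≢n (ℕ.+-mono-< (Fin.toℕ<n k) (Fin.toℕ<n k))))) (zeroʳ _))
      where
      ≢n : toℕ k ℕ.+ toℕ k ≢ n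
      ≢n e = k≢k₀ (Fin.toℕ-injective (trans (double-injective (trans e n≡m+m)) (sym (Fin.toℕ-fromℕ< m<n))))

  -- The sum over w of (w² - s)^(q-1) vanishes when s is not a square, as all its terms are 1.
  nonsquare⇒bin*[-s]^m : ∀ s → s ≢ 0# → ¬ NZSq F s → bin n m * (- s) ^ m ≡ - 1#
  nonsquare⇒bin*[-s]^m s s≢0 ¬sq = move (bin n m * (- s) ^ m) (trans (sym (square-moment (- s)))
    (trans (∑F-cong (λ w → trans (*-identityˡ _) (fermat (w * w + - s) (λ e → ¬sq (s≢0 , w , x-y≡0⇒x≡y e))))) power-sum-0))
    where
    move : ∀ X → - X + - 1# ≡ 0# → X ≡ - 1#
    move X e = +-cancelˡ (- X + - 1#) (trans (lemma X) (cong (_+ - 1#) (sym e)))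
      where
      lemma : ∀ X → (- X + - 1#) + X ≡ 0# + - 1#
      lemma = solve 1 (λ X → (:- X :+ :- :1) :+ X := :0 :+ :- :1) refl

  neg-^m : ∀ x → (- x) ^ m ≡ x ^ m
  neg-^m x = let k , e = m-even in trans (cong ((- x) ^_) e) (trans (sym (ww^k (- x) k))
    (trans (cong (_^ k) (neg*neg x)) (trans (ww^k x k) (cong (x ^_) (sym e)))))
    where
    neg*neg : ∀ x → - x * - x ≡ x * x
    neg*neg = solve 1 (λ x → :- x :* :- x := x :* x) refl

  minus1≢0 : - 1# ≢ 0#
  minus1≢0 e = 0≢1 (trans (sym (-‿inverseʳ 1#)) (trans (cong (1# +_) e) (+-identityʳ 1#)))

  -- Both satisfy the same equation with coefficient C(n,m), which is nonzero because its product
  -- with (-s)ᵐ is -1. The sign disappears as m is even.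
  nonsquares-^m : ∀ {s t} → s ≢ 0# → ¬ NZSq F s → t ≢ 0# → ¬ NZSq F t → s ^ m ≡ t ^ m
  nonsquares-^m {s} {t} s≢0 ¬s t≢0 ¬t = trans (sym (neg-^m s)) (trans (*-cancelˡ (bin n m) bin≢0 (trans es (sym et))) (neg-^m t))
    where
    es = nonsquare⇒bin*[-s]^m s s≢0 ¬s
    et = nonsquare⇒bin*[-s]^m t t≢0 ¬t
    bin≢0 : bin n m ≢ 0#
    bin≢0 e = minus1≢0 (trans (sym es) (trans (cong (_* (- s) ^ m) e) (zeroˡ _)))

  square-^m : ∀ {s} → NZSq F s → s ^ m ≡ 1#
  square-^m (s≢0 , w , refl) = trans (ww^k w m) (trans (cong (w ^_) (sym n≡m+m)) (fermat w (λ { refl → s≢0 (zeroˡ _) })))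

  square-1 : NZSq F 1#
  square-1 = (λ e → 0≢1 (sym e)) , 1# , *-identityˡ 1#

  -- Some a has aᵐ ≢ 1 and is thus a nonsquare. Were -1 a nonsquare too, aᵐ would equal (-1)ᵐ = 1.
  square-minus1 : NZSq F (- 1#)
  square-minus1 = decidable-stable (square? (- 1#)) λ ¬sq →
    let a , a≢0 , a^m≢1 = nontrivial-power 0<m m<n
        ¬sq-a : ¬ NZSq F a
        ¬sq-a sq = a^m≢1 (square-^m sq)
    in a^m≢1 (trans (nonsquares-^m a≢0 ¬sq-a minus1≢0 ¬sq) (trans (neg-^m 1#) (1^ m)))

  square-* : ∀ {s t} → NZSq F s → NZSq F t → NZSq F (s * t)
  square-* (s≢0 , v , refl) (t≢0 , w , refl) = *-nonzero s≢0 t≢0 , v * w , lemma v w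
    where
    lemma : ∀ v w → v * w * (v * w) ≡ v * v * (w * w)
    lemma = solve 2 (λ v w → v :* w :* (v :* w) := v :* v :* (w :* w)) refl

  square-neg : ∀ {s} → NZSq F s → NZSq F (- s)
  square-neg {s} sq = subst (NZSq F) (lemma s) (square-* square-minus1 sq)
    where
    lemma : ∀ s → - 1# * s ≡ - s
    lemma = solve 1 (λ s → :- :1 :* s := :- s) refl

  -- The power zᵐ is constant on the nonzero squares, on the nonsquares and on 0, and f respects
  -- these three classes of differences.
  paley⇒preserves : (f : Carrier ↔ Carrier) →
    (∀ x y → NZSq F (y + - x) ⇔ NZSq F (Inverse.to f y + - Inverse.to f x)) → Preserves f
  paley⇒preserves f paley x y with square? (x + - y)
  ... | yes sq = trans (square-^m (Equivalence.to (paley y x) sq)) (sym (square-^m sq))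
  ... | no ¬sq with x ≟ y
  ...   | yes refl = cong (_^ m) (trans (-‿inverseʳ _) (sym (-‿inverseʳ _)))
  ...   | no x≢y = nonsquares-^m (λ e → x≢y (to-injective f (x-y≡0⇒x≡y e))) (λ sq → ¬sq (Equivalence.from (paley y x) sq))
                     (λ e → x≢y (x-y≡0⇒x≡y e)) ¬sq

  2≢0 : 1# + 1# ≢ 0#
  2≢0 e = ×1-nonzero {2} (s≤s z≤n) (s≤s (ℕ.*-monoʳ-≤ 2 0<h)) (trans (cong (1# +_) (+-identityʳ 1#)) e)

  -- x = ((x+1)/2)² - ((x-1)/2)², and -1 is a square.
  two-squares : ∀ x → ∃ λ a → ∃ λ b → a * a + b * b ≡ x
  two-squares x =
    let e , [1+1]*e≡1 = *-inverse (1# + 1#) 2≢0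
        _ , i , ii≡-1 = square-minus1
    in (x + 1#) * e , i * ((x + - 1#) * e) , (begin
      (x + 1#) * e * ((x + 1#) * e) + i * ((x + - 1#) * e) * (i * ((x + - 1#) * e)) ≡⟨ expand x e i ⟩
      (x + 1#) * e * ((x + 1#) * e) + i * i * ((x + - 1#) * e * ((x + - 1#) * e))   ≡⟨ cong (λ z → (x + 1#) * e * ((x + 1#) * e) + z * ((x + - 1#) * e * ((x + - 1#) * e))) ii≡-1 ⟩
      (x + 1#) * e * ((x + 1#) * e) + - 1# * ((x + - 1#) * e * ((x + - 1#) * e))    ≡⟨ collect x e ⟩
      x * (((1# + 1#) * e) * ((1# + 1#) * e))                                       ≡⟨ cong (λ z → x * (z * z)) [1+1]*e≡1 ⟩
      x * (1# * 1#)                                                                 ≡⟨ cong (x *_) (*-identityˡ 1#) ⟩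
      x * 1#                                                                        ≡⟨ *-identityʳ x ⟩
      x                                                                             ∎)
    where
    open ≡-Reasoning
    expand : ∀ x e i → (x + 1#) * e * ((x + 1#) * e) + i * ((x + - 1#) * e) * (i * ((x + - 1#) * e))
                     ≡ (x + 1#) * e * ((x + 1#) * e) + i * i * ((x + - 1#) * e * ((x + - 1#) * e))
    expand = solve 3 (λ x e i → (x :+ :1) :* e :* ((x :+ :1) :* e) :+ i :* ((x :- :1) :* e) :* (i :* ((x :- :1) :* e))
                     := (x :+ :1) :* e :* ((x :+ :1) :* e) :+ i :* i :* ((x :- :1) :* e :* ((x :- :1) :* e))) refl
    collect : ∀ x e → (x + 1#) * e * ((x + 1#) * e) + - 1# * ((x + - 1#) * e * ((x + - 1#) * e)) ≡ x * (((1# + 1#) * e) * ((1# + 1#) * e))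
    collect = solve 2 (λ x e → (x :+ :1) :* e :* ((x :+ :1) :* e) :+ :- :1 :* ((x :- :1) :* e :* ((x :- :1) :* e))
                     := x :* (((:1 :+ :1) :* e) :* ((:1 :+ :1) :* e))) refl

-- Arithmetic modulo ℓ = L + 1.

1%ℓ≢0 : ∀ L → Prime (suc L) → 1 % suc L ≢ 0
1%ℓ≢0 zero    pr = contradiction pr ¬prime[1]
1%ℓ≢0 (suc L) pr ()

module Modular (L : ℕ) where

  infix 4 _≋_
  record _≋_ (a b : ℕ) : Set where
    constructor mk≋
    field %-≡ : a % suc L ≡ b % suc L
  open _≋_ public

  ≋-refl : ∀ {a} → a ≋ a
  ≋-refl = mk≋ refl

  ≡⇒≋ : ∀ {a b} → a ≡ b → a ≋ b
  ≡⇒≋ e = mk≋ (cong (_% suc L) e)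

  ≋-sym : ∀ {a b} → a ≋ b → b ≋ a
  ≋-sym (mk≋ e) = mk≋ (sym e)

  ≋-trans : ∀ {a b c} → a ≋ b → b ≋ c → a ≋ c
  ≋-trans (mk≋ e) (mk≋ e′) = mk≋ (trans e e′)

  ≋-+ : ∀ {a a′ b b′} → a ≋ a′ → b ≋ b′ → a ℕ.+ b ≋ a′ ℕ.+ b′
  ≋-+ {a} {a′} {b} {b′} (mk≋ e) (mk≋ e′) = mk≋ (trans (%-distribˡ-+ a b (suc L))
    (trans (cong₂ (λ x y → (x ℕ.+ y) % suc L) e e′) (sym (%-distribˡ-+ a′ b′ (suc L)))))

  ≋-* : ∀ {a a′ b b′} → a ≋ a′ → b ≋ b′ → a ℕ.* b ≋ a′ ℕ.* b′
  ≋-* {a} {a′} {b} {b′} (mk≋ e) (mk≋ e′) = mk≋ (trans (%-distribˡ-* a b (suc L))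
    (trans (cong₂ (λ x y → (x ℕ.* y) % suc L) e e′) (sym (%-distribˡ-* a′ b′ (suc L)))))

  ≋-multiple : ∀ a k → a ℕ.+ k ℕ.* suc L ≋ a
  ≋-multiple a k = mk≋ ([m+kn]%n≡m%n a k (suc L))

  ≋-+-cancelʳ : ∀ {a b} c → a ℕ.+ c ≋ b ℕ.+ c → a ≋ b
  ≋-+-cancelʳ {a} {b} c e = ≋-trans (≋-sym (drop a)) (≋-trans (≋-+ e (≋-refl {L ℕ.* c})) (drop b))
    where
    collect : ∀ a c L → a ℕ.+ c ℕ.+ L ℕ.* c ≡ a ℕ.+ c ℕ.* suc L
    collect = ℕSolver.solve-∀
    drop : ∀ a → a ℕ.+ c ℕ.+ L ℕ.* c ≋ a
    drop a = ≋-trans (≡⇒≋ (collect a c L)) (≋-multiple a c)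

  toℕ-mod : ∀ a → toℕ (a mod suc L) ≋ a
  toℕ-mod a = mk≋ (trans (cong (_% suc L) (Fin.toℕ-fromℕ< (m%n<n a (suc L)))) (m%n%n≡m%n a (suc L)))

  ≋⇒≡ : ∀ {i j : Fin (suc L)} → toℕ i ≋ toℕ j → i ≡ j
  ≋⇒≡ {i} {j} (mk≋ e) = Fin.toℕ-injective (trans (sym (m<n⇒m%n≡m (Fin.toℕ<n i))) (trans e (m<n⇒m%n≡m (Fin.toℕ<n j))))

  toℕ≋0⇒≡0 : ∀ (i : Fin (suc L)) → toℕ i ≋ 0 → toℕ i ≡ 0
  toℕ≋0⇒≡0 i e = cong toℕ (≋⇒≡ {i} {zero} e)

  mod-cong : ∀ {a b} → a ≋ b → a mod suc L ≡ b mod suc L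
  mod-cong {a} {b} e = ≋⇒≡ (≋-trans (toℕ-mod a) (≋-trans e (≋-sym (toℕ-mod b))))

  infixl 6 _⊕_
  -- The right operand is a natural number, so that multiples of voltages enter unreduced.
  _⊕_ : Fin (suc L) → ℕ → Fin (suc L)
  i ⊕ a = (toℕ i ℕ.+ a) mod suc L

  ⊕-toℕ : ∀ i a → toℕ (i ⊕ a) ≋ toℕ i ℕ.+ a
  ⊕-toℕ i a = toℕ-mod (toℕ i ℕ.+ a)

  ⊕-0 : ∀ i → i ⊕ 0 ≡ i
  ⊕-0 i = ≋⇒≡ (≋-trans (⊕-toℕ i 0) (≡⇒≋ (ℕ.+-identityʳ (toℕ i))))

  ⊕-cong : ∀ i {a b} → a ≋ b → i ⊕ a ≡ i ⊕ b
  ⊕-cong i e = mod-cong (≋-+ (≋-refl {toℕ i}) e)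

  ⊕-assoc : ∀ i a b → (i ⊕ a) ⊕ b ≡ i ⊕ (a ℕ.+ b)
  ⊕-assoc i a b = mod-cong (≋-trans (≋-+ (⊕-toℕ i a) (≋-refl {b})) (≡⇒≋ (ℕ.+-assoc (toℕ i) a b)))

  ⊕-comm : ∀ i a b → (i ⊕ a) ⊕ b ≡ (i ⊕ b) ⊕ a
  ⊕-comm i a b = trans (⊕-assoc i a b) (trans (cong (i ⊕_) (ℕ.+-comm a b)) (sym (⊕-assoc i b a)))

  ⊕-cancel : ∀ i {a b} → i ⊕ a ≡ i ⊕ b → a ≋ b
  ⊕-cancel i {a} {b} e = ≋-+-cancelʳ (toℕ i) (≋-trans (≡⇒≋ (ℕ.+-comm a (toℕ i))) (≋-trans (≋-sym (⊕-toℕ i a))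
    (≋-trans (≡⇒≋ (cong toℕ e)) (≋-trans (⊕-toℕ i b) (≡⇒≋ (ℕ.+-comm (toℕ i) b))))))

  ⊕-reach : ∀ i j → ∃ λ a → i ⊕ a ≡ j
  ⊕-reach i j = (suc L ℕ.∸ toℕ i) ℕ.+ toℕ j , ≋⇒≡ (≋-trans (⊕-toℕ i _) (≋-trans (≡⇒≋ regroup) (≋-multiple (toℕ j) 1)))
    where
    regroup : toℕ i ℕ.+ ((suc L ℕ.∸ toℕ i) ℕ.+ toℕ j) ≡ toℕ j ℕ.+ 1 ℕ.* suc L
    regroup = trans (sym (ℕ.+-assoc (toℕ i) _ _)) (trans (cong (ℕ._+ toℕ j) (ℕ.m+[n∸m]≡n (ℕ.<⇒≤ (Fin.toℕ<n i))))
      (trans (ℕ.+-comm (suc L) (toℕ j)) (cong (toℕ j ℕ.+_) (sym (ℕ.*-identityˡ (suc L))))))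

  negℓ-inverse : (i : Fin (suc L)) → toℕ (negℓ i) ℕ.+ toℕ i ≋ 0
  negℓ-inverse i = ≋-trans (≋-+ (toℕ-mod (suc L ℕ.∸ toℕ i)) (≋-refl {toℕ i}))
    (≋-trans (≡⇒≋ (ℕ.m∸n+n≡m (ℕ.<⇒≤ (Fin.toℕ<n i)))) (mk≋ (n%n≡0 (suc L))))

  bezout-inverse : ∀ {a} → Bézout.Identity 1 (suc L) a → ∃ λ u → u ℕ.* a ≋ 1
  bezout-inverse {a} (Bézout.-+ x y e) = y , ≋-trans (≡⇒≋ (sym e)) (≋-multiple 1 x)
  -- In this case 1 + ya is a multiple of ℓ, so the inverse is -y, written L y because L is -1
  -- modulo ℓ.
  bezout-inverse {a} (Bézout.+- x y e) = L ℕ.* y , ≋-+-cancelʳ (y ℕ.* a) (≋-trans (≡⇒≋ (collect L y a))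
      (≋-trans (≋-multiple 0 (y ℕ.* a)) (≋-sym (≋-trans (≡⇒≋ e) (≋-multiple 0 x)))))
    where
    collect : ∀ L y a → L ℕ.* y ℕ.* a ℕ.+ y ℕ.* a ≡ y ℕ.* a ℕ.* suc L
    collect = ℕSolver.solve-∀

  inverse : Prime (suc L) → ∀ (i : Fin (suc L)) → toℕ i ≢ 0 → ∃ λ u → u ℕ.* toℕ i ≋ 1
  inverse pr i i≢0 = bezout-inverse (coprime-Bézout (prime⇒coprime pr {{ℕ.≢-nonZero i≢0}} (Fin.toℕ<n i)))

  distinct-primes-coprime : ∀ {p} → Prime (suc L) → Prime p → suc L ≢ p → Coprime (suc L) p
  distinct-primes-coprime prℓ prp ℓ≢p (d∣ℓ , d∣p) with prime⇒irreducible prℓ d∣ℓ | prime⇒irreducible prp d∣p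
  ... | inj₁ d≡1 | _ = d≡1
  ... | inj₂ _ | inj₁ d≡1 = d≡1
  ... | inj₂ d≡ℓ | inj₂ d≡p = contradiction (trans (sym d≡ℓ) d≡p) ℓ≢p

  -- The multiplier 1 + kp is 1 modulo p by its shape. Modulo ℓ, k has to be (u - 1)/p; it is taken
  -- as (u + L)x with xp ≋ 1.
  crt : ∀ {p} → Prime (suc L) → Prime p → suc L ≢ p → ∀ u → ∃ λ k → suc (k ℕ.* p) ≋ u
  crt {p} prℓ prp ℓ≢p u =
    let x , xp≋1 = bezout-inverse (coprime-Bézout (distinct-primes-coprime prℓ prp ℓ≢p))
    in (u ℕ.+ L) ℕ.* x , ≋-trans (≡⇒≋ (cong suc (ℕ.*-assoc (u ℕ.+ L) x p)))
       (≋-trans (≋-+ (≋-refl {1}) (≋-* (≋-refl {u ℕ.+ L}) xp≋1))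
       (≋-trans (≡⇒≋ (collect u L)) (≋-multiple u 1)))
    where
    collect : ∀ u L → 1 ℕ.+ (u ℕ.+ L) ℕ.* 1 ≡ u ℕ.+ 1 ℕ.* suc L
    collect = ℕSolver.solve-∀

-- The covers as families of commuting shifts.

module Covers (F : Field) {n : ℕ} (card : Fin (suc n) ↔ Field.Carrier F)
              {h : ℕ} (pr : Prime (suc (2 ℕ.* h))) {r-1 : ℕ} (q≡p^r : suc n ≡ suc (2 ℕ.* h) ℕ.^ suc r-1)
              {L : ℕ} (prℓ : Prime (suc L)) (ℓ≢p : suc L ≢ suc (2 ℕ.* h)) where
  open Field F
  open FieldSolver F
  open FieldFacts F
  open FiniteField F card
  open Characteristic F card {h} pr {suc r-1} q≡p^r
  open Modular L

  V : Set
  V = Vertex F (suc L)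

  _≟V_ : DecidableEquality V
  _≟V_ = ≡-dec _≟_ Fin._≟_

  squares : List Carrier
  squares = filter square? (tabulate elt)

  squares-unique : Unique squares
  squares-unique = Unique.filter⁺ square? (Unique.tabulate⁺ elt-injective)

  ∈-squares⁺ : ∀ {s} → NZSq F s → s ∈ squares
  ∈-squares⁺ {s} sq = ∈-filter⁺ square? (subst (_∈ tabulate elt) (elt-idx s) (∈-tabulate⁺ {f = elt} (idx s))) sq

  ∈-squares⁻ : ∀ {s} → s ∈ squares → NZSq F s
  ∈-squares⁻ s∈ = proj₂ (∈-filter⁻ square? {xs = tabulate elt} s∈)

  -- For nonzero squares s these are the steps along the edges of the graph with voltages uγ.
  shift : (Carrier → Fin (suc L)) → ℕ → Carrier → V → V
  shift γ u s (x , i) = x + s , i ⊕ u ℕ.* toℕ (γ s)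

  adj⇒shift : ∀ γ v w → Adj F γ v w → ∃ λ s → NZSq F s × w ≡ shift γ 1 s v
  adj⇒shift γ (x , i) (y , j) (sq , e) = y + - x , sq , cong₂ _,_ (sym (x+[y-x]≡y x y))
    (trans e (cong (i ⊕_) (sym (ℕ.*-identityˡ _))))

  shift⇒adj : ∀ γ v s → NZSq F s → Adj F γ v (shift γ 1 s v)
  shift⇒adj γ (x , i) s sq = subst (NZSq F) (sym (x+y-x≡y x s)) sq ,
    trans (cong (i ⊕_) (ℕ.*-identityˡ _)) (cong (λ z → i ⊕ toℕ (γ z)) (sym (x+y-x≡y x s)))

  shift-comm : ∀ γ s t v → shift γ 1 s (shift γ 1 t v) ≡ shift γ 1 t (shift γ 1 s v)
  shift-comm γ s t (x , i) = cong₂ _,_ (swap x t s) (⊕-comm i (1 ℕ.* toℕ (γ t)) (1 ℕ.* toℕ (γ s)))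
    where
    swap : ∀ x t s → x + t + s ≡ x + s + t
    swap = solve 3 (λ x t s → x :+ t :+ s := x :+ s :+ t) refl

  iter-shift : ∀ γ s k x i → iter (shift γ 1 s) k (x , i) ≡ (x + k ×F s , i ⊕ k ℕ.* toℕ (γ s))
  iter-shift γ s zero x i = cong₂ _,_ (sym (+-identityʳ x)) (sym (⊕-0 i))
  iter-shift γ s (suc k) x i = trans (iter-shift γ s k (x + s) (i ⊕ 1 ℕ.* toℕ (γ s)))
    (cong₂ _,_ (+-assoc x s (k ×F s)) (trans (⊕-assoc i _ _) (cong (λ a → i ⊕ (a ℕ.+ k ℕ.* toℕ (γ s))) (ℕ.*-identityˡ _))))

  p∤⇒×-injective : ∀ k → ¬ p ∣ k → ∀ {s t} → k ×F s ≡ k ×F t → s ≡ t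
  p∤⇒×-injective k p∤k {s} {t} e = *-cancelˡ (k ×F 1#) k≢0 (trans (sym (×-as-* k s)) (trans e (×-as-* k t)))
    where
    k≢0 : k ×F 1# ≢ 0#
    k≢0 k≡0 = ×1-nonzero {k % p} 0<k%p (m%n<n k p) (trans (sym (+-identityʳ _)) (trans (cong ((k % p) ×F 1# +_) (sym (p∣⇒×≡0 (divides (k / p) refl) 1#)))
        (trans (sym (×-homo-+ 1# (k % p) (k / p ℕ.* p))) (trans (cong (_×F 1#) (sym (m≡m%n+[m/n]*n k p))) k≡0))))
      where
      0<k%p : 0 ℕ.< k % p
      0<k%p = ℕ.n≢0⇒n>0 (λ e → p∤k (m%n≡0⇒n∣m k p e))

  iter-shift-injective : ∀ γ k → ¬ p ∣ k → ∀ v {s t} → iter (shift γ 1 s) k v ≡ iter (shift γ 1 t) k v → s ≡ t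
  iter-shift-injective γ k p∤k (x , i) {s} {t} e = p∤⇒×-injective k p∤k
    (+-cancelˡ x (trans (sym (cong proj₁ (iter-shift γ s k x i))) (trans (cong proj₁ e) (cong proj₁ (iter-shift γ t k x i)))))

  p∤1+kp : ∀ k → ¬ p ∣ suc (k ℕ.* p)
  p∤1+kp k d = ℕ.<⇒≱ (ℕ.nonTrivial⇒n>1 p {{prime⇒nonTrivial pr}})
    (∣⇒≤ (∣m+n∣m⇒∣n (subst (p ∣_) (ℕ.+-comm 1 (k ℕ.* p)) d) (n∣m*n k)))

  -- In F the kp extra translations by s cancel, while modulo ℓ the number of steps is u.
  iter-shift-multiplier : ∀ γ s u k → suc (k ℕ.* p) ≋ u → ∀ v → iter (shift γ 1 s) (suc (k ℕ.* p)) v ≡ shift γ u s v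
  iter-shift-multiplier γ s u k e (x , i) = trans (iter-shift γ s (suc (k ℕ.* p)) x i) (cong₂ _,_
    (cong (x +_) (trans (cong (s +_) (p∣⇒×≡0 (n∣m*n k) s)) (+-identityʳ s)))
    (⊕-cong i (≋-* e (≋-refl {toℕ (γ s)}))))

  module Isomorphism (α β : Carrier → Fin (suc L)) (f : V ↔ V) (iso : IsGraphIso F α β f) where

    Φ : V → V
    Φ = Inverse.to f

    Φ-injective : ∀ {v w} → Φ v ≡ Φ w → v ≡ w
    Φ-injective {v} {w} e = trans (sym (Inverse.inverseʳ f refl)) (trans (cong (Inverse.from f) e) (Inverse.inverseʳ f refl))

    open Schur _≟V_ Φ Φ-injective squares squares-unique

    shift-injective : ∀ γ v {s t} → shift γ 1 s v ≡ shift γ 1 t v → s ≡ t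
    shift-injective γ (x , i) e = +-cancelˡ x (cong proj₁ e)

    iso⇒intertwines : Intertwines (shift α 1) (shift β 1)
    iso⇒intertwines v = ∼bag⇒↭ (unique∧set⇒bag
        (Unique.map⁺ (λ e → shift-injective α v (Φ-injective e)) squares-unique)
        (Unique.map⁺ (shift-injective β (Φ v)) squares-unique) (mk⇔ to from))
      where
      to : ∀ {w} → w ∈ map (λ s → Φ (shift α 1 s v)) squares → w ∈ map (λ s → shift β 1 s (Φ v)) squares
      to w∈ =
        let s , s∈ , w≡ = ∈-map⁻ (λ s → Φ (shift α 1 s v)) w∈
            s′ , sq′ , e = adj⇒shift β (Φ v) _ (Equivalence.to (iso v (shift α 1 s v)) (shift⇒adj α v s (∈-squares⁻ s∈)))
        in subst (_∈ _) (sym (trans w≡ e)) (∈-map⁺ (λ s → shift β 1 s (Φ v)) (∈-squares⁺ sq′))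
      from : ∀ {w} → w ∈ map (λ s → shift β 1 s (Φ v)) squares → w ∈ map (λ s → Φ (shift α 1 s v)) squares
      from w∈ =
        let s , s∈ , w≡ = ∈-map⁻ (λ s → shift β 1 s (Φ v)) w∈
            w′ = Inverse.from f (shift β 1 s (Φ v))
            Φw′ : Φ w′ ≡ shift β 1 s (Φ v)
            Φw′ = Inverse.inverseˡ f refl
            s′ , sq′ , e = adj⇒shift α v w′ (Equivalence.from (iso v w′)
              (subst (Adj F β (Φ v)) (sym Φw′) (shift⇒adj β (Φ v) s (∈-squares⁻ s∈))))
        in subst (_∈ _) (sym (trans w≡ (trans (sym Φw′) (cong Φ e)))) (∈-map⁺ (λ s → Φ (shift α 1 s v)) (∈-squares⁺ sq′))

    intertwines : ∀ u → Intertwines (shift α u) (shift β u)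
    intertwines u =
      let k , e = crt prℓ pr ℓ≢p u
      in intertwines-cong (λ s → iter-shift-multiplier α s u k e) (λ s → iter-shift-multiplier β s u k e)
           (intertwines-multiplier {p} (shift α 1) (shift β 1) (shift-comm α) (shift-comm β)
             (iter-shift-injective α) (iter-shift-injective β) iso⇒intertwines (suc (k ℕ.* p)) (p∤1+kp k))

    move : ∀ u v s → NZSq F s → ∃ λ s′ → NZSq F s′ × Φ (shift α u s v) ≡ shift β u s′ (Φ v)
    move u v s sq =
      let s′ , s′∈ , e = ∈-map⁻ (λ s → shift β u s (Φ v)) (↭.∈-resp-↭ (intertwines u v) (∈-map⁺ (λ s → Φ (shift α u s v)) (∈-squares⁺ sq)))
      in s′ , ∈-squares⁻ s′∈ , e

    comove : ∀ u v s′ → NZSq F s′ → ∃ λ s → NZSq F s × Φ (shift α u s v) ≡ shift β u s′ (Φ v)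
    comove u v s′ sq =
      let s , s∈ , e = ∈-map⁻ (λ s → Φ (shift α u s v)) (↭.∈-resp-↭ (↭-sym (intertwines u v)) (∈-map⁺ (λ s → shift β u s (Φ v)) (∈-squares⁺ sq)))
      in s , ∈-squares⁻ s∈ , sym e

-- Reading the voltages off the isomorphism.

module Rigidity (F : Field) {n : ℕ} (card : Fin (suc n) ↔ Field.Carrier F)
                {h : ℕ} (pr : Prime (suc (2 ℕ.* h))) {r-1 : ℕ} (q≡p^r : suc n ≡ suc (2 ℕ.* h) ℕ.^ suc r-1)
                (m-even : ∃ λ k → half h (suc r-1) ≡ k ℕ.+ k)
                {L : ℕ} (prℓ : Prime (suc L)) (ℓ≢p : suc L ≢ suc (2 ℕ.* h))
                (α β : Field.Carrier F → Fin (suc L))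
                (α-odd : ∀ s → NZSq F s → α (Field.-_ F s) ≡ negℓ (α s))
                (β-odd : ∀ s → NZSq F s → β (Field.-_ F s) ≡ negℓ (β s))
                (f : Vertex F (suc L) ↔ Vertex F (suc L)) (iso : IsGraphIso F α β f) where
  open Field F
  open FieldSolver F
  open FieldFacts F
  open FiniteField F card
  open Characteristic F card {h} pr {suc r-1} q≡p^r
  open Paley F card {h} pr {r-1} q≡p^r
  open Squares F card {h} pr {r-1} q≡p^r m-even
  open Modular L
  open Covers F card {h} pr {r-1} q≡p^r {L} prℓ ℓ≢p
  open Isomorphism α β f iso

  level : Fin (suc L) → Fin (suc L)
  level i = proj₂ (Φ (0# , i))

  sheet : Fin (suc L) → Carrier → Carrier
  sheet i x = proj₁ (Φ (x , i))

  stay : ∀ γ s x i → shift γ 0 s (x , i) ≡ (x + s , i)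
  stay γ s x i = cong (x + s ,_) (⊕-0 i)

  sheet-move : ∀ x i s → NZSq F s → ∃ λ s′ → NZSq F s′ × Φ (x + s , i) ≡ (sheet i x + s′ , proj₂ (Φ (x , i)))
  sheet-move x i s sq =
    let s′ , sq′ , e = move 0 (x , i) s sq
    in s′ , sq′ , trans (cong Φ (sym (stay α s x i))) (trans e (stay β s′ _ _))

  sheet-comove : ∀ x i s′ → NZSq F s′ → ∃ λ s → NZSq F s × Φ (x + s , i) ≡ (sheet i x + s′ , proj₂ (Φ (x , i)))
  sheet-comove x i s′ sq′ =
    let s , sq , e = comove 0 (x , i) s′ sq′
    in s , sq , trans (cong Φ (sym (stay α s x i))) (trans e (stay β s′ _ _))

  -- Allows w = 0, since the squares supplied by `two-squares` may vanish.
  level-step : ∀ x i w → proj₂ (Φ (x + w * w , i)) ≡ proj₂ (Φ (x , i))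
  level-step x i w with w * w ≟ 0#
  ... | yes e = cong (λ y → proj₂ (Φ (y , i))) (trans (cong (x +_) e) (+-identityʳ x))
  ... | no ne = let _ , _ , e = sheet-move x i (w * w) (ne , w , refl) in cong proj₂ e

  -- As x is a sum of two squares, at most two steps with u = 0 lead from 0 to x.
  level-constant : ∀ x i → proj₂ (Φ (x , i)) ≡ level i
  level-constant x i =
    let a , b , e = two-squares x
    in trans (cong (λ y → proj₂ (Φ (y , i))) (sym (trans (cong (_+ b * b) (+-identityˡ _)) e)))
         (trans (level-step (0# + a * a) i b) (level-step 0# i a))

  Φ≡ : ∀ x i → Φ (x , i) ≡ (sheet i x , level i)
  Φ≡ x i = cong (sheet i x ,_) (level-constant x i)

  sheet-step-surjective : ∀ x i w → ∃ λ y → sheet i y ≡ sheet i x + w * w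
  sheet-step-surjective x i w with w * w ≟ 0#
  ... | yes e = x , sym (trans (cong (sheet i x +_) e) (+-identityʳ _))
  ... | no ne = let s , _ , e = sheet-comove x i (w * w) (ne , w , refl) in x + s , cong proj₁ e

  -- The preimage of a vertex under f might a priori lie on another level. Lifting two square steps
  -- of the image through `sheet-comove` keeps to level i.
  sheet-surjective : ∀ i z → ∃ λ x → sheet i x ≡ z
  sheet-surjective i z =
    let a , b , e = two-squares (z + - sheet i 0#)
        y , ey = sheet-step-surjective 0# i a
        x , ex = sheet-step-surjective y i b
    in x , trans ex (trans (cong (_+ b * b) ey) (trans (+-assoc _ _ _) (trans (cong (sheet i 0# +_) e) (x+[y-x]≡y (sheet i 0#) z))))

  -- Two levels with the same image would compete for the vertex Φ (0, j), already reached from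
  -- level i by surjectivity.
  level-injective : ∀ {i j} → level i ≡ level j → i ≡ j
  level-injective {i} {j} e =
    let x , ex = sheet-surjective i (sheet j 0#)
    in cong proj₂ (Φ-injective (trans (Φ≡ x i) (trans (cong₂ _,_ ex e) (sym (Φ≡ 0# j)))))

  sheet-injective : ∀ i {x y} → sheet i x ≡ sheet i y → x ≡ y
  sheet-injective i {x} {y} e = cong proj₁ (Φ-injective (trans (Φ≡ x i) (trans (cong (_, level i) e) (sym (Φ≡ y i)))))

  sheet-bijection : Fin (suc L) → Carrier ↔ Carrier
  sheet-bijection i = mk↔ₛ′ (sheet i) (λ z → proj₁ (sheet-surjective i z)) (λ z → proj₂ (sheet-surjective i z))
    (λ x → sheet-injective i (proj₂ (sheet-surjective i (sheet i x))))

  sheet-paley : ∀ i x y → NZSq F (y + - x) ⇔ NZSq F (sheet i y + - sheet i x)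
  sheet-paley i x y = mk⇔ to from
    where
    to : NZSq F (y + - x) → NZSq F (sheet i y + - sheet i x)
    to sq = let s′ , sq′ , e = sheet-move x i (y + - x) sq
            in subst (NZSq F) (trans (sym (x+y-x≡y (sheet i x) s′)) (cong (_+ - sheet i x) (trans (sym (cong proj₁ e)) (cong (sheet i) (x+[y-x]≡y x y))))) sq′
    from : NZSq F (sheet i y + - sheet i x) → NZSq F (y + - x)
    from sq′ = let s , sq , e = sheet-comove x i (sheet i y + - sheet i x) sq′
                   y≡ : x + s ≡ y
                   y≡ = sheet-injective i (trans (cong proj₁ e) (x+[y-x]≡y (sheet i x) (sheet i y)))
               in subst (NZSq F) (trans (sym (x+y-x≡y x s)) (cong (_+ - x) y≡)) sq

  i₀ i₁ : Fin (suc L)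
  i₀ = zero
  i₁ = i₀ ⊕ 1

  abstract
    -- Kept abstract so that the witnesses never unfold into the degree computations behind them.
    semilinear : ∃ λ j → ∃ λ t → ∃ λ b → ∀ x → sheet i₁ x ≡ t * x ^ (p ℕ.^ j) + b
    semilinear = carlitz (sheet-bijection i₁) (paley⇒preserves (sheet-bijection i₁) (sheet-paley i₁))

  j₁ : ℕ
  j₁ = proj₁ semilinear

  σ : Carrier ↔ Carrier
  σ = frobenius j₁

  t : Carrier
  t = proj₁ (proj₂ semilinear)

  Λ : Carrier → Carrier
  Λ x = t * Inverse.to σ x

  b₁ c : Carrier
  b₁ = proj₁ (proj₂ (proj₂ semilinear))
  c = b₁ + - sheet i₀ 0#

  sheet-1 : ∀ x → sheet i₁ x ≡ Λ x + b₁
  sheet-1 = proj₂ (proj₂ (proj₂ semilinear))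

  σ-+ : ∀ x y → Inverse.to σ (x + y) ≡ Inverse.to σ x + Inverse.to σ y
  σ-+ = frobenius-+ j₁

  σ-- : ∀ x y → Inverse.to σ (x + - y) ≡ Inverse.to σ x + - Inverse.to σ y
  σ-- = frobenius-- j₁

  σ-* : ∀ x y → Inverse.to σ (x * y) ≡ Inverse.to σ x * Inverse.to σ y
  σ-* x y = ^-distrib-* x y (p ℕ.^ j₁)

  σ-1 : Inverse.to σ 1# ≡ 1#
  σ-1 = 1^ (p ℕ.^ j₁)

  σ-0 : Inverse.to σ 0# ≡ 0#
  σ-0 = 0^ (ℕ.m^n>0 p j₁)

  Λ-- : ∀ x y → Λ (x + - y) ≡ Λ x + - Λ y
  Λ-- x y = trans (cong (t *_) (σ-- x y)) (distribute t (Inverse.to σ x) (Inverse.to σ y))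
    where
    distribute : ∀ t x y → t * (x + - y) ≡ t * x + - (t * y)
    distribute = solve 3 (λ t x y → t :* (x :- y) := t :* x :- t :* y) refl

  Λ-0 : Λ 0# ≡ 0#
  Λ-0 = trans (cong (t *_) σ-0) (zeroʳ t)

  Λ-neg : ∀ x → Λ (- x) ≡ - Λ x
  Λ-neg x = trans (cong Λ (sym (+-identityˡ (- x)))) (trans (Λ-- 0# x) (trans (cong (_+ - Λ x) Λ-0) (+-identityˡ _)))

  -- The coefficient t is the difference of the images of 1 and 0, whose own difference 1 is a
  -- square.
  t-square : NZSq F t
  t-square = subst (NZSq F) difference (Equivalence.to (sheet-paley i₁ 0# 1#) (subst (NZSq F) (1-0 1#) square-1))
    where
    1-0 : ∀ x → x ≡ x + - 0#
    1-0 = solve 1 (λ x → x := x :- :0) refl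
    cancel-b : ∀ t b → (t * 1# + b) + - (0# + b) ≡ t
    cancel-b = solve 2 (λ t b → (t :* :1 :+ b) :- (:0 :+ b) := t) refl
    difference : sheet i₁ 1# + - sheet i₁ 0# ≡ t
    difference = trans (cong₂ (λ u v → u + - v) (trans (sheet-1 1#) (cong (λ z → t * z + b₁) σ-1)) (trans (sheet-1 0#) (cong (_+ b₁) Λ-0))) (cancel-b t b₁)

  σ-square : ∀ {s} → NZSq F s → NZSq F (Inverse.to σ s)
  σ-square {s} (s≢0 , w , refl) = (λ e → s≢0 (to-injective σ (trans e (sym σ-0)))) , Inverse.to σ w , sym (σ-* w w)

  Λ-square : ∀ {s} → NZSq F s → NZSq F (Λ s)
  Λ-square sq = square-* t-square (σ-square sq)

  Λ-injective : ∀ {x y} → Λ x ≡ Λ y → x ≡ y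
  Λ-injective e = to-injective σ (*-cancelˡ t (proj₁ t-square) e)

  abstract
    ν : ℕ
    ν = proj₁ (⊕-reach (level i₀) (level i₁))

    level-ν : level i₀ ⊕ ν ≡ level i₁
    level-ν = proj₂ (⊕-reach (level i₀) (level i₁))

  private
    swap : ∀ u a b → u ℕ.* a ℕ.* b ≡ u ℕ.* b ℕ.* a
    swap = ℕSolver.solve-∀

    solve-for : ∀ b₀ {s′ x} → b₀ + s′ ≡ x + b₁ → s′ ≡ x + (b₁ + - b₀)
    solve-for b₀ {s′} {x} e = trans (isolate b₀ s′) (trans (cong (_+ - b₀) e) (+-assoc x b₁ (- b₀)))
      where
      isolate : ∀ b s → s ≡ b + s + - b
      isolate = solve 2 (λ b s → s := b :+ s :- b) refl

  -- With uα(s) = 1 the step s leads from (0, 0) to (s, 1), whose image is known from `sheet-1`.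
  -- Comparing coordinates with the image step s′ gives s′ = Λ s + c and uβ(s′) = ν.
  forward : ∀ s → NZSq F s → toℕ (α s) ≢ 0 → NZSq F (Λ s + c) × toℕ (β (Λ s + c)) ≋ ν ℕ.* toℕ (α s)
  forward s sq αs≢0 =
    let u , uα≋1 = inverse prℓ (α s) αs≢0
        s′ , sq′ , e = move u (0# , i₀) s sq
        e′ : Φ (s , i₁) ≡ (sheet i₀ 0# + s′ , level i₀ ⊕ u ℕ.* toℕ (β s′))
        e′ = trans (cong Φ (sym (cong₂ _,_ (+-identityˡ s) (⊕-cong i₀ uα≋1)))) e
        s′≡ : s′ ≡ Λ s + c
        s′≡ = solve-for (sheet i₀ 0#) (trans (sym (cong proj₁ e′)) (sheet-1 s))
        ν≋ : ν ≋ u ℕ.* toℕ (β s′)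
        ν≋ = ⊕-cancel (level i₀) (trans level-ν (trans (sym (level-constant s i₁)) (cong proj₂ e′)))
        β≋ : toℕ (β s′) ≋ ν ℕ.* toℕ (α s)
        β≋ = ≋-trans (≡⇒≋ (sym (ℕ.*-identityˡ _))) (≋-trans (≋-* (≋-sym uα≋1) (≋-refl {toℕ (β s′)}))
               (≋-trans (≡⇒≋ (swap u (toℕ (α s)) (toℕ (β s′)))) (≋-* (≋-sym ν≋) (≋-refl {toℕ (α s)}))))
    in subst (NZSq F) s′≡ sq′ , subst (λ z → toℕ (β z) ≋ ν ℕ.* toℕ (α s)) s′≡ β≋

  backward : ∀ s′ → NZSq F s′ → toℕ (β s′) ≢ 0 → ∃ λ s → NZSq F s × s′ ≡ Λ s + c × ν ℕ.* toℕ (α s) ≋ toℕ (β s′)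
  backward s′ sq′ βs′≢0 =
    let v , vβ≋1 = inverse prℓ (β s′) βs′≢0
        -- Chosen so that the step s′ in the image raises the level by exactly ν, from `level i₀` to
        -- `level i₁`. By `level-injective` the step upstairs then goes from level 0 to level 1.
        u = ν ℕ.* v
        uβ≋ν : u ℕ.* toℕ (β s′) ≋ ν
        uβ≋ν = ≋-trans (≡⇒≋ (ℕ.*-assoc ν v _)) (≋-trans (≋-* (≋-refl {ν}) vβ≋1) (≡⇒≋ (ℕ.*-identityʳ ν)))
        s , sq , e = comove u (0# , i₀) s′ sq′
        i = i₀ ⊕ u ℕ.* toℕ (α s)
        e′ : Φ (s , i) ≡ (sheet i₀ 0# + s′ , level i₁)
        e′ = trans (cong (λ z → Φ (z , i)) (sym (+-identityˡ s))) (trans e (cong (sheet i₀ 0# + s′ ,_) (trans (⊕-cong (level i₀) uβ≋ν) level-ν)))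
        i≡1 : i ≡ i₁
        i≡1 = level-injective (trans (sym (level-constant s i)) (cong proj₂ e′))
        uα≋1 : u ℕ.* toℕ (α s) ≋ 1
        uα≋1 = ⊕-cancel i₀ i≡1
    in s , sq ,
       solve-for (sheet i₀ 0#) (trans (sym (cong proj₁ e′)) (trans (cong (λ i → sheet i s) i≡1) (sheet-1 s))) ,
       ≋-trans (≋-* (≋-sym uβ≋ν) (≋-refl {toℕ (α s)})) (≋-trans (≡⇒≋ (swap u (toℕ (β s′)) (toℕ (α s))))
         (≋-trans (≋-* uα≋1 (≋-refl {toℕ (β s′)})) (≡⇒≋ (ℕ.*-identityˡ _))))

  odd : ∀ (γ : Carrier → Fin (suc L)) {s} → γ (- s) ≡ negℓ (γ s) → toℕ (γ (- s)) ℕ.+ toℕ (γ s) ≋ 0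
  odd γ {s} e = ≋-trans (≡⇒≋ (cong (λ i → toℕ i ℕ.+ toℕ (γ s)) e)) (negℓ-inverse (γ s))

  -- The antisymmetry of the voltages turns c into -c.
  forward⁻ : ∀ s → NZSq F s → toℕ (α s) ≢ 0 → NZSq F (Λ s + - c) × toℕ (β (Λ s + - c)) ≋ ν ℕ.* toℕ (α s)
  forward⁻ s sq αs≢0 =
    let sq-y , βy≋ = forward (- s) (square-neg sq) α-s≢0
    in subst (NZSq F) -y≡ (square-neg sq-y) ,
       subst (λ z → toℕ (β z) ≋ ν ℕ.* toℕ (α s)) -y≡ (≋-+-cancelʳ (toℕ (β y)) (≋-trans (odd β (β-odd y sq-y)) (≋-sym
         (≋-trans (≋-+ (≋-refl {ν ℕ.* toℕ (α s)}) βy≋) (≋-trans (≡⇒≋ (factor ν (toℕ (α s)) (toℕ (α (- s)))))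
           (≋-trans (≋-* (≋-refl {ν}) (odd α (α-odd s sq))) (≡⇒≋ (ℕ.*-zeroʳ ν))))))))
    where
    y = Λ (- s) + c
    negate : ∀ x c → - (- x + c) ≡ x + - c
    negate = solve 2 (λ x c → :- (:- x :+ c) := x :- c) refl
    -y≡ : - y ≡ Λ s + - c
    -y≡ = trans (cong (λ z → - (z + c)) (Λ-neg s)) (negate (Λ s) c)
    factor : ∀ ν a b → ν ℕ.* a ℕ.+ ν ℕ.* b ≡ ν ℕ.* (b ℕ.+ a)
    factor = ℕSolver.solve-∀
    α-s≢0 : toℕ (α (- s)) ≢ 0
    α-s≢0 e = αs≢0 (toℕ≋0⇒≡0 (α s) (subst (λ a → a ℕ.+ toℕ (α s) ≋ 0) e (odd α (α-odd s sq))))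

  ≋-nonzero : ∀ {i j : Fin (suc L)} → toℕ i ≋ toℕ j → toℕ j ≢ 0 → toℕ i ≢ 0
  ≋-nonzero {i} {j} e j≢0 i≡0 = j≢0 (toℕ≋0⇒≡0 j (≋-trans (≋-sym e) (≡⇒≋ i≡0)))

  -- By `backward` s′ is Λ s + c, and `forward⁻` carries the voltage over to Λ s - c.
  periodic : ∀ s′ → NZSq F s′ → toℕ (β s′) ≢ 0 → NZSq F (s′ + - (c + c)) × toℕ (β (s′ + - (c + c))) ≋ toℕ (β s′)
  periodic s′ sq′ βs′≢0 =
    let s , sq , s′≡ , να≋β = backward s′ sq′ βs′≢0
        αs≢0 : toℕ (α s) ≢ 0
        αs≢0 e = βs′≢0 (toℕ≋0⇒≡0 (β s′) (≋-trans (≋-sym να≋β) (≡⇒≋ (trans (cong (ν ℕ.*_) e) (ℕ.*-zeroʳ ν)))))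
        sq″ , e″ = forward⁻ s sq αs≢0
        eq : Λ s + - c ≡ s′ + - (c + c)
        eq = trans (rewrite-shift (Λ s) c) (cong (_+ - (c + c)) (sym s′≡))
    in subst (NZSq F) eq sq″ , subst (λ z → toℕ (β z) ≋ toℕ (β s′)) eq (≋-trans e″ να≋β)
    where
    rewrite-shift : ∀ x c → x + - c ≡ x + c + - (c + c)
    rewrite-shift = solve 2 (λ x c → x :- c := x :+ c :- (c :+ c)) refl

  periodic^ : ∀ k s′ → NZSq F s′ → toℕ (β s′) ≢ 0 → NZSq F (s′ + k ×F (- (c + c))) × toℕ (β (s′ + k ×F (- (c + c)))) ≋ toℕ (β s′)
  periodic^ zero s′ sq′ _ = subst (NZSq F) (sym (+-identityʳ s′)) sq′ , ≡⇒≋ (cong (toℕ ∘ β) (+-identityʳ s′))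
  periodic^ (suc k) s′ sq′ βs′≢0 =
    let sq₁ , e₁ = periodic s′ sq′ βs′≢0
        sq₂ , e₂ = periodic^ k (s′ + - (c + c)) sq₁ (≋-nonzero e₁ βs′≢0)
    in subst (NZSq F) (+-assoc _ _ _) sq₂ , ≋-trans (≡⇒≋ (cong (toℕ ∘ β) (sym (+-assoc _ _ _)))) (≋-trans e₂ e₁)

  1+2h≡0 : 1# + (h ×F 1# + h ×F 1#) ≡ 0#
  1+2h≡0 = trans (cong (1# +_) (sym (trans (×-homo-+ 1# h (h ℕ.+ 0)) (cong (λ k → h ×F 1# + k ×F 1#) (ℕ.+-identityʳ h))))) p×1≡0

  -- Because 1 + 2h = p, the total translation -2hc is c.
  h-steps : ∀ x → x + h ×F (- (c + c)) ≡ x + c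
  h-steps x = trans (cong (x +_) (×-as-* h _)) (trans (collect x (h ×F 1#) c) (trans (cong (λ z → x + (c + - (z * c))) 1+2h≡0) (finish x c)))
    where
    collect : ∀ x H c → x + H * (- (c + c)) ≡ x + (c + - ((1# + (H + H)) * c))
    collect = solve 3 (λ x H c → x :+ H :* (:- (c :+ c)) := x :+ (c :- (:1 :+ (H :+ H)) :* c)) refl
    finish : ∀ x c → x + (c + - (0# * c)) ≡ x + c
    finish = solve 2 (λ x c → x :+ (c :- :0 :* c) := x :+ c) refl

  [1+h]-steps : ∀ x → x + c + suc h ×F (- (c + c)) ≡ x
  [1+h]-steps x = trans (regroup x c (- (c + c)) (h ×F (- (c + c)))) (trans (h-steps (x + c + - (c + c))) (collect x c))
    where
    regroup : ∀ x c d e → x + c + (d + e) ≡ x + c + d + e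
    regroup = solve 4 (λ x c d e → x :+ c :+ (d :+ e) := x :+ c :+ d :+ e) refl
    collect : ∀ x c → x + c + - (c + c) + c ≡ x
    collect = solve 2 (λ x c → x :+ c :- (c :+ c) :+ c := x) refl

  i₀≢i₁ : i₀ ≢ i₁
  i₀≢i₁ e = 1%ℓ≢0 L prℓ (%-≡ (≋-trans (≋-sym (⊕-toℕ i₀ 1)) (≡⇒≋ (cong toℕ (sym e)))))

  abstract
    -- If ν vanished modulo ℓ, levels 0 and 1 would have the same image.
    ν-inverse : ∃ λ v → v ℕ.* ν ≋ 1
    ν-inverse =
      let v , e = inverse prℓ (ν mod suc L) λ ν≡0 → i₀≢i₁ (level-injective (trans (sym (⊕-0 (level i₀)))
                    (trans (⊕-cong (level i₀) (≋-trans (≡⇒≋ (sym ν≡0)) (toℕ-mod ν))) level-ν)))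
      in v , ≋-trans (≋-* (≋-refl {v}) (≋-sym (toℕ-mod ν))) e

  ν-cancel : ∀ a b → ν ℕ.* a ≋ ν ℕ.* b → a ≋ b
  ν-cancel a b e = ≋-trans (≋-sym (undo a)) (≋-trans (≋-* (≋-refl {proj₁ ν-inverse}) e) (undo b))
    where
    undo : ∀ a → proj₁ ν-inverse ℕ.* (ν ℕ.* a) ≋ a
    undo a = ≋-trans (≡⇒≋ (sym (ℕ.*-assoc (proj₁ ν-inverse) ν a))) (≋-trans (≋-* (proj₂ ν-inverse) (≋-refl {a})) (≡⇒≋ (ℕ.*-identityˡ a)))

  -- The value is known at Λ s + c from `forward`, and h + 1 periods of -2c lead from there back to
  -- Λ s.
  voltages-nonzero : ∀ s → NZSq F s → toℕ (α s) ≢ 0 → toℕ (β (Λ s)) ≋ ν ℕ.* toℕ (α s)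
  voltages-nonzero s sq αs≢0 = ≋-trans (subst (λ z → toℕ (β z) ≋ toℕ (β (Λ s + c))) ([1+h]-steps (Λ s))
      (proj₂ (periodic^ (suc h) (Λ s + c) (proj₁ (forward s sq αs≢0)) βΛ+c≢0))) (proj₂ (forward s sq αs≢0))
    where
    βΛ+c≢0 : toℕ (β (Λ s + c)) ≢ 0
    βΛ+c≢0 e = αs≢0 (toℕ≋0⇒≡0 (α s) (ν-cancel (toℕ (α s)) 0
      (≋-trans (≋-sym (proj₂ (forward s sq αs≢0))) (≡⇒≋ (trans e (sym (ℕ.*-zeroʳ ν)))))))

  -- A nonzero voltage at Λ s would persist at Λ s + c after h periods. There `backward` returns s
  -- itself and makes α s nonzero.
  voltages-zero : ∀ s → NZSq F s → toℕ (α s) ≡ 0 → ¬ (toℕ (β (Λ s)) ≢ 0)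
  voltages-zero s sq αs≡0 βΛs≢0 =
    let sq₁ , e₁ = periodic^ h (Λ s) (Λ-square sq) βΛs≢0
        e₁′ : toℕ (β (Λ s + c)) ≋ toℕ (β (Λ s))
        e₁′ = subst (λ z → toℕ (β z) ≋ toℕ (β (Λ s))) (h-steps (Λ s)) e₁
        s₁ , _ , eq , e₂ = backward (Λ s + c) (subst (NZSq F) (h-steps (Λ s)) sq₁) (≋-nonzero e₁′ βΛs≢0)
        s≡s₁ : s ≡ s₁
        s≡s₁ = Λ-injective (+-cancelˡ c (trans (+-comm c _) (trans eq (+-comm _ c))))
    in βΛs≢0 (toℕ≋0⇒≡0 (β (Λ s)) (≋-trans (≋-sym e₁′) (≋-trans (≋-sym e₂)
         (≡⇒≋ (trans (cong (ν ℕ.*_) (trans (cong (toℕ ∘ α) (sym s≡s₁)) αs≡0)) (ℕ.*-zeroʳ ν))))))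

  voltages : ∀ s → NZSq F s → toℕ (β (Λ s)) ≋ ν ℕ.* toℕ (α s)
  voltages s sq = by-cases (toℕ (α s) ℕ.≟ 0)
    where
    by-cases : Dec (toℕ (α s) ≡ 0) → toℕ (β (Λ s)) ≋ ν ℕ.* toℕ (α s)
    by-cases (no αs≢0) = voltages-nonzero s sq αs≢0
    by-cases (yes αs≡0) = ≡⇒≋ (trans (decidable-stable (toℕ (β (Λ s)) ℕ.≟ 0) (voltages-zero s sq αs≡0))
      (sym (trans (cong (ν ℕ.*_) αs≡0) (ℕ.*-zeroʳ ν))))

  ν⁻¹ : ℕ
  ν⁻¹ = proj₁ ν-inverse

  N N⁻¹ : Fin (suc L)
  N = ν mod suc L
  N⁻¹ = ν⁻¹ mod suc L

  N*-≋ : ∀ i → toℕ (N *ℓ i) ≋ ν ℕ.* toℕ i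
  N*-≋ i = ≋-trans (toℕ-mod (toℕ N ℕ.* toℕ i)) (≋-* (toℕ-mod ν) (≋-refl {toℕ i}))

  N⁻¹*-≋ : ∀ i → toℕ (N⁻¹ *ℓ i) ≋ ν⁻¹ ℕ.* toℕ i
  N⁻¹*-≋ i = ≋-trans (toℕ-mod (toℕ N⁻¹ ℕ.* toℕ i)) (≋-* (toℕ-mod ν⁻¹) (≋-refl {toℕ i}))

  N-unit : IsUnitℓ N
  N-unit = N⁻¹ , mod-cong (≋-trans (≋-* (toℕ-mod ν) (toℕ-mod ν⁻¹)) (≋-trans (≡⇒≋ (ℕ.*-comm ν ν⁻¹)) (proj₂ ν-inverse)))

  N⁻¹*N* : ∀ i → N⁻¹ *ℓ (N *ℓ i) ≡ i
  N⁻¹*N* i = ≋⇒≡ (≋-trans (N⁻¹*-≋ (N *ℓ i)) (≋-trans (≋-* (≋-refl {ν⁻¹}) (N*-≋ i)) (≋-trans (≡⇒≋ (sym (ℕ.*-assoc ν⁻¹ ν (toℕ i))))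
    (≋-trans (≋-* (proj₂ ν-inverse) (≋-refl {toℕ i})) (≡⇒≋ (ℕ.*-identityˡ (toℕ i)))))))

  N*N⁻¹* : ∀ i → N *ℓ (N⁻¹ *ℓ i) ≡ i
  N*N⁻¹* i = ≋⇒≡ (ν-cancel′ (≋-trans (≋-sym (N⁻¹*-≋ (N *ℓ (N⁻¹ *ℓ i)))) (≋-trans (≡⇒≋ (cong toℕ (N⁻¹*N* (N⁻¹ *ℓ i)))) (N⁻¹*-≋ i))))
    where
    ν-cancel′ : ∀ {a b} → ν⁻¹ ℕ.* a ≋ ν⁻¹ ℕ.* b → a ≋ b
    ν-cancel′ {a} {b} e = ≋-trans (≋-sym (undo a)) (≋-trans (≋-* (≋-refl {ν}) e) (undo b))
      where
      undo : ∀ a → ν ℕ.* (ν⁻¹ ℕ.* a) ≋ a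
      undo a = ≋-trans (≡⇒≋ (trans (sym (ℕ.*-assoc ν ν⁻¹ a)) (cong (ℕ._* a) (ℕ.*-comm ν ν⁻¹)))) (≋-trans (≋-* (proj₂ ν-inverse) (≋-refl {a})) (≡⇒≋ (ℕ.*-identityˡ a)))

  voltages-≡ : ∀ s → NZSq F s → N *ℓ α s ≡ β (Λ s)
  voltages-≡ s sq = ≋⇒≡ (≋-trans (N*-≋ (α s)) (≋-sym (voltages s sq)))

  -- For the converse, Λ differs from the sheet over level 1 only by the translation b₁.
  Λ-paley : ∀ x y → NZSq F (y + - x) ⇔ NZSq F (Λ y + - Λ x)
  Λ-paley x y = mk⇔ (λ sq → subst (NZSq F) (Λ-- y x) (Λ-square sq))
    (λ sq → Equivalence.from (sheet-paley i₁ x y) (subst (NZSq F) (sym difference) sq))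
    where
    cancel-b : ∀ u v b → (u + b) + - (v + b) ≡ u + - v
    cancel-b = solve 3 (λ u v b → (u :+ b) :- (v :+ b) := u :- v) refl
    difference : sheet i₁ y + - sheet i₁ x ≡ Λ y + - Λ x
    difference = trans (cong₂ (λ u v → u + - v) (sheet-1 y) (sheet-1 x)) (cancel-b (Λ y) (Λ x) b₁)

  Λ⁻¹ : Carrier → Carrier
  Λ⁻¹ y = Inverse.from σ (Inverse.from (dilate t (proj₁ t-square)) y)

  ΛΛ⁻¹ : ∀ y → Λ (Λ⁻¹ y) ≡ y
  ΛΛ⁻¹ y = trans (cong (t *_) (Inverse.inverseˡ σ refl)) (Inverse.inverseˡ (dilate t (proj₁ t-square)) refl)

  Λ⁻¹Λ : ∀ x → Λ⁻¹ (Λ x) ≡ x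
  Λ⁻¹Λ x = trans (cong (Inverse.from σ) (Inverse.inverseʳ (dilate t (proj₁ t-square)) refl)) (Inverse.inverseʳ σ refl)

  standard : V ↔ V
  standard = mk↔ₛ′ to from to-from from-to
    where
    to from : V → V
    to (x , i) = Λ x , N *ℓ i
    from (y , j) = Λ⁻¹ y , N⁻¹ *ℓ j
    to-from : ∀ v → to (from v) ≡ v
    to-from (y , j) = cong₂ _,_ {Λ (Λ⁻¹ y)} {y} {N *ℓ (N⁻¹ *ℓ j)} {j} (ΛΛ⁻¹ y) (N*N⁻¹* j)
    from-to : ∀ v → from (to v) ≡ v
    from-to (x , i) = cong₂ _,_ {Λ⁻¹ (Λ x)} {x} {N⁻¹ *ℓ (N *ℓ i)} {i} (Λ⁻¹Λ x) (N⁻¹*N* i)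

  standard-iso : IsGraphIso F α β standard
  standard-iso (x , i) (y , j) = mk⇔
    (λ (sq , e) → Equivalence.to (Λ-paley x y) sq ,
      ≋⇒≡ (≋-trans (N*-≋ j) (≋-trans (≋-* (≋-refl {ν}) (≋-trans (≡⇒≋ (cong toℕ e)) (⊕-toℕ i _))) (≋-sym (image sq)))))
    (λ (sq , e) → let sq′ = Equivalence.from (Λ-paley x y) sq in sq′ ,
      ≋⇒≡ (≋-trans (ν-cancel (toℕ j) _ (≋-trans (≋-sym (N*-≋ j)) (≋-trans (≡⇒≋ (cong toℕ e)) (image sq′)))) (≋-sym (⊕-toℕ i _))))
    where
    image : NZSq F (y + - x) → toℕ ((N *ℓ i) +ℓ β (Λ y + - Λ x)) ≋ ν ℕ.* (toℕ i ℕ.+ toℕ (α (y + - x)))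
    image sq = ≋-trans (⊕-toℕ (N *ℓ i) _) (≋-trans (≋-+ (N*-≋ i)
      (≋-trans (≡⇒≋ (cong (toℕ ∘ β) (sym (Λ-- y x)))) (voltages (y + - x) sq))) (≡⇒≋ (sym (ℕ.*-distribˡ-+ ν (toℕ i) _))))

  -- The factor n is already absorbed in the voltages, so the level stays put and equivariance holds
  -- by computation.
  covering : V ↔ V
  covering = mk↔ₛ′ to from to-from from-to
    where
    to from : V → V
    to (x , i) = Λ x , i
    from (y , j) = Λ⁻¹ y , j
    to-from : ∀ v → to (from v) ≡ v
    to-from (y , j) = cong (_, j) (ΛΛ⁻¹ y)
    from-to : ∀ v → from (to v) ≡ v
    from-to (x , i) = cong (_, i) (Λ⁻¹Λ x)

  covering-iso : IsGraphIso F (scaleV F N α) β covering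
  covering-iso (x , i) (y , j) = mk⇔
    (λ (sq , e) → Equivalence.to (Λ-paley x y) sq , trans e (image sq))
    (λ (sq , e) → let sq′ = Equivalence.from (Λ-paley x y) sq in sq′ , trans e (sym (image sq′)))
    where
    image : NZSq F (y + - x) → i +ℓ (N *ℓ α (y + - x)) ≡ i +ℓ β (Λ y + - Λ x)
    image sq = cong (i +ℓ_) (trans (voltages-≡ (y + - x) sq) (cong β (Λ-- y x)))

-- Parity of p and of (q - 1) / 2, and the theorem.

parity : ∀ a → ∃ λ h → (a ≡ 2 ℕ.* h) ⊎ (a ≡ suc (2 ℕ.* h))
parity zero = 0 , inj₁ refl
parity (suc a) with parity a
... | h , inj₁ e = h , inj₂ (cong suc e)
... | h , inj₂ e = suc h , inj₁ (trans (cong suc e) (next h))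
  where
  next : ∀ h → suc (suc (2 ℕ.* h)) ≡ 2 ℕ.* suc h
  next = ℕSolver.solve-∀

1+4k-odd : ∀ k → ¬ 2 ∣ suc (k ℕ.* 4)
1+4k-odd k d with ∣1⇒≡1 (∣m+n∣m⇒∣n (subst (2 ∣_) (ℕ.+-comm 1 (k ℕ.* 4)) d) (divides (k ℕ.* 2) (sym (ℕ.*-assoc k 2 2))))
... | ()

half-even : ∀ h r {n k} → suc n ≡ suc (2 ℕ.* h) ℕ.^ r → suc n ≡ suc (k ℕ.* 4) → half h r ≡ k ℕ.+ k
half-even h r {n} {k} q≡ q≡′ = double-injective (ℕ.suc-injective (trans (trans (cong (λ x → suc (half h r ℕ.+ x)) (sym (ℕ.+-identityʳ _)))
  (trans (half-spec h r) (sym q≡))) (trans q≡′ (cong suc (four k)))))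
  where
  four : ∀ k → k ℕ.* 4 ≡ k ℕ.+ k ℕ.+ (k ℕ.+ k)
  four = ℕSolver.solve-∀

open import Data.Nat using (_≤_; _<_; _^_; _∸_)

theorem4p1 : (p r q ℓ : ℕ) (F : Field) →
    Prime p → 1 ≤ r → q ≡ p ^ r → HasCard F q → q % 4 ≡ 1 →
    Prime ℓ → ℓ ≢ p → (r ≤ 4 ⊎ (q ∸ 1) / 2 < ℓ) →
    (α β : Field.Carrier F → Fin ℓ) →
    IsVoltage F α → IsVoltage F β → GraphIsomorphic F α β →
    Σ (Field.Carrier F) λ t → NZSq F t ×
    Σ (Field.Carrier F ↔ Field.Carrier F) λ σ → IsFieldAut F σ ×
    Σ (Fin ℓ) λ n → IsUnitℓ n ×
    Σ (Vertex F ℓ ↔ Vertex F ℓ) (λ f →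
    (∀ x i → Inverse.to f (x , i) ≡
    (Field._*_ F t (Inverse.to σ x) , n *ℓ i)) ×
    IsGraphIso F α β f) ×
    (∀ s → NZSq F s → n *ℓ α s ≡ β (Field._*_ F t (Inverse.to σ s))) ×
    CoverIsomorphic F (scaleV F n α) β
theorem4p1 p (suc r-1) q zero F pr _ _ _ _ prℓ = contradiction prℓ ¬prime[0]
theorem4p1 p (suc r-1) q (suc L) F pr _ q≡p^r card q%4≡1 prℓ ℓ≢p _ α β (_ , α-odd) (_ , β-odd) (f , iso)
  with parity p | trans (m≡m%n+[m/n]*n q 4) (cong (ℕ._+ q / 4 ℕ.* 4) q%4≡1)
-- An even p would make q = 1 + 4(q / 4) even.
... | h , inj₁ refl | q≡1+4k = contradiction
        (∣-trans (m∣m*n h) (subst (2 ℕ.* h ∣_) (trans (sym q≡p^r) q≡1+4k) (m∣m*n ((2 ℕ.* h) ^ r-1)))) (1+4k-odd (q / 4))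
theorem4p1 p (suc r-1) zero (suc L) F pr _ q≡p^r card q%4≡1 prℓ ℓ≢p _ α β (_ , α-odd) (_ , β-odd) (f , iso) | h , inj₂ refl | ()
theorem4p1 p (suc r-1) q@(suc n) (suc L) F pr _ q≡p^r card q%4≡1 prℓ ℓ≢p _ α β (_ , α-odd) (_ , β-odd) (f , iso) | h , inj₂ refl | q≡1+4k =
  t , t-square , σ , (σ-+ , σ-* , σ-1) , N , N-unit ,
  (standard , (λ _ _ → refl) , standard-iso) , voltages-≡ , covering , covering-iso , λ _ _ → refl
  where
  open Rigidity F card {h} pr {r-1} q≡p^r (q / 4 , half-even h (suc r-1) {k = q / 4} q≡p^r q≡1+4k) {L} prℓ ℓ≢p α β α-odd β-odd f iso
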